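{- There exist a constant $c>0$, an integer $k_0\ge 2$, and, for each integer $k\ge k_0$, a set $U_k$ of $k$-permutations such that $|U_k|/k!\to 1$ as $k\to\infty$ and, for every $k\ge k_0$, the limit $L(U_k)=\lim_{n\to\infty}S_n(U_k)^{1/n}$ exists (as a finite real number) and satisfies $$L(U_k)\ \ge\ 2^{c\,(k/\log k)^{1/4}}.$$
   Context: Write $[n]=\{1,\dots,n\}$. An $n$-permutation is a permutation of $[n]$. An $n$-permutation $\sigma$ contains a $k$-permutation $\pi$ if there are integers $1\le x_1<x_2<\dots<x_k\le n$ such that for all $1\le i,j\le k$ we have $\sigma(x_i)<\sigma(x_j)$ if and only if $\pi(i)<\pi(j)$; otherwise $\sigma$ avoids $\pi$. For a set $U$ of permutations, $S_n(U)$ is the number of $n$-permutations that avoid every permutation in $U$. Logarithms are base $2$. -}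

module Defs where

open import Algebra.Bundles using (CommutativeRing)
open import Data.Fin as Fin using (Fin; zero; suc; punchIn)
open import Data.Fin.Permutation using (Permutation′; _⟨$⟩ʳ_; insert; remove; insert-remove; insert-punchIn; _≈_; id)
import Data.Fin.Properties as Fin
open import Data.Integer as ℤ using (ℤ; +_; -[1+_])
import Data.Integer.Properties as ℤ
open import Data.List using (List; []; _∷_; length; filter; cartesianProductWith; allFin)
import Data.List.Membership.Propositional.Properties as ∈ₚ
import Data.List.Membership.Setoid as Membership
import Data.List.Membership.Setoid.Properties as ∈ₛ
open import Data.List.Relation.Unary.All as All using (All)
open import Data.List.Relation.Unary.AllPairs using ([]; _∷_)
open import Data.List.Relation.Unary.Any using (here)
import Data.List.Relation.Unary.Unique.Propositional.Properties as Unique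
open import Data.List.Relation.Unary.Unique.Setoid using (Unique)
import Data.List.Relation.Unary.Unique.Setoid.Properties as Uniqueₛ
open import Data.Nat as ℕ using (ℕ; zero; suc; NonZero)
import Data.Nat.Properties as ℕ
open import Data.Product using (∃; ∃₂; _×_; _,_; proj₁; proj₂)
open import Data.Rational using (ℚ; 0ℚ; 1ℚ; ½; _<_; _≤_; _≰_; _⊔_; ↥_; ↧ₙ_; mkℚ; *≤*; *<*; positive; nonNegative; >-nonZero)
import Data.Rational as ℚ
import Data.Rational.Properties as ℚ
import Data.Rational.Unnormalised as ℚᵘ
import Data.Rational.Unnormalised.Properties as ℚᵘₚ
open import Data.Sum using (_⊎_; inj₁; inj₂)
open import Function using (_∘_; _⇔_; mk⇔; Equivalence)
open import Level using (0ℓ)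
open import Relation.Binary using (Setoid; tri<; tri≈; tri>)
open import Relation.Binary.PropositionalEquality using (_≡_; _≢_; _≗_; refl; sym; trans; cong; subst; subst₂; setoid)
open import Relation.Nullary using (¬_; Dec; yes; no; contradiction)
open import Relation.Nullary.Decidable using (map′; _×-dec_; _→-dec_; ¬?)
open import Relation.Unary using (Pred; Decidable)

permutationSetoid : ℕ → Setoid 0ℓ 0ℓ
permutationSetoid n = record
  { Carrier       = Permutation′ n
  ; _≈_           = _≈_
  ; isEquivalence = record
    { refl  = λ _ → refl
    ; sym   = λ p i → sym (p i)
    ; trans = λ p q i → trans (p i) (q i)
    }
  }

permutations : ∀ n → List (Permutation′ n)
permutations zero    = id ∷ []
permutations (suc n) = cartesianProductWith (insert zero) (allFin (suc n)) (permutations n)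

private
  insert-cong : ∀ {n} {i j : Fin (suc n)} {π ρ : Permutation′ n} →
                i ≡ j → π ≈ ρ → insert zero i π ≈ insert zero j ρ
  insert-cong             refl π≈ρ zero    = refl
  insert-cong {i = i} {π = π} {ρ} refl π≈ρ (suc k) =
    trans (insert-punchIn zero i π k)
    (trans (cong (punchIn i) (π≈ρ k)) (sym (insert-punchIn zero i ρ k)))

  insert-injective : ∀ {n} {i j : Fin (suc n)} {π ρ : Permutation′ n} →
                     insert zero i π ≈ insert zero j ρ → i ≡ j × π ≈ ρ
  insert-injective {i = i} {π = π} {ρ} eq with eq zero
  ... | refl = refl , λ k → Fin.punchIn-injective i _ _
    (trans (sym (insert-punchIn zero i π k))
    (trans (eq (suc k)) (insert-punchIn zero i ρ k)))

permutations-complete : ∀ {n} (π : Permutation′ n) →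
  let open Membership (permutationSetoid n) in π ∈ permutations n
permutations-complete {zero}  π = here (λ ())
permutations-complete {suc n} π =
  ∈ₛ.∈-resp-≈ (permutationSetoid (suc n)) {x = insert zero (π ⟨$⟩ʳ zero) (remove zero π)} {π} (insert-remove zero π)
    (∈ₛ.∈-cartesianProductWith⁺ (setoid (Fin (suc n))) (permutationSetoid n) (permutationSetoid (suc n))
      (λ {i} {j} {π} {ρ} → insert-cong {i = i} {j} {π} {ρ}) (∈ₚ.∈-allFin (π ⟨$⟩ʳ zero)) (permutations-complete (remove zero π)))

permutations-unique : ∀ n → Unique (permutationSetoid n) (permutations n)
permutations-unique zero    = All.[] ∷ []
permutations-unique (suc n) =
  Uniqueₛ.cartesianProductWith⁺ (setoid (Fin (suc n))) (permutationSetoid n) (permutationSetoid (suc n))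
    (insert zero) (λ {i} {j} {π} {ρ} → insert-injective {i = i} {j} {π} {ρ}) (Unique.allFin⁺ (suc n)) (permutations-unique n)

Contains : ∀ {n k} → Permutation′ n → Permutation′ k → Set
Contains {n} {k} σ π = ∃ λ (x : Fin k → Fin n) →
  (∀ i j → i Fin.< j → x i Fin.< x j) ×
  (∀ i j → (σ ⟨$⟩ʳ x i Fin.< σ ⟨$⟩ʳ x j) ⇔ (π ⟨$⟩ʳ i Fin.< π ⟨$⟩ʳ j))

record PermutationSet (k : ℕ) : Set where
  field
    elements : List (Permutation′ k)
    distinct : Unique (permutationSetoid k) elements

  size : ℕ
  size = length elements

open PermutationSet public using (elements; distinct; size)

Avoids : ∀ {n k} → Permutation′ n → PermutationSet k → Set
Avoids σ U = All (λ π → ¬ Contains σ π) (elements U)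

private
  -- Without function extensionality, P must be assumed to respect _≗_.
  anyFunction? : ∀ {k n} {P : Pred (Fin k → Fin n) 0ℓ} →
                 (∀ {f g} → f ≗ g → P f → P g) → Decidable P → Dec (∃ P)
  anyFunction? {zero} resp P? =
    map′ (λ p → _ , p) (λ (f , p) → resp (λ ()) p) (P? λ ())
  anyFunction? {suc k} {n} {P} resp P? =
    map′ (λ (a , f , p) → cons a f , p)
         (λ (f , p) → f zero , f ∘ suc , resp (λ { zero → refl ; (suc i) → refl }) p)
         (Fin.any? λ a → anyFunction? (resp ∘ cons-cong a) (P? ∘ cons a))
    where
    cons : Fin n → (Fin k → Fin n) → Fin (suc k) → Fin n
    cons a f zero    = a
    cons a f (suc i) = f i

    cons-cong : ∀ a {f g} → f ≗ g → cons a f ≗ cons a g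
    cons-cong a f≗g zero    = refl
    cons-cong a f≗g (suc i) = f≗g i

  _⇔-dec_ : {A B : Set} → Dec A → Dec B → Dec (A ⇔ B)
  a? ⇔-dec b? = map′ (λ (f , g) → mk⇔ f g) (λ e → Equivalence.to e , Equivalence.from e)
                     ((a? →-dec b?) ×-dec (b? →-dec a?))

contains? : ∀ {n k} (σ : Permutation′ n) (π : Permutation′ k) → Dec (Contains σ π)
contains? σ π = anyFunction? resp λ x →
  (Fin.all? λ i → Fin.all? λ j → (i Fin.<? j) →-dec (x i Fin.<? x j)) ×-dec
  (Fin.all? λ i → Fin.all? λ j →
    ((σ ⟨$⟩ʳ x i) Fin.<? (σ ⟨$⟩ʳ x j)) ⇔-dec ((π ⟨$⟩ʳ i) Fin.<? (π ⟨$⟩ʳ j)))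
  where
  resp : ∀ {x y} → x ≗ y →
    (∀ i j → i Fin.< j → x i Fin.< x j) ×
    (∀ i j → (σ ⟨$⟩ʳ x i Fin.< σ ⟨$⟩ʳ x j) ⇔ (π ⟨$⟩ʳ i Fin.< π ⟨$⟩ʳ j)) →
    (∀ i j → i Fin.< j → y i Fin.< y j) ×
    (∀ i j → (σ ⟨$⟩ʳ y i Fin.< σ ⟨$⟩ʳ y j) ⇔ (π ⟨$⟩ʳ i Fin.< π ⟨$⟩ʳ j))
  resp x≗y (mono , iso) =
    (λ i j i<j → subst₂ Fin._<_ (x≗y i) (x≗y j) (mono i j i<j)) ,
    (λ i j → subst₂ (λ a b → (σ ⟨$⟩ʳ a Fin.< σ ⟨$⟩ʳ b) ⇔ (π ⟨$⟩ʳ i Fin.< π ⟨$⟩ʳ j))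
                    (x≗y i) (x≗y j) (iso i j))

avoids? : ∀ {n k} (U : PermutationSet k) (σ : Permutation′ n) → Dec (Avoids σ U)
avoids? U σ = All.all? (λ π → ¬? (contains? σ π)) (elements U)

S : ∀ {k} → ℕ → PermutationSet k → ℕ
S n U = length (filter (avoids? U) (permutations n))

open import Algebra.Properties.Semiring.Exp (CommutativeRing.semiring ℚ.+-*-commutativeRing) public
  using (_^_; ^-homo-*; ^-assocʳ)

fromℕ′ : ℕ → ℚ
fromℕ′ n = + n ℚ./ 1

2ℚ : ℚ
2ℚ = fromℕ′ 2

2^ℤ_ : ℤ → ℚ
2^ℤ (+ n)    = 2ℚ ^ n
2^ℤ -[1+ n ] = ½ ^ suc n

private
  0≤1 : 0ℚ ≤ 1ℚ
  0≤1 = *≤* (ℤ.+≤+ ℕ.z≤n)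

  0<1 : 0ℚ < 1ℚ
  0<1 = *<* (ℤ.+<+ (ℕ.s≤s ℕ.z≤n))

  1≤2 : 1ℚ ≤ 2ℚ
  1≤2 = *≤* (ℤ.+≤+ (ℕ.s≤s ℕ.z≤n))

  1<2 : 1ℚ < 2ℚ
  1<2 = *<* (ℤ.+<+ (ℕ.s≤s (ℕ.s≤s ℕ.z≤n)))

  ½≤1 : ½ ≤ 1ℚ
  ½≤1 = *≤* (ℤ.+≤+ (ℕ.s≤s ℕ.z≤n))

  0≤½ : 0ℚ ≤ ½
  0≤½ = *≤* (ℤ.+≤+ ℕ.z≤n)

  *-mono : ∀ {p q r s} → 0ℚ ≤ p → 0ℚ ≤ s → p ≤ q → r ≤ s → p ℚ.* r ≤ q ℚ.* s
  *-mono {p} {q} {r} {s} 0≤p 0≤s p≤q r≤s =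
    ℚ.≤-trans (ℚ.*-monoˡ-≤-nonNeg p {{nonNegative 0≤p}} r≤s)
              (ℚ.*-monoʳ-≤-nonNeg s {{nonNegative 0≤s}} p≤q)

  *-nonNeg : ∀ {p q} → 0ℚ ≤ p → 0ℚ ≤ q → 0ℚ ≤ p ℚ.* q
  *-nonNeg {p} {q} 0≤p 0≤q =
    subst (_≤ p ℚ.* q) (ℚ.*-zeroʳ p) (ℚ.*-monoˡ-≤-nonNeg p {{nonNegative 0≤p}} 0≤q)

  ^-nonNeg : ∀ {p} n → 0ℚ ≤ p → 0ℚ ≤ p ^ n
  ^-nonNeg zero    0≤p = 0≤1
  ^-nonNeg (suc n) 0≤p = *-nonNeg 0≤p (^-nonNeg n 0≤p)

  ^-monoˡ : ∀ {p q} n → 0ℚ ≤ p → p ≤ q → p ^ n ≤ q ^ n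
  ^-monoˡ zero    0≤p p≤q = ℚ.≤-refl
  ^-monoˡ (suc n) 0≤p p≤q =
    *-mono 0≤p (^-nonNeg n (ℚ.≤-trans 0≤p p≤q)) p≤q (^-monoˡ n 0≤p p≤q)

  1≤^ : ∀ {p} n → 1ℚ ≤ p → 1ℚ ≤ p ^ n
  1≤^ zero    1≤p = ℚ.≤-refl
  1≤^ {p} (suc n) 1≤p = *-mono 0≤1 (^-nonNeg n (ℚ.≤-trans 0≤1 1≤p)) 1≤p (1≤^ n 1≤p)

  ≤^ : ∀ {p} n .{{_ : NonZero n}} → 1ℚ ≤ p → p ≤ p ^ n
  ≤^ {p} (suc n) 1≤p = subst (_≤ p ^ suc n) (ℚ.*-identityʳ p)
    (*-mono (ℚ.≤-trans 0≤1 1≤p) (^-nonNeg n (ℚ.≤-trans 0≤1 1≤p)) (ℚ.≤-refl {p}) (1≤^ n 1≤p))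

  ^-monoˡ-< : ∀ {p q} n .{{_ : NonZero n}} → 0ℚ ≤ p → p < q → p ^ n < q ^ n
  ^-monoˡ-< {p} {q} (suc n) 0≤p p<q = ℚ.≤-<-trans
    (ℚ.*-monoˡ-≤-nonNeg p {{nonNegative 0≤p}} (^-monoˡ n 0≤p (ℚ.<⇒≤ p<q)))
    (ℚ.*-monoˡ-<-pos (q ^ n) {{positive (^-pos n)}} p<q)
    where
    ^-pos : ∀ n → 0ℚ < q ^ n
    ^-pos zero    = 0<1
    ^-pos (suc n) = subst (_< q ^ suc n) (ℚ.*-zeroʳ q)
      (ℚ.*-monoʳ-<-pos q {{positive (ℚ.≤-<-trans 0≤p p<q)}} (^-pos n))

  ^-cancelˡ : ∀ {p q} n .{{_ : NonZero n}} → 0ℚ ≤ q → p ^ n ≤ q ^ n → p ≤ q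
  ^-cancelˡ {p} {q} n 0≤q le with p ℚ.≤? q
  ... | yes p≤q = p≤q
  ... | no  p≰q = contradiction (ℚ.≤-<-trans le (^-monoˡ-< n 0≤q (ℚ.≰⇒> p≰q))) (ℚ.<-irrefl refl)

  2^-mono : ∀ {m n} → m ℕ.≤ n → 2ℚ ^ m ≤ 2ℚ ^ n
  2^-mono {n = n} ℕ.z≤n       = 1≤^ n 1≤2
  2^-mono         (ℕ.s≤s m≤n) = ℚ.*-monoˡ-≤-nonNeg 2ℚ (2^-mono m≤n)

  2^-mono-< : ∀ {m n} → m ℕ.< n → 2ℚ ^ m < 2ℚ ^ n
  2^-mono-< {m} m<n = ℚ.<-≤-trans
    (subst (_< 2ℚ ^ suc m) (ℚ.*-identityˡ (2ℚ ^ m))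
      (ℚ.*-monoˡ-<-pos (2ℚ ^ m) {{positive (ℚ.<-≤-trans 0<1 (1≤^ m 1≤2))}} 1<2))
    (2^-mono m<n)

  fromℕ′-suc : ∀ n → fromℕ′ (suc n) ≡ 1ℚ ℚ.+ fromℕ′ n
  fromℕ′-suc n = ℚ.toℚᵘ-injective (begin
    ℚ.toℚᵘ (fromℕ′ (suc n))              ≈⟨ ℚ.toℚᵘ-fromℚᵘ (ℚᵘ.mkℚᵘ (+ suc n) 0) ⟩
    ℚᵘ.mkℚᵘ (+ suc n) 0                  ≈⟨ ℚᵘ.*≡* (cong (λ m → (+ suc m) ℤ.* + 1) (sym (ℕ.*-identityʳ n))) ⟩
    ℚᵘ.mkℚᵘ (+ suc (n ℕ.* 1)) 0          ≈⟨ ℚᵘ.*≡* (cong (λ z → (+ 1 ℤ.+ z) ℤ.* + 1) (ℤ.pos-* n 1)) ⟩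
    ℚᵘ.1ℚᵘ ℚᵘ.+ ℚᵘ.mkℚᵘ (+ n) 0          ≈⟨ ℚᵘₚ.+-congʳ ℚᵘ.1ℚᵘ (ℚ.toℚᵘ-fromℚᵘ (ℚᵘ.mkℚᵘ (+ n) 0)) ⟨
    ℚ.toℚᵘ 1ℚ ℚᵘ.+ ℚ.toℚᵘ (fromℕ′ n)     ≈⟨ ℚ.toℚᵘ-homo-+ 1ℚ (fromℕ′ n) ⟨
    ℚ.toℚᵘ (1ℚ ℚ.+ fromℕ′ n)             ∎)
    where open ℚᵘₚ.≃-Reasoning

  0≤fromℕ′ : ∀ n → 0ℚ ≤ fromℕ′ n
  0≤fromℕ′ n = ℚ.nonNegative⁻¹ (fromℕ′ n) {{ℚ.normalize-nonNeg n 1}}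

  fromℕ′≤2^ : ∀ n → fromℕ′ n ≤ 2ℚ ^ n
  fromℕ′≤2^ zero    = 0≤1
  fromℕ′≤2^ (suc n) = begin
    fromℕ′ (suc n)              ≡⟨ fromℕ′-suc n ⟩
    1ℚ ℚ.+ fromℕ′ n             ≤⟨ ℚ.+-mono-≤ (1≤^ n 1≤2) (fromℕ′≤2^ n) ⟩
    2ℚ ^ n ℚ.+ 2ℚ ^ n           ≡⟨ cong (λ p → p ℚ.+ p) (ℚ.*-identityˡ (2ℚ ^ n)) ⟨
    1ℚ ℚ.* 2ℚ ^ n ℚ.+ 1ℚ ℚ.* 2ℚ ^ n ≡⟨ ℚ.*-distribʳ-+ (2ℚ ^ n) 1ℚ 1ℚ ⟨
    2ℚ ℚ.* 2ℚ ^ n               ∎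
    where open ℚ.≤-Reasoning

  drop-fromℕ′ : ∀ n → ℚ.toℚᵘ (fromℕ′ n) ℚᵘ.≃ ℚᵘ.mkℚᵘ (+ n) 0
  drop-fromℕ′ n = ℚ.toℚᵘ-fromℚᵘ (ℚᵘ.mkℚᵘ (+ n) 0)

  ≤fromℕ′ : ∀ p → p ≤ fromℕ′ ℤ.∣ ↥ p ∣
  ≤fromℕ′ p@(mkℚ a d _) = ℚ.toℚᵘ-cancel-≤ (ℚᵘₚ.≤-respʳ-≃ (ℚᵘₚ.≃-sym (drop-fromℕ′ ℤ.∣ a ∣))
    (ℚᵘ.*≤* (ℤ.≤-trans (ℤ.≤-reflexive (ℤ.*-identityʳ a)) (bound a))))
    where
    bound : ∀ a → a ℤ.≤ + ℤ.∣ a ∣ ℤ.* + suc d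
    bound (+ n)    = subst (+ n ℤ.≤_) (ℤ.pos-* n (suc d)) (ℤ.+≤+ (ℕ.m≤m*n n (suc d)))
    bound -[1+ n ] = ℤ.-≤+

  ≤fromℕ′⇒ : ∀ {r n} → r ≤ fromℕ′ n → ↥ r ℤ.≤ + (n ℕ.* ↧ₙ r)
  ≤fromℕ′⇒ {r@(mkℚ a d _)} {n} r≤n
    with ℚᵘ.*≤* le ← ℚᵘₚ.≤-respʳ-≃ (drop-fromℕ′ n) (ℚ.toℚᵘ-mono-≤ r≤n) =
    subst₂ ℤ._≤_ (ℤ.*-identityʳ a) (sym (ℤ.pos-* n (suc d))) le

  fromℕ′<⇒ : ∀ {r n} → fromℕ′ n < r → + (n ℕ.* ↧ₙ r) ℤ.< ↥ r
  fromℕ′<⇒ {r@(mkℚ a d _)} {n} n<r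
    with ℚᵘ.*<* lt ← ℚᵘₚ.<-respˡ-≃ (drop-fromℕ′ n) (ℚ.toℚᵘ-mono-< n<r) =
    subst₂ ℤ._<_ (sym (ℤ.pos-* n (suc d))) (ℤ.*-identityʳ a) lt

  2^ℤ≤ : ∀ {a n} → a ℤ.≤ + n → 2^ℤ a ≤ 2ℚ ^ n
  2^ℤ≤ (ℤ.+≤+ m≤n)            = 2^-mono m≤n
  2^ℤ≤ {n = n} (ℤ.-≤+ {m}) = ℚ.≤-trans (½^≤1 (suc m)) (1≤^ n 1≤2)
    where
    ½^≤1 : ∀ m → ½ ^ m ≤ 1ℚ
    ½^≤1 zero    = ℚ.≤-refl
    ½^≤1 (suc m) = *-mono 0≤½ 0≤1 ½≤1 (½^≤1 m)

  <2^ℤ : ∀ {a n} → + n ℤ.< a → 2ℚ ^ n < 2^ℤ a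
  <2^ℤ (ℤ.+<+ n<a) = 2^-mono-< n<a

-- Dedekind reals, presented by their lower cuts. These are the real numbers
-- of classical mathematics: no locatedness is required, so results about
-- them are meant to be read in the presence of excluded middle.
record ℝ : Set₁ where
  field
    lower     : ℚ → Set
    inhabited : ∃ lower
    bounded   : ∃ λ q → ¬ lower q
    downward  : ∀ {p q} → p < q → lower q → lower p
    rounded   : ∀ {p} → lower p → ∃ λ q → p < q × lower q

open ℝ public using (lower)

infix 4 _∈_ _∉_ _<ᴿ_ _≤ᴿ_ _⟶_
infixl 6 _+ᴿ_
infixl 7 _*ᴿ_

_∈_ _∉_ : ℚ → ℝ → Set
q ∈ x = lower x q
q ∉ x = ¬ (q ∈ x)

_≤ᴿ_ _<ᴿ_ : ℝ → ℝ → Set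
x ≤ᴿ y = ∀ q → q ∈ x → q ∈ y
x <ᴿ y = ∃ λ q → q ∈ y × q ∉ x

private
  ∈∉⇒< : ∀ x {p q} → p ∈ x → q ∉ x → p < q
  ∈∉⇒< x {p} {q} p∈x q∉x with ℚ.<-cmp p q
  ... | tri< p<q _ _  = p<q
  ... | tri≈ _ refl _ = contradiction p∈x q∉x
  ... | tri> _ _ q<p  = contradiction (ℝ.downward x q<p p∈x) q∉x

  p-1<p : ∀ p → p ℚ.- 1ℚ < p
  p-1<p p = subst (p ℚ.- 1ℚ <_) (ℚ.+-identityʳ p) (ℚ.+-monoʳ-< p (*<* ℤ.-<+))

sup : (P : ℚ → Set) → ∃ P → (∃ λ b → ∀ q → P q → q ≤ b) → ℝ
sup P (p , Pp) (b , ub) = record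
  { lower     = λ q → ∃ λ s → P s × q < s
  ; inhabited = p ℚ.- 1ℚ , p , Pp , p-1<p p
  ; bounded   = b , λ (s , Ps , b<s) → ℚ.<-irrefl refl (ℚ.<-≤-trans b<s (ub s Ps))
  ; downward  = λ p<q (s , Ps , q<s) → s , Ps , ℚ.<-trans p<q q<s
  ; rounded   = λ (s , Ps , p<s) → let q , p<q , q<s = ℚ.<-dense p<s in q , p<q , s , Ps , q<s
  }

fromℚ : ℚ → ℝ
fromℚ p = sup (_≡ p) (p , refl) (p , λ _ → ℚ.≤-reflexive)

fromℕ : ℕ → ℝ
fromℕ n = fromℚ (fromℕ′ n)

0ℝ 1ℝ : ℝ
0ℝ = fromℚ 0ℚ
1ℝ = fromℚ 1ℚ

_+ᴿ_ : ℝ → ℝ → ℝ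
x +ᴿ y = sup (λ s → ∃₂ λ p q → p ∈ x × q ∈ y × s ≡ p ℚ.+ q)
  (let p , p∈x = ℝ.inhabited x ; q , q∈y = ℝ.inhabited y in
   p ℚ.+ q , p , q , p∈x , q∈y , refl)
  (let b , b∉x = ℝ.bounded x ; c , c∉y = ℝ.bounded y in
   b ℚ.+ c , λ { _ (p , q , p∈x , q∈y , refl) →
     ℚ.+-mono-≤ (ℚ.<⇒≤ (∈∉⇒< x p∈x b∉x)) (ℚ.<⇒≤ (∈∉⇒< y q∈y c∉y)) })

-- Agrees with multiplication only for nonnegative x and y.
_*ᴿ_ : ℝ → ℝ → ℝ
x *ᴿ y = sup (λ s → s ≤ 0ℚ ⊎ ∃₂ λ p q → (0ℚ ≤ p × p ∈ x) × (0ℚ ≤ q × q ∈ y) × s ≡ p ℚ.* q)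
  (0ℚ , inj₁ ℚ.≤-refl)
  (let b , b∉x = ℝ.bounded x ; c , c∉y = ℝ.bounded y in
   (0ℚ ⊔ b ℚ.* c) , λ
     { s (inj₁ s≤0) → ℚ.≤-trans s≤0 (ℚ.p≤p⊔q 0ℚ (b ℚ.* c))
     ; _ (inj₂ (p , q , (0≤p , p∈x) , (0≤q , q∈y) , refl)) →
         let p<b = ∈∉⇒< x p∈x b∉x ; q<c = ∈∉⇒< y q∈y c∉y in
         ℚ.≤-trans (*-mono 0≤p (ℚ.≤-trans 0≤q (ℚ.<⇒≤ q<c)) (ℚ.<⇒≤ p<b) (ℚ.<⇒≤ q<c))
                   (ℚ.p≤q⊔p 0ℚ (b ℚ.* c)) })

-- 1/y is the supremum of 1/t over the rational upper bounds t of y > 0.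
recip : (y : ℝ) → 0ℝ <ᴿ y → ℝ
recip y (u , u∈y , u∉0) = sup (λ s → ∃ λ t → t ∉ y × s ℚ.* t ≡ 1ℚ)
  (let t , t∉y = ℝ.bounded y
       instance _ = >-nonZero (ℚ.<-trans 0<v (∈∉⇒< y v∈y t∉y)) in
   ℚ.1/ t , t , t∉y , ℚ.*-inverseˡ t)
  (1/v , λ s (t , t∉y , st≡1) → ≤1/v s t (∈∉⇒< y v∈y t∉y) st≡1)
  where
  v : ℚ
  v = proj₁ (ℝ.rounded y u∈y)

  v∈y : v ∈ y
  v∈y = proj₂ (proj₂ (ℝ.rounded y u∈y))

  0≤u : 0ℚ ≤ u
  0≤u = ℚ.≮⇒≥ (λ u<0 → u∉0 (0ℚ , refl , u<0))

  0<v : 0ℚ < v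
  0<v = ℚ.≤-<-trans 0≤u (proj₁ (proj₂ (ℝ.rounded y u∈y)))

  1/v : ℚ
  1/v = (ℚ.1/ v) {{>-nonZero 0<v}}

  1/v*v : 1/v ℚ.* v ≡ 1ℚ
  1/v*v = ℚ.*-inverseˡ v {{>-nonZero 0<v}}

  ≤1/v : ∀ s t → v < t → s ℚ.* t ≡ 1ℚ → s ≤ 1/v
  ≤1/v s t v<t st≡1 with s ℚ.≤? 0ℚ
  ... | yes s≤0 = ℚ.≤-trans s≤0 (ℚ.<⇒≤ (ℚ.positive⁻¹ 1/v {{ℚ.1/pos⇒pos v {{positive 0<v}}}}))
  ... | no  s≰0 = ℚ.*-cancelʳ-≤-pos v {{positive 0<v}}
    (subst (s ℚ.* v ≤_) (trans st≡1 (sym 1/v*v))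
      (ℚ.*-monoˡ-≤-nonNeg s {{nonNegative (ℚ.<⇒≤ (ℚ.≰⇒> s≰0))}} (ℚ.<⇒≤ v<t)))

-- Meaningful only for nonnegative x.
root : (n : ℕ) → .{{NonZero n}} → ℝ → ℝ
root n x = sup (λ s → s ≤ 0ℚ ⊎ s ^ n ∈ x) (0ℚ , inj₁ ℚ.≤-refl)
  (let b , b∉x = ℝ.bounded x in 1ℚ ⊔ b , λ
    { s (inj₁ s≤0) → ℚ.≤-trans s≤0 (ℚ.≤-trans 0≤1 (ℚ.p≤p⊔q 1ℚ b))
    ; s (inj₂ sⁿ∈x) → bound b s (∈∉⇒< x sⁿ∈x b∉x) })
  where
  bound : ∀ b s → s ^ n < b → s ≤ 1ℚ ⊔ b
  bound b s sⁿ<b with s ℚ.≤? 1ℚ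
  ... | yes s≤1 = ℚ.≤-trans s≤1 (ℚ.p≤p⊔q 1ℚ b)
  ... | no  s≰1 = ℚ.≤-trans (≤^ n (ℚ.<⇒≤ (ℚ.≰⇒> s≰1)))
                            (ℚ.≤-trans (ℚ.<⇒≤ sⁿ<b) (ℚ.p≤q⊔p 1ℚ b))

-- 2 to the power x is the supremum of 2^(a/b) over the rationals a/b < x,
-- where s ≤ 2^(a/b) means s^b ≤ 2^a.
exp₂ : ℝ → ℝ
exp₂ x = sup (λ s → 0ℚ ≤ s × ∃ λ r → r ∈ x × s ^ ↧ₙ r ≤ 2^ℤ (↥ r))
  (let r , r∈x = ℝ.inhabited x in
   0ℚ , ℚ.≤-refl , r , r∈x , ℚ.≤-trans (ℚ.≤-reflexive (0^ r)) (0≤2^ℤ (↥ r)))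
  (let b , b∉x = ℝ.bounded x ; m = ℤ.∣ ↥ b ∣ in
   2ℚ ^ m , λ s (0≤s , r , r∈x , le) →
     ^-cancelˡ (↧ₙ r) {{↧ₙ-nonZero r}} (^-nonNeg m (ℚ.≤-trans 0≤1 1≤2)) (ℚ.≤-trans le
       (ℚ.≤-trans (2^ℤ≤ (≤fromℕ′⇒ {r} {m} (ℚ.≤-trans (ℚ.<⇒≤ (∈∉⇒< x r∈x b∉x)) (≤fromℕ′ b))))
                  (ℚ.≤-reflexive (sym (^-assocʳ 2ℚ m (↧ₙ r)))))))
  where
  ↧ₙ-nonZero : ∀ r → NonZero (↧ₙ r)
  ↧ₙ-nonZero (mkℚ _ _ _) = _

  0^ : ∀ r → 0ℚ ^ ↧ₙ r ≡ 0ℚ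
  0^ (mkℚ _ d _) = ℚ.*-zeroˡ (0ℚ ^ d)

  0≤2^ℤ : ∀ a → 0ℚ ≤ 2^ℤ a
  0≤2^ℤ (+ n)    = ^-nonNeg n (ℚ.≤-trans 0≤1 1≤2)
  0≤2^ℤ -[1+ n ] = ^-nonNeg (suc n) 0≤½

-- log₂ n is the supremum of the rationals a/b with 2^a ≤ n^b.
log₂ : (n : ℕ) → .{{NonZero n}} → ℝ
log₂ n = sup (λ r → 2^ℤ (↥ r) ≤ fromℕ′ n ^ ↧ₙ r)
  (0ℚ , subst (1ℚ ≤_) (sym (ℚ.*-identityʳ (fromℕ′ n))) (1≤fromℕ′ n))
  (fromℕ′ n , bound)
  where
  1≤fromℕ′ : ∀ n → .{{NonZero n}} → 1ℚ ≤ fromℕ′ n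
  1≤fromℕ′ (suc n) = subst (1ℚ ≤_) (sym (fromℕ′-suc n))
    (subst (_≤ 1ℚ ℚ.+ fromℕ′ n) (ℚ.+-identityʳ 1ℚ) (ℚ.+-monoʳ-≤ 1ℚ (0≤fromℕ′ n)))

  bound : ∀ r → 2^ℤ (↥ r) ≤ fromℕ′ n ^ ↧ₙ r → r ≤ fromℕ′ n
  bound r le with r ℚ.≤? fromℕ′ n
  ... | yes r≤n = r≤n
  ... | no  r≰n = contradiction
    (ℚ.<-≤-trans (<2^ℤ (fromℕ′<⇒ {r} {n} (ℚ.≰⇒> r≰n)))
      (ℚ.≤-trans le (ℚ.≤-trans (^-monoˡ (↧ₙ r) (0≤fromℕ′ n) (fromℕ′≤2^ n))
        (ℚ.≤-reflexive (^-assocʳ 2ℚ n (↧ₙ r))))))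
    (ℚ.<-irrefl refl)

log₂-positive : ∀ n .{{_ : NonZero n}} → 2 ℕ.≤ n → 0ℝ <ᴿ log₂ n
log₂-positive n 2≤n = 0ℚ , (1ℚ , subst₂ _≤_ (sym (ℚ.*-identityʳ 2ℚ)) (sym (ℚ.*-identityʳ (fromℕ′ n))) 2≤ , 0<1) ,
  λ { (_ , refl , 0<0) → ℚ.<-irrefl refl 0<0 }
  where
  2≤ : 2ℚ ≤ fromℕ′ n
  2≤ = ℚ.toℚᵘ-cancel-≤ (ℚᵘₚ.≤-respʳ-≃ (ℚᵘₚ.≃-sym (drop-fromℕ′ n))
         (ℚᵘ.*≤* (ℤ.*-monoʳ-≤-nonNeg (+ 1) (ℤ.+≤+ 2≤n))))

n/log₂n : (n : ℕ) → 2 ℕ.≤ n → ℝ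
n/log₂n n 2≤n = fromℕ n *ᴿ recip (log₂ n) (log₂-positive n 2≤n)
  where instance _ = ℕ.>-nonZero (ℕ.<-trans (ℕ.s≤s ℕ.z≤n) 2≤n)

-- The two inequalities say |aₙ - l| < ε.
_⟶_ : (ℕ → ℝ) → ℝ → Set
a ⟶ l = ∀ ε → 0ℚ < ε → ∃ λ N → ∀ n → N ℕ.≤ n →
  a n <ᴿ l +ᴿ fromℚ ε × l <ᴿ a n +ᴿ fromℚ ε

{-# OPTIONS --safe #-}

-- Let U_k consist of the k-permutations that hit every block of a ρ × ρ grid and are slightly restricted at both
-- ends. A union bound shows that these are almost all k-permutations, even for ρ² of order k / log k. They are skew
-- indecomposable, so their avoiders are closed under skew sums, and Fekete's lemma together with the Marcus–Tardos
-- bound for matrices without the interval minor J_k yields the limit.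
--
-- For the lower bound, keep each pair of dyadic intervals of 2^α rows and 2^β columns with probability 1 - 1/Q,
-- and let a cell be a one when all pairs containing it are kept. Disjoint intervals have distinct least common
-- dyadic ancestors, so a minor J_r would be a kept r × r biclique. With r of order h² none survives, while many
-- rows still have 2^(2h) ones. Choosing one of them in each of n such rows, and ordering the chosen points by
-- column first, gives 2^(h n) permutations of length n none of which contains a permutation hitting every block
-- of a 3r × 3r grid. For 3r = ρ this h is of order (k / log k)^(1/4).
module Submission where

-- The fourth root comes from the number of dyadic levels. A cell lies in about `h²` pairs of
-- intervals, so `Q` must be of order `h` for it to survive with probability `2^(-O(h))`. There are
-- `2^(O(h r))` bicliques, each surviving with probability at most `2^(-r²/Q)`; hence `r` must be of
-- order `h Q`, that is `h²`, and `ρ²` is of order `h⁴`. Different choices of ones may yield the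
-- same permutation. A choice is recovered from the permutation and the number of points left of
-- each column, so the matrix is given far fewer columns (`2^(6h)`) than chosen rows (`2^(12h)`):
-- this loses only a factor `2^(h n)` out of `2^(2h n)`. A single length `n` is enough, because the
-- limit of the roots of a supermultiplicative sequence is their supremum. A permutation that hits
-- every block may still start with its maximum or end with its minimum, and is then skew
-- decomposable; the end conditions exclude such cuts at a cost of order `1/h`. All probabilities
-- are cleared of denominators, so that the combinatorics takes place in the natural numbers.

module Arithmetic where

  -- Power inequalities on natural numbers

  open import Data.Nat
  open import Data.Nat.Properties
  open import Data.Nat.Tactic.RingSolver using (solve-∀)
  open import Relation.Binary.PropositionalEquality

  module _ where
    open ≤-Reasoning

    -- After division by `x ^ suc n` this is Bernoulli's inequality `(1 + y/x)^n ≥ 1 + n y/x`.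
    bernoulli : ∀ n x y → x ^ n * (x + n * y) ≤ (x + y) ^ n * x
    bernoulli zero    x y = ≤-reflexive (cong (1 *_) (+-identityʳ x))
    bernoulli (suc n) x y = begin
      x * x ^ n * (x + (y + n * y))        ≤⟨ m≤m+n _ (x ^ n * (n * y * y)) ⟩
      x * x ^ n * (x + (y + n * y)) + x ^ n * (n * y * y) ≡⟨ expand x y n (x ^ n) ⟩
      (x + y) * (x ^ n * (x + n * y))      ≤⟨ *-monoʳ-≤ (x + y) (bernoulli n x y) ⟩
      (x + y) * ((x + y) ^ n * x)          ≡⟨ *-assoc (x + y) _ x ⟨
      (x + y) * (x + y) ^ n * x            ∎
      where
      expand : ∀ x y n p → x * p * (x + (y + n * y)) + p * (n * y * y) ≡ (x + y) * (p * (x + n * y))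
      expand = solve-∀

    -- Bernoulli's inequality for the base `1 - y/(x + y)`, with denominators cleared and the
    -- subtracted term moved to the other side.
    bernoulli′ : ∀ n x y → (x + y) ^ n * (x + y) ≤ x ^ n * (x + y) + n * y * (x + y) ^ n
    bernoulli′ zero    x y = m≤m+n _ _
    bernoulli′ (suc n) x y = begin
      (x + y) * p * (x + y)                              ≡⟨ *-assoc (x + y) p (x + y) ⟩
      (x + y) * (p * (x + y))                            ≤⟨ *-monoʳ-≤ (x + y) (bernoulli′ n x y) ⟩
      (x + y) * (x ^ n * (x + y) + n * y * p)            ≡⟨ expand x y (x ^ n) n p ⟩
      x * x ^ n * (x + y) + y * ((x + y) * x ^ n) + n * y * ((x + y) * p)
        ≤⟨ +-monoˡ-≤ _ (+-monoʳ-≤ (x * x ^ n * (x + y)) (*-monoʳ-≤ y (*-monoʳ-≤ (x + y) (^-monoˡ-≤ n (m≤m+n x y))))) ⟩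
      x * x ^ n * (x + y) + y * ((x + y) * p) + n * y * ((x + y) * p)
        ≡⟨ collect (x * x ^ n * (x + y)) y n ((x + y) * p) ⟩
      x * x ^ n * (x + y) + (y + n * y) * ((x + y) * p)  ∎
      where
      p : ℕ
      p = (x + y) ^ n
      expand : ∀ x y u n p → (x + y) * (u * (x + y) + n * y * p) ≡ x * u * (x + y) + y * ((x + y) * u) + n * y * ((x + y) * p)
      expand = solve-∀
      collect : ∀ a y n b → a + y * b + n * y * b ≡ a + (y + n * y) * b
      collect = solve-∀

    -- With `x = Q - 1`, `y = 1` and `n = Q` this reads `(1 - 1/Q)^Q ≤ 1/2`. Together with
    -- `halving`, its counterpart at exponent `Q/2`, it replaces estimates by exponentials:
    -- `iterate-≤` and `iterate-≥` turn batches of factors into powers of two.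
    doubling : ∀ n x y .{{_ : NonZero x}} → x ≤ n * y → x ^ n * 2 ≤ (x + y) ^ n
    doubling n x y x≤ny = *-cancelʳ-≤ _ _ x (begin
      x ^ n * 2 * x       ≡⟨ twice (x ^ n) x ⟩
      x ^ n * (x + x)     ≤⟨ *-monoʳ-≤ (x ^ n) (+-monoʳ-≤ x x≤ny) ⟩
      x ^ n * (x + n * y) ≤⟨ bernoulli n x y ⟩
      (x + y) ^ n * x     ∎)
      where
      twice : ∀ p x → p * 2 * x ≡ p * (x + x)
      twice = solve-∀

    halving : ∀ n x y .{{_ : NonZero (x + y)}} → 2 * (n * y) ≤ x + y → (x + y) ^ n ≤ x ^ n * 2
    halving n x y 2ny≤ = *-cancelʳ-≤ _ _ (x + y) (+-cancelʳ-≤ (p * (x + y)) _ _ (begin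
      p * (x + y) + p * (x + y)          ≡⟨ twice (p * (x + y)) ⟩
      2 * (p * (x + y))                  ≤⟨ *-monoʳ-≤ 2 (bernoulli′ n x y) ⟩
      2 * (x ^ n * (x + y) + n * y * p)  ≡⟨ distrib (x ^ n) (x + y) (n * y) p ⟩
      x ^ n * 2 * (x + y) + p * (2 * (n * y)) ≤⟨ +-monoʳ-≤ (x ^ n * 2 * (x + y)) (*-monoʳ-≤ p 2ny≤) ⟩
      x ^ n * 2 * (x + y) + p * (x + y)  ∎))
      where
      p : ℕ
      p = (x + y) ^ n
      twice : ∀ z → z + z ≡ 2 * z
      twice = solve-∀
      distrib : ∀ u z w p → 2 * (u * z + w * p) ≡ u * 2 * z + p * (2 * w)
      distrib = solve-∀

    ^-distribʳ-* : ∀ n x y → (x * y) ^ n ≡ x ^ n * y ^ n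
    ^-distribʳ-* zero    x y = refl
    ^-distribʳ-* (suc n) x y = trans (cong (x * y *_) (^-distribʳ-* n x y)) (swap x y (x ^ n) (y ^ n))
      where
      swap : ∀ a b c d → a * b * (c * d) ≡ a * c * (b * d)
      swap = solve-∀

    iterate-≤ : ∀ n j {x z w} → x ^ n * w ≤ z ^ n → x ^ (n * j) * w ^ j ≤ z ^ (n * j)
    iterate-≤ n j {x} {z} {w} le = begin
      x ^ (n * j) * w ^ j ≡⟨ cong (_* w ^ j) (^-*-assoc x n j) ⟨
      (x ^ n) ^ j * w ^ j ≡⟨ ^-distribʳ-* j (x ^ n) w ⟨
      (x ^ n * w) ^ j     ≤⟨ ^-monoˡ-≤ j le ⟩
      (z ^ n) ^ j         ≡⟨ ^-*-assoc z n j ⟩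
      z ^ (n * j)         ∎

    iterate-≥ : ∀ n j {x z w} → z ^ n ≤ x ^ n * w → z ^ (n * j) ≤ x ^ (n * j) * w ^ j
    iterate-≥ n j {x} {z} {w} le = begin
      z ^ (n * j)         ≡⟨ ^-*-assoc z n j ⟨
      (z ^ n) ^ j         ≤⟨ ^-monoˡ-≤ j le ⟩
      (x ^ n * w) ^ j     ≡⟨ ^-distribʳ-* j (x ^ n) w ⟩
      (x ^ n) ^ j * w ^ j ≡⟨ cong (_* w ^ j) (^-*-assoc x n j) ⟩
      x ^ (n * j) * w ^ j ∎

    extend-≤ : ∀ {x z w m n} → x ≤ z → m ≤ n → x ^ m * w ≤ z ^ m → x ^ n * w ≤ z ^ n
    extend-≤ {x} {z} {w} {m} {n} x≤z m≤n le = begin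
      x ^ n * w                  ≡⟨ cong (λ n → x ^ n * w) (m+[n∸m]≡n m≤n) ⟨
      x ^ (m + (n ∸ m)) * w      ≡⟨ cong (_* w) (^-distribˡ-+-* x m (n ∸ m)) ⟩
      x ^ m * x ^ (n ∸ m) * w    ≡⟨ swap (x ^ m) (x ^ (n ∸ m)) w ⟩
      x ^ m * w * x ^ (n ∸ m)    ≤⟨ *-mono-≤ le (^-monoˡ-≤ (n ∸ m) x≤z) ⟩
      z ^ m * z ^ (n ∸ m)        ≡⟨ ^-distribˡ-+-* z m (n ∸ m) ⟨
      z ^ (m + (n ∸ m))          ≡⟨ cong (z ^_) (m+[n∸m]≡n m≤n) ⟩
      z ^ n                      ∎
      where
      swap : ∀ a b c → a * b * c ≡ a * c * b
      swap = solve-∀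

    n<2^n : ∀ n → n < 2 ^ n
    n<2^n zero    = ≤-refl
    n<2^n (suc n) = begin
      suc (suc n)     ≤⟨ s≤s (n<2^n n) ⟩
      1 + 2 ^ n       ≤⟨ +-monoˡ-≤ (2 ^ n) (m^n>0 2 n) ⟩
      2 ^ n + 2 ^ n   ≡⟨ cong (2 ^ n +_) (+-identityʳ (2 ^ n)) ⟨
      2 ^ suc n       ∎

-- Rational arithmetic, lower cuts and Fekete's lemma

module Analysis where

  open import Algebra.Bundles using (CommutativeRing)
  open import Axiom.ExcludedMiddle using (ExcludedMiddle)
  open import Data.Integer as ℤ using (ℤ; +_; -[1+_])
  import Data.Integer.Properties as ℤ
  open import Data.Nat as ℕ using (ℕ; zero; suc; NonZero; z≤n; s≤s)
  import Data.Nat.Properties as ℕ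
  import Data.Nat.Coprimality as Coprime
  import Data.Nat.DivMod as ℕ
  open import Data.Nat.Tactic.RingSolver using (solve-∀)
  open import Data.Product using (Σ; ∃; ∃₂; _×_; _,_; proj₁; proj₂)
  open import Data.Rational as ℚ using (ℚ; 0ℚ; 1ℚ; ½; _<_; _≤_; _+_; _*_; _-_; -_; ↥_; ↧ₙ_; mkℚ; *≤*; *<*; positive; nonNegative; >-nonZero; 1/_)
  import Data.Rational.Properties as ℚ
  import Data.Rational.Unnormalised as ℚᵘ
  import Data.Rational.Unnormalised.Properties as ℚᵘ
  open import Data.Sum using (_⊎_; inj₁; inj₂)
  open import Function using (_∘_)
  open import Level using (0ℓ)
  open import Relation.Binary using (tri<; tri≈; tri>)
  open import Relation.Binary.PropositionalEquality
  open import Relation.Nullary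
  open import Algebra.Properties.CommutativeSemiring.Exp (CommutativeRing.commutativeSemiring ℚ.+-*-commutativeRing) using (^-distrib-*)
  open import Algebra.Properties.Group ℚ.+-0-group using (⁻¹-involutive)
  open import Defs
  open Arithmetic using (bernoulli; ^-distribʳ-*)

  private
    ι : ℕ → ℚ
    ι = fromℕ′

  ℚ-<⇒≱ : ∀ {p q} → p < q → ¬ (q ≤ p)
  ℚ-<⇒≱ p<q q≤p = ℚ.<-irrefl refl (ℚ.<-≤-trans p<q q≤p)

  ℚ-≤⇒≯ : ∀ {p q} → p ≤ q → ¬ (q < p)
  ℚ-≤⇒≯ p≤q q<p = ℚ-<⇒≱ q<p p≤q

  fromℕ′-toℚᵘ : ∀ n → ℚ.toℚᵘ (ι n) ℚᵘ.≃ ℚᵘ.mkℚᵘ (+ n) 0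
  fromℕ′-toℚᵘ n = ℚ.toℚᵘ-fromℚᵘ (ℚᵘ.mkℚᵘ (+ n) 0)

  fromℕ′-+ : ∀ m n → ι (m ℕ.+ n) ≡ ι m + ι n
  fromℕ′-+ m n = ℚ.toℚᵘ-injective (begin
    ℚ.toℚᵘ (ι (m ℕ.+ n))                          ≈⟨ fromℕ′-toℚᵘ (m ℕ.+ n) ⟩
    ℚᵘ.mkℚᵘ (+ (m ℕ.+ n)) 0                       ≈⟨ ℚᵘ.*≡* (cong (ℤ._* + 1) (cong₂ ℤ._+_ (sym (ℤ.*-identityʳ (+ m))) (sym (ℤ.*-identityʳ (+ n))))) ⟩
    ℚᵘ.mkℚᵘ (+ m) 0 ℚᵘ.+ ℚᵘ.mkℚᵘ (+ n) 0          ≈⟨ ℚᵘ.+-cong (fromℕ′-toℚᵘ m) (fromℕ′-toℚᵘ n) ⟨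
    ℚ.toℚᵘ (ι m) ℚᵘ.+ ℚ.toℚᵘ (ι n)                ≈⟨ ℚ.toℚᵘ-homo-+ (ι m) (ι n) ⟨
    ℚ.toℚᵘ (ι m + ι n)                            ∎)
    where open ℚᵘ.≃-Reasoning

  fromℕ′-* : ∀ m n → ι (m ℕ.* n) ≡ ι m * ι n
  fromℕ′-* m n = ℚ.toℚᵘ-injective (begin
    ℚ.toℚᵘ (ι (m ℕ.* n))                          ≈⟨ fromℕ′-toℚᵘ (m ℕ.* n) ⟩
    ℚᵘ.mkℚᵘ (+ (m ℕ.* n)) 0                       ≈⟨ ℚᵘ.*≡* (cong (ℤ._* + 1) (ℤ.pos-* m n)) ⟩
    ℚᵘ.mkℚᵘ (+ m) 0 ℚᵘ.* ℚᵘ.mkℚᵘ (+ n) 0          ≈⟨ ℚᵘ.*-cong (fromℕ′-toℚᵘ m) (fromℕ′-toℚᵘ n) ⟨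
    ℚ.toℚᵘ (ι m) ℚᵘ.* ℚ.toℚᵘ (ι n)                ≈⟨ ℚ.toℚᵘ-homo-* (ι m) (ι n) ⟨
    ℚ.toℚᵘ (ι m * ι n)                            ∎)
    where open ℚᵘ.≃-Reasoning

  fromℕ′-^ : ∀ m n → ι (m ℕ.^ n) ≡ ι m ^ n
  fromℕ′-^ m zero    = refl
  fromℕ′-^ m (suc n) = trans (fromℕ′-* m (m ℕ.^ n)) (cong (ι m *_) (fromℕ′-^ m n))

  fromℕ′-mono-≤ : ∀ {m n} → m ℕ.≤ n → ι m ≤ ι n
  fromℕ′-mono-≤ {m} {n} m≤n = ℚ.toℚᵘ-cancel-≤ (ℚᵘ.≤-respˡ-≃ (ℚᵘ.≃-sym (fromℕ′-toℚᵘ m)) (ℚᵘ.≤-respʳ-≃ (ℚᵘ.≃-sym (fromℕ′-toℚᵘ n))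
    (ℚᵘ.*≤* (ℤ.*-monoʳ-≤-nonNeg (+ 1) (ℤ.+≤+ m≤n)))))

  fromℕ′-mono-< : ∀ {m n} → m ℕ.< n → ι m < ι n
  fromℕ′-mono-< {m} {n} m<n = ℚ.toℚᵘ-cancel-< (ℚᵘ.<-respˡ-≃ (ℚᵘ.≃-sym (fromℕ′-toℚᵘ m)) (ℚᵘ.<-respʳ-≃ (ℚᵘ.≃-sym (fromℕ′-toℚᵘ n))
    (ℚᵘ.*<* (ℤ.*-monoʳ-<-pos (+ 1) (ℤ.+<+ m<n)))))

  fromℕ′-cancel-≤ : ∀ m n → ι m ≤ ι n → m ℕ.≤ n
  fromℕ′-cancel-≤ m n le = ℕ.≮⇒≥ λ n<m → ℚ-<⇒≱ (fromℕ′-mono-< {n} {m} n<m) le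

  fromℕ′-cancel-< : ∀ m n → ι m < ι n → m ℕ.< n
  fromℕ′-cancel-< m n lt = ℕ.≰⇒> λ n≤m → ℚ-<⇒≱ lt (fromℕ′-mono-≤ {n} {m} n≤m)

  0≤ι : ∀ n → 0ℚ ≤ ι n
  0≤ι n = fromℕ′-mono-≤ {0} {n} z≤n

  0<ι : ∀ n → .{{NonZero n}} → 0ℚ < ι n
  0<ι n@(suc _) = fromℕ′-mono-< {0} {n} (s≤s z≤n)

  numerator : ℚ → ℕ
  numerator p = ℤ.∣ ↥ p ∣

  instance
    ↧ₙ-nonZero : ∀ {p} → NonZero (↧ₙ p)
    ↧ₙ-nonZero {mkℚ _ _ _} = _

  denominator-* : ∀ p → 0ℚ ≤ p → ι (↧ₙ p) * p ≡ ι (numerator p)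
  denominator-* p@(mkℚ (+ u) d _) 0≤p = ℚ.toℚᵘ-injective (begin
    ℚ.toℚᵘ (ι (suc d) * p)                        ≈⟨ ℚ.toℚᵘ-homo-* (ι (suc d)) p ⟩
    ℚ.toℚᵘ (ι (suc d)) ℚᵘ.* ℚᵘ.mkℚᵘ (+ u) d       ≈⟨ ℚᵘ.*-cong (fromℕ′-toℚᵘ (suc d)) ℚᵘ.≃-refl ⟩
    ℚᵘ.mkℚᵘ (+ suc d) 0 ℚᵘ.* ℚᵘ.mkℚᵘ (+ u) d      ≈⟨ ℚᵘ.*≡* (trans (ℤ.*-identityʳ (+ suc d ℤ.* + u)) (trans (ℤ.*-comm (+ suc d) (+ u)) (cong (λ n → + u ℤ.* + suc n) (sym (ℕ.+-identityʳ d))))) ⟩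
    ℚᵘ.mkℚᵘ (+ u) 0                               ≈⟨ fromℕ′-toℚᵘ u ⟨
    ℚ.toℚᵘ (ι u)                                  ∎)
    where open ℚᵘ.≃-Reasoning
  denominator-* (mkℚ -[1+ _ ] _ _) (*≤* ())

  denominator-^ : ∀ p n → 0ℚ ≤ p → ι (↧ₙ p ℕ.^ n) * p ^ n ≡ ι (numerator p ℕ.^ n)
  denominator-^ p n 0≤p = begin
    ι (↧ₙ p ℕ.^ n) * p ^ n ≡⟨ cong (_* p ^ n) (fromℕ′-^ (↧ₙ p) n) ⟩
    ι (↧ₙ p) ^ n * p ^ n   ≡⟨ ^-distrib-* (ι (↧ₙ p)) p n ⟨
    (ι (↧ₙ p) * p) ^ n     ≡⟨ cong (_^ n) (denominator-* p 0≤p) ⟩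
    ι (numerator p) ^ n    ≡⟨ fromℕ′-^ (numerator p) n ⟨
    ι (numerator p ℕ.^ n)  ∎
    where open ≡-Reasoning

  -- The passage from inequalities between a rational and an integer to inequalities of natural
  -- numbers, where the power estimates live.
  module Scaled (D X : ℕ) .{{_ : NonZero D}} {x : ℚ} (eq : ι D * x ≡ ι X) where
    private
      instance
        D-pos : ℚ.Positive (ι D)
        D-pos = positive (0<ι D)
        D-nonNeg : ℚ.NonNegative (ι D)
        D-nonNeg = nonNegative (0≤ι D)

      split : ∀ a → ι D * ι a ≡ ι (a ℕ.* D)
      split a = trans (ℚ.*-comm (ι D) (ι a)) (sym (fromℕ′-* a D))

    <⇒ : ∀ a → x < ι a → X ℕ.< a ℕ.* D
    <⇒ a lt = fromℕ′-cancel-< X (a ℕ.* D) (subst₂ _<_ eq (split a) (ℚ.*-monoʳ-<-pos (ι D) lt))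

    ≤⇒ : ∀ a → x ≤ ι a → X ℕ.≤ a ℕ.* D
    ≤⇒ a le = fromℕ′-cancel-≤ X (a ℕ.* D) (subst₂ _≤_ eq (split a) (ℚ.*-monoˡ-≤-nonNeg (ι D) le))

    <⇐ : ∀ a → X ℕ.< a ℕ.* D → x < ι a
    <⇐ a lt = ℚ.*-cancelˡ-<-nonNeg (ι D) (subst₂ _<_ (sym eq) (sym (split a)) (fromℕ′-mono-< {X} {a ℕ.* D} lt))

  module Powers (p : ℚ) (0≤p : 0ℚ ≤ p) where
    open Scaled using (<⇒; ≤⇒; <⇐)

    pow-<⇒ : ∀ n a → p ^ n < ι a → numerator p ℕ.^ n ℕ.< a ℕ.* ↧ₙ p ℕ.^ n
    pow-<⇒ n = <⇒ (↧ₙ p ℕ.^ n) (numerator p ℕ.^ n) {{ℕ.m^n≢0 (↧ₙ p) n}} (denominator-^ p n 0≤p)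

    pow-≤⇒ : ∀ n a → p ^ n ≤ ι a → numerator p ℕ.^ n ℕ.≤ a ℕ.* ↧ₙ p ℕ.^ n
    pow-≤⇒ n = ≤⇒ (↧ₙ p ℕ.^ n) (numerator p ℕ.^ n) {{ℕ.m^n≢0 (↧ₙ p) n}} (denominator-^ p n 0≤p)

    pow-<⇐ : ∀ n a → numerator p ℕ.^ n ℕ.< a ℕ.* ↧ₙ p ℕ.^ n → p ^ n < ι a
    pow-<⇐ n = <⇐ (↧ₙ p ℕ.^ n) (numerator p ℕ.^ n) {{ℕ.m^n≢0 (↧ₙ p) n}} (denominator-^ p n 0≤p)

    <⇐′ : ∀ a → numerator p ℕ.< a ℕ.* ↧ₙ p → p < ι a
    <⇐′ = <⇐ (↧ₙ p) (numerator p) (denominator-* p 0≤p)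

  ^-cancel-< : ∀ {x y} n → x ℕ.^ n ℕ.< y ℕ.^ n → x ℕ.< y
  ^-cancel-< n lt = ℕ.≰⇒> λ y≤x → ℕ.<⇒≱ lt (ℕ.^-monoˡ-≤ n y≤x)

  ≤numerator : ∀ p → p ≤ ι (numerator p)
  ≤numerator p with 0ℚ ℚ.≤? p
  ... | no 0≰p = ℚ.≤-trans (ℚ.<⇒≤ (ℚ.≰⇒> 0≰p)) (0≤ι (numerator p))
  ... | yes 0≤p = begin
    p                 ≡⟨ ℚ.*-identityˡ p ⟨
    1ℚ * p            ≤⟨ ℚ.*-monoʳ-≤-nonNeg p {{nonNegative 0≤p}} (fromℕ′-mono-≤ {1} {↧ₙ p} (ℕ.>-nonZero⁻¹ (↧ₙ p) {{↧ₙ-nonZero {p}}})) ⟩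
    ι (↧ₙ p) * p      ≡⟨ denominator-* p 0≤p ⟩
    ι (numerator p)   ∎
    where open ℚ.≤-Reasoning

  archimedean : ∀ p δ → 0ℚ < δ → ∃ λ n → p ≤ ι n * δ
  archimedean p δ 0<δ = numerator (p * 1/δ) , (begin
    p                        ≡⟨ ℚ.*-identityʳ p ⟨
    p * 1ℚ                   ≡⟨ cong (p *_) (ℚ.*-inverseˡ δ {{>-nonZero 0<δ}}) ⟨
    p * (1/δ * δ)            ≡⟨ ℚ.*-assoc p 1/δ δ ⟨
    p * 1/δ * δ              ≤⟨ ℚ.*-monoʳ-≤-nonNeg δ {{nonNegative (ℚ.<⇒≤ 0<δ)}} (≤numerator (p * 1/δ)) ⟩
    ι (numerator (p * 1/δ)) * δ ∎)
    where
    open ℚ.≤-Reasoning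
    1/δ : ℚ
    1/δ = (1/ δ) {{>-nonZero 0<δ}}

  p<p+ε : ∀ p {ε} → 0ℚ < ε → p < p + ε
  p<p+ε p 0<ε = subst (_< p + _) (ℚ.+-identityʳ p) (ℚ.+-monoʳ-< p 0<ε)

  ∈-+ : ∀ x {p q ε} → p ∈ x → q < p + ε → q ∈ x +ᴿ fromℚ ε
  ∈-+ x {p} {q} {ε} p∈x q<p+ε = p + (ε - η) , (p , ε - η , p∈x , (ε , refl , ε-η<ε) , refl) , q<
    where
    gap : ∃ λ t → q < t × t < p + ε
    gap = ℚ.<-dense q<p+ε
    t : ℚ
    t = proj₁ gap
    η : ℚ
    η = p + ε - t
    0<η : 0ℚ < η
    0<η = subst (_< η) (ℚ.+-inverseʳ t) (ℚ.+-monoˡ-< (- t) (proj₂ (proj₂ gap)))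
    ε-η<ε : ε - η < ε
    ε-η<ε = subst (ε - η <_) (trans (ℚ.+-assoc ε (- η) η) (trans (cong (λ z → ε + z) (ℚ.+-inverseˡ η)) (ℚ.+-identityʳ ε))) (p<p+ε (ε - η) 0<η)
    t≡ : p + (ε - η) ≡ t
    t≡ = begin
      p + (ε - η)                  ≡⟨ ℚ.+-assoc p ε (- η) ⟨
      p + ε - (p + ε - t)          ≡⟨ cong (λ z → p + ε + z) (ℚ.neg-distrib-+ (p + ε) (- t)) ⟩
      p + ε + (- (p + ε) - (- t))  ≡⟨ ℚ.+-assoc (p + ε) (- (p + ε)) (- (- t)) ⟨
      p + ε - (p + ε) - (- t)      ≡⟨ cong (_- (- t)) (ℚ.+-inverseʳ (p + ε)) ⟩
      0ℚ - (- t)                   ≡⟨ ℚ.+-identityˡ (- (- t)) ⟩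
      - (- t)                      ≡⟨ ⁻¹-involutive t ⟩
      t                            ∎
      where open ≡-Reasoning
    q< : q < p + (ε - η)
    q< = subst (q <_) (sym t≡) (proj₁ (proj₂ gap))

  ½*-< : ∀ {ε} → 0ℚ < ε → 0ℚ < ½ * ε × ½ * ε < ε
  ½*-< {ε} 0<ε = subst (_< ½ * ε) (ℚ.*-zeroʳ ½) (ℚ.*-monoʳ-<-pos ½ 0<ε) ,
    subst (½ * ε <_) (ℚ.*-identityˡ ε) (ℚ.*-monoˡ-<-pos ε {{positive 0<ε}} {½} {1ℚ} (*<* (ℤ.+<+ (s≤s (s≤s z≤n)))))

  <-respects-∈ : ∀ x {p q} → p ∈ x → q ∉ x → p < q
  <-respects-∈ x {p} {q} p∈x q∉x with p ℚ.<? q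
  ... | yes p<q = p<q
  ... | no  p≮q with ℚ.<-cmp p q
  ...   | tri< p<q _ _ = p<q
  ...   | tri≈ _ refl _ = contradiction p∈x q∉x
  ...   | tri> _ _ q<p = contradiction (ℝ.downward x q<p p∈x) q∉x

  module _ (em : ExcludedMiddle 0ℓ) where

    -- Cuts are not located, so the boundary is approached by walking up from a member in steps of
    -- `δ`. Excluded middle decides each step, and the Archimedean property makes the walk end.
    -- Excluded middle enters the proof only here.
    near-boundary : ∀ x δ → 0ℚ < δ → ∃ λ p → p ∈ x × p + δ ∉ x
    near-boundary x δ 0<δ = search (proj₁ steps) p p∈x λ far∈x →
      contradiction (<-respects-∈ x far∈x b∉x) (ℚ-≤⇒≯ (subst (_≤ p + ι (proj₁ steps) * δ) p+[b-p]≡b (ℚ.+-monoʳ-≤ p (proj₂ steps))))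
      where
      p b : ℚ
      p = proj₁ (ℝ.inhabited x)
      b = proj₁ (ℝ.bounded x)
      p∈x : p ∈ x
      p∈x = proj₂ (ℝ.inhabited x)
      b∉x : b ∉ x
      b∉x = proj₂ (ℝ.bounded x)
      steps : ∃ λ n → b - p ≤ ι n * δ
      steps = archimedean (b - p) δ 0<δ
      p+[b-p]≡b : p + (b - p) ≡ b
      p+[b-p]≡b = trans (ℚ.+-comm p (b - p)) (trans (ℚ.+-assoc b (- p) p) (trans (cong (λ z → b + z) (ℚ.+-inverseˡ p)) (ℚ.+-identityʳ b)))
      search : ∀ n p → p ∈ x → p + ι n * δ ∉ x → ∃ λ p → p ∈ x × p + δ ∉ x
      search zero    p p∈x ∉x = contradiction (subst (lower x) (sym (trans (cong (λ z → p + z) (ℚ.*-zeroˡ δ)) (ℚ.+-identityʳ p))) p∈x) ∉x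
      search (suc n) p p∈x ∉x with em {p + δ ∈ x}
      ... | no  out = p , p∈x , out
      ... | yes into = search n (p + δ) into (subst (λ q → q ∉ x) step ∉x)
        where
        step : p + ι (suc n) * δ ≡ p + δ + ι n * δ
        step = trans (cong (λ z → p + z * δ) (fromℕ′-+ 1 n)) (trans (cong (λ z → p + z) (trans (ℚ.*-distribʳ-+ δ 1ℚ (ι n)) (cong (_+ ι n * δ) (ℚ.*-identityˡ δ)))) (sym (ℚ.+-assoc p δ (ι n * δ))))

    module Fekete (a : ℕ → ℕ) (1≤a₀ : 1 ℕ.≤ a 0) (1≤a₁ : 1 ℕ.≤ a 1) (super : ∀ m n → a m ℕ.* a n ℕ.≤ a (m ℕ.+ n))
                  (B : ℕ) (a≤ : ∀ n → a (suc n) ℕ.≤ B ℕ.^ suc n) where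
      open ℕ.≤-Reasoning

      private
        1≤a : ∀ n → 1 ℕ.≤ a n
        1≤a zero    = 1≤a₀
        1≤a (suc n) = ℕ.≤-trans (ℕ.*-mono-≤ 1≤a₁ (1≤a n)) (super 1 n)

        power≤ : ∀ m j i → a m ℕ.^ j ℕ.* a i ℕ.≤ a (j ℕ.* m ℕ.+ i)
        power≤ m zero    i = ℕ.≤-reflexive (ℕ.+-identityʳ (a i))
        power≤ m (suc j) i = begin
          a m ℕ.* a m ℕ.^ j ℕ.* a i         ≡⟨ ℕ.*-assoc (a m) (a m ℕ.^ j) (a i) ⟩
          a m ℕ.* (a m ℕ.^ j ℕ.* a i)       ≤⟨ ℕ.*-monoʳ-≤ (a m) (power≤ m j i) ⟩
          a m ℕ.* a (j ℕ.* m ℕ.+ i)         ≤⟨ super m (j ℕ.* m ℕ.+ i) ⟩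
          a (m ℕ.+ (j ℕ.* m ℕ.+ i))         ≡⟨ cong a (ℕ.+-assoc m (j ℕ.* m) i) ⟨
          a (m ℕ.+ j ℕ.* m ℕ.+ i)           ∎

      -- The hypothesis says `u/v < (a m)^(1/m)`. Write `n = j m + i`; then `a n ≥ (a m)^j`, and
      -- `X < Y` makes `Y^j` outgrow `X^j` by more than the factor `u^i ≤ X` that the remainder
      -- costs.
      eventually : ∀ u v m .{{_ : NonZero v}} .{{_ : NonZero m}} → u ℕ.^ m ℕ.< a m ℕ.* v ℕ.^ m →
                   ∃ λ N → ∀ n → N ℕ.≤ n → u ℕ.^ n ℕ.< a n ℕ.* v ℕ.^ n
      -- A zero numerator is treated apart because `X` would vanish; from `n = 1` on, `u ^ n` is
      -- zero.
      eventually zero      v m lt = 1 , λ { (suc n) _ → ℕ.*-mono-≤ (1≤a (suc n)) (ℕ.m^n>0 v (suc n)) }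
      eventually u@(suc _) v m lt = T ℕ.* m , λ n T*m≤n → subst (λ n → u ℕ.^ n ℕ.< a n ℕ.* v ℕ.^ n) (sym (ℕ.m≡m%n+[m/n]*n n m))
          (subst (λ e → u ℕ.^ e ℕ.< a e ℕ.* v ℕ.^ e) (ℕ.+-comm (n ℕ./ m ℕ.* m) (n ℕ.% m)) (large (n ℕ./ m) (n ℕ.% m) (ℕ.<⇒≤ (ℕ.m%n<n n m))
            (subst (ℕ._≤ n ℕ./ m) (ℕ.m*n/n≡m T m) (ℕ./-monoˡ-≤ m T*m≤n))))
        where
        X Y T : ℕ
        X = u ℕ.^ m
        Y = a m ℕ.* v ℕ.^ m
        -- As `Y ≥ X + 1`, Bernoulli gives `Y^j ≥ X^j (1 + j/X)`, and `1 + j/X` exceeds `X` once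
        -- `j ≥ X * X`.
        T = X ℕ.* X
        instance
          X≢0 : NonZero X
          X≢0 = ℕ.m^n≢0 u m
        dominates : ∀ j → T ℕ.≤ j → X ℕ.^ j ℕ.* X ℕ.< Y ℕ.^ j
        dominates j T≤j = ℕ.*-cancelʳ-< X _ _ (begin-strict
          X ℕ.^ j ℕ.* X ℕ.* X            ≡⟨ ℕ.*-assoc (X ℕ.^ j) X X ⟩
          X ℕ.^ j ℕ.* T                  <⟨ ℕ.*-monoʳ-< (X ℕ.^ j) {{ℕ.m^n≢0 X j}} (ℕ.≤-<-trans T≤j (ℕ.m<n+m j (ℕ.>-nonZero⁻¹ X))) ⟩
          X ℕ.^ j ℕ.* (X ℕ.+ j)          ≡⟨ cong (λ j′ → X ℕ.^ j ℕ.* (X ℕ.+ j′)) (ℕ.*-identityʳ j) ⟨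
          X ℕ.^ j ℕ.* (X ℕ.+ j ℕ.* 1)    ≤⟨ bernoulli j X 1 ⟩
          (X ℕ.+ 1) ℕ.^ j ℕ.* X          ≤⟨ ℕ.*-monoˡ-≤ X (ℕ.^-monoˡ-≤ j (ℕ.≤-trans (ℕ.≤-reflexive (ℕ.+-comm X 1)) lt)) ⟩
          Y ℕ.^ j ℕ.* X                  ∎)
        large : ∀ j i → i ℕ.≤ m → T ℕ.≤ j → u ℕ.^ (j ℕ.* m ℕ.+ i) ℕ.< a (j ℕ.* m ℕ.+ i) ℕ.* v ℕ.^ (j ℕ.* m ℕ.+ i)
        large j i i≤m T≤j = begin-strict
          u ℕ.^ (j ℕ.* m ℕ.+ i)                         ≡⟨ ℕ.^-distribˡ-+-* u (j ℕ.* m) i ⟩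
          u ℕ.^ (j ℕ.* m) ℕ.* u ℕ.^ i                   ≡⟨ cong (ℕ._* u ℕ.^ i) (trans (cong (u ℕ.^_) (ℕ.*-comm j m)) (sym (ℕ.^-*-assoc u m j))) ⟩
          X ℕ.^ j ℕ.* u ℕ.^ i                           ≤⟨ ℕ.*-monoʳ-≤ (X ℕ.^ j) (ℕ.^-monoʳ-≤ u i≤m) ⟩
          X ℕ.^ j ℕ.* X                                 <⟨ dominates j T≤j ⟩
          (a m ℕ.* v ℕ.^ m) ℕ.^ j                       ≡⟨ ^-distribʳ-* j (a m) (v ℕ.^ m) ⟩
          a m ℕ.^ j ℕ.* (v ℕ.^ m) ℕ.^ j                 ≡⟨ cong (a m ℕ.^ j ℕ.*_) (trans (ℕ.^-*-assoc v m j) (cong (v ℕ.^_) (ℕ.*-comm m j))) ⟩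
          a m ℕ.^ j ℕ.* v ℕ.^ (j ℕ.* m)                 ≤⟨ ℕ.*-mono-≤ (ℕ.≤-trans (ℕ.m≤m*n (a m ℕ.^ j) (a i) {{ℕ.>-nonZero (1≤a i)}}) (power≤ m j i)) (ℕ.^-monoʳ-≤ v (ℕ.m≤m+n (j ℕ.* m) i)) ⟩
          a (j ℕ.* m ℕ.+ i) ℕ.* v ℕ.^ (j ℕ.* m ℕ.+ i)   ∎

      -- With this set the limit is by definition the supremum of all roots, so a lower bound at a
      -- single length is a lower bound for the limit.
      below : ℚ → Set
      below s = s ≤ 0ℚ ⊎ ∃ λ n → s ^ suc n < ι (a (suc n))

      limit : ℝ
      limit = sup below (0ℚ , inj₁ ℚ.≤-refl) (ι B , ub)
        where
        ub : ∀ s → below s → s ≤ ι B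
        ub s (inj₁ s≤0) = ℚ.≤-trans s≤0 (0≤ι B)
        ub s (inj₂ (n , lt)) with s ℚ.≤? 0ℚ
        ... | yes s≤0 = ℚ.≤-trans s≤0 (0≤ι B)
        ... | no  s≰0 = ℚ.<⇒≤ (Powers.<⇐′ s 0≤s B (^-cancel-< (suc n) (begin-strict
          numerator s ℕ.^ suc n                ≡⟨⟩
          numerator s ℕ.^ suc n                <⟨ Powers.pow-<⇒ s 0≤s (suc n) (a (suc n)) lt ⟩
          a (suc n) ℕ.* ↧ₙ s ℕ.^ suc n         ≤⟨ ℕ.*-monoˡ-≤ (↧ₙ s ℕ.^ suc n) (a≤ n) ⟩
          B ℕ.^ suc n ℕ.* ↧ₙ s ℕ.^ suc n       ≡⟨ ^-distribʳ-* (suc n) B (↧ₙ s) ⟨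
          (B ℕ.* ↧ₙ s) ℕ.^ suc n               ∎)))
          where
          0≤s : 0ℚ ≤ s
          0≤s = ℚ.<⇒≤ (ℚ.≰⇒> s≰0)

      private
        roots : ℕ → ℝ
        roots n = root (suc n) (fromℕ (a (suc n)))

        roots⊆limit : ∀ n q → q ∈ roots n → q ∈ limit
        roots⊆limit n q (s , inj₁ s≤0 , q<s) = s , inj₁ s≤0 , q<s
        roots⊆limit n q (s , inj₂ (_ , refl , lt) , q<s) = s , inj₂ (n , lt) , q<s

        eventually-∈ : ∀ q → q ∈ limit → ∃ λ N → ∀ n → N ℕ.≤ n → q ∈ roots n
        eventually-∈ q (s , inj₁ s≤0 , q<s) = 0 , λ n _ → s , inj₁ s≤0 , q<s
        eventually-∈ q (s , inj₂ (m , lt) , q<s) with s ℚ.≤? 0ℚ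
        ... | yes s≤0 = 0 , λ n _ → s , inj₁ s≤0 , q<s
        ... | no  s≰0 = let N , large = eventually (numerator s) (↧ₙ s) (suc m) {{↧ₙ-nonZero {s}}} (Powers.pow-<⇒ s 0≤s (suc m) (a (suc m)) lt) in
          N , λ n N≤n → s , inj₂ (ι (a (suc n)) , refl , Powers.pow-<⇐ s 0≤s (suc n) (a (suc n)) (large (suc n) (ℕ.m≤n⇒m≤1+n N≤n))) , q<s
          where
          0≤s : 0ℚ ≤ s
          0≤s = ℚ.<⇒≤ (ℚ.≰⇒> s≰0)

      -- One rational serves both inequalities. Take `p` in the limit with `p + ε/2` outside it:
      -- `p + ε/2` then lies in no root, while `p` lies in all late roots by `eventually-∈`.
      converges : roots ⟶ limit
      converges ε 0<ε = let N , large = eventually-∈ p p∈ in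
        N , λ n N≤n → (p + ½ * ε , ∈-+ limit p∈ p+½ε< , p+½ε∉ ∘ roots⊆limit n (p + ½ * ε)) ,
                      (p + ½ * ε , ∈-+ (roots n) (large n N≤n) p+½ε< , p+½ε∉)
        where
        boundary : ∃ λ p → p ∈ limit × p + ½ * ε ∉ limit
        boundary = near-boundary limit (½ * ε) (proj₁ (½*-< 0<ε))
        p : ℚ
        p = proj₁ boundary
        p∈ : p ∈ limit
        p∈ = proj₁ (proj₂ boundary)
        p+½ε∉ : p + ½ * ε ∉ limit
        p+½ε∉ = proj₂ (proj₂ boundary)
        p+½ε< : p + ½ * ε < p + ε
        p+½ε< = ℚ.+-monoʳ-< p (proj₂ (½*-< 0<ε))

  -- Density near one, and the exponent of the lower bound

  ∈-fromℚ-+ : ∀ p {q ε} → q < p + ε → q ∈ fromℚ p +ᴿ fromℚ ε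
  ∈-fromℚ-+ p {q} {ε} q<p+ε = ∈-+ (fromℚ p) (p , refl , proj₂ (proj₂ between)) (subst (_< proj₁ between + ε) q-ε+ε≡q (ℚ.+-monoˡ-< ε (proj₁ (proj₂ between))))
    where
    cancel : ∀ x → x + ε - ε ≡ x
    cancel x = trans (ℚ.+-assoc x ε (- ε)) (trans (cong (λ z → x + z) (ℚ.+-inverseʳ ε)) (ℚ.+-identityʳ x))
    q-ε+ε≡q : q - ε + ε ≡ q
    q-ε+ε≡q = trans (ℚ.+-assoc q (- ε) ε) (trans (cong (λ z → q + z) (ℚ.+-inverseˡ ε)) (ℚ.+-identityʳ q))
    between : ∃ λ t → q - ε < t × t < p
    between = ℚ.<-dense (subst (q - ε <_) (cancel p) (ℚ.+-monoˡ-< (- ε) q<p+ε))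

  ∉-fromℚ : ∀ p → p ∉ fromℚ p
  ∉-fromℚ p (_ , refl , p<p) = ℚ.<-irrefl refl p<p

  /-* : ∀ i n .{{_ : NonZero n}} → ι n * (+ i ℚ./ n) ≡ ι i
  /-* i (suc n) = ℚ.toℚᵘ-injective (begin
    ℚ.toℚᵘ (ι (suc n) * (+ i ℚ./ suc n))               ≈⟨ ℚ.toℚᵘ-homo-* (ι (suc n)) (+ i ℚ./ suc n) ⟩
    ℚ.toℚᵘ (ι (suc n)) ℚᵘ.* ℚ.toℚᵘ (+ i ℚ./ suc n)     ≈⟨ ℚᵘ.*-cong (fromℕ′-toℚᵘ (suc n)) (ℚ.toℚᵘ-fromℚᵘ (ℚᵘ.mkℚᵘ (+ i) n)) ⟩
    ℚᵘ.mkℚᵘ (+ suc n) 0 ℚᵘ.* ℚᵘ.mkℚᵘ (+ i) n           ≈⟨ ℚᵘ.*≡* (trans (ℤ.*-identityʳ (+ suc n ℤ.* + i)) (trans (ℤ.*-comm (+ suc n) (+ i)) (cong (λ n → + i ℤ.* + suc n) (sym (ℕ.+-identityʳ n))))) ⟩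
    ℚᵘ.mkℚᵘ (+ i) 0                                    ≈⟨ fromℕ′-toℚᵘ i ⟨
    ℚ.toℚᵘ (ι i)                                       ∎)
    where open ℚᵘ.≃-Reasoning

  -- The hypotheses give `1 - i/f ≤ 5/h < 1/d` with `d` the denominator of `ε`, and `1/d ≤ ε`
  -- because the numerator of `ε` is at least one.
  ratio-near-1 : ∀ i f h {ε} .{{_ : NonZero f}} → 0ℚ < ε → i ℕ.≤ f → f ℕ.* h ℕ.≤ i ℕ.* h ℕ.+ 5 ℕ.* f → 5 ℕ.* ↧ₙ ε ℕ.< h →
                 fromℚ (+ i ℚ./ f) <ᴿ 1ℝ +ᴿ fromℚ ε × 1ℝ <ᴿ fromℚ (+ i ℚ./ f) +ᴿ fromℚ ε
  ratio-near-1 i f h {ε} 0<ε i≤f close 5d<h =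
    (p , ∈-fromℚ-+ 1ℚ (ℚ.≤-<-trans p≤1 (p<p+ε 1ℚ 0<ε)) , ∉-fromℚ p) ,
    (1ℚ , ∈-fromℚ-+ p 1<p+ε , ∉-fromℚ 1ℚ)
    where
    p : ℚ
    p = + i ℚ./ f
    d e : ℕ
    d = ↧ₙ ε
    e = numerator ε
    instance
      d≢0 : NonZero d
      d≢0 = ↧ₙ-nonZero {ε}
      f-pos : ℚ.Positive (ι f)
      f-pos = positive (0<ι f)
    p≤1 : p ≤ 1ℚ
    p≤1 = ℚ.*-cancelˡ-≤-pos (ι f) (subst₂ _≤_ (sym (/-* i f)) (sym (ℚ.*-identityʳ (ι f))) (fromℕ′-mono-≤ {i} {f} i≤f))
    1≤e : 1 ℕ.≤ e
    1≤e = ℕ.≰⇒> λ e≤0 → ℚ-<⇒≱ 0<ε (ℚ.≤-trans (≤numerator ε) (fromℕ′-mono-≤ {e} {0} e≤0))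
    key : f ℕ.* d ℕ.< i ℕ.* d ℕ.+ f ℕ.* e
    key = ℕ.≰⇒> λ le → ℕ.<⇒≱ 5d<h (ℕ.*-cancelʳ-≤ h (5 ℕ.* d) f (ℕ.+-cancelˡ-≤ (i ℕ.* d ℕ.* h) _ _ (let open ℕ.≤-Reasoning in begin
      i ℕ.* d ℕ.* h ℕ.+ h ℕ.* f              ≡⟨ regroup i d h f ⟩
      (i ℕ.* d ℕ.+ f ℕ.* 1) ℕ.* h            ≤⟨ ℕ.*-monoˡ-≤ h (ℕ.≤-trans (ℕ.+-monoʳ-≤ (i ℕ.* d) (ℕ.*-monoʳ-≤ f 1≤e)) le) ⟩
      f ℕ.* d ℕ.* h                          ≡⟨ swap f d h ⟩
      f ℕ.* h ℕ.* d                          ≤⟨ ℕ.*-monoˡ-≤ d close ⟩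
      (i ℕ.* h ℕ.+ 5 ℕ.* f) ℕ.* d            ≡⟨ expand i h f d ⟩
      i ℕ.* d ℕ.* h ℕ.+ 5 ℕ.* d ℕ.* f        ∎)))
      where
      regroup : ∀ i d h f → i ℕ.* d ℕ.* h ℕ.+ h ℕ.* f ≡ (i ℕ.* d ℕ.+ f ℕ.* 1) ℕ.* h
      regroup = solve-∀
      swap : ∀ f d h → f ℕ.* d ℕ.* h ≡ f ℕ.* h ℕ.* d
      swap = solve-∀
      expand : ∀ i h f d → (i ℕ.* h ℕ.+ 5 ℕ.* f) ℕ.* d ≡ i ℕ.* d ℕ.* h ℕ.+ 5 ℕ.* d ℕ.* f
      expand = solve-∀
    1<p+ε : 1ℚ < p + ε
    1<p+ε = ℚ.*-cancelˡ-<-nonNeg (ι (f ℕ.* d)) {{nonNegative (0≤ι (f ℕ.* d))}} (subst₂ _<_ (sym (ℚ.*-identityʳ (ι (f ℕ.* d)))) scaled (fromℕ′-mono-< key))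
      where
      open ≡-Reasoning
      scaled : ι (i ℕ.* d ℕ.+ f ℕ.* e) ≡ ι (f ℕ.* d) * (p + ε)
      scaled = begin
        ι (i ℕ.* d ℕ.+ f ℕ.* e)                    ≡⟨ fromℕ′-+ (i ℕ.* d) (f ℕ.* e) ⟩
        ι (i ℕ.* d) + ι (f ℕ.* e)                  ≡⟨ cong₂ _+_ (trans (cong ι (ℕ.*-comm i d)) (fromℕ′-* d i)) (fromℕ′-* f e) ⟩
        ι d * ι i + ι f * ι e                      ≡⟨ cong₂ (λ a b → ι d * a + ι f * b) (/-* i f) (denominator-* ε (ℚ.<⇒≤ 0<ε)) ⟨
        ι d * (ι f * p) + ι f * (ι d * ε)          ≡⟨ cong₂ _+_ (trans (sym (ℚ.*-assoc (ι d) (ι f) p)) (cong (_* p) (ℚ.*-comm (ι d) (ι f)))) (sym (ℚ.*-assoc (ι f) (ι d) ε)) ⟩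
        ι f * ι d * p + ι f * ι d * ε              ≡⟨ ℚ.*-distribˡ-+ (ι f * ι d) p ε ⟨
        ι f * ι d * (p + ε)                        ≡⟨ cong (_* (p + ε)) (fromℕ′-* f d) ⟨
        ι (f ℕ.* d) * (p + ε)                      ∎

  ½^≤1 : ∀ n → ½ ^ n ≤ 1ℚ
  ½^≤1 zero    = ℚ.≤-refl
  ½^≤1 (suc n) = ℚ.≤-trans (ℚ.*-monoˡ-≤-nonNeg ½ (½^≤1 n)) (*≤* (ℤ.+≤+ (s≤s z≤n)))

  -- Bounding `x` by an integer avoids any evaluation of `exp₂`: an approximant `s` satisfies
  -- `s^d ≤ 2^n` for some fraction `n/d < h`, hence `s < 2^h`. The conclusion has the form of a
  -- witness for `Fekete.below`.
  exp₂-< : ∀ x h .{{_ : NonZero h}} → (∀ r → r ∈ x → r < ι h) → ∀ m a → 2 ℕ.^ (h ℕ.* suc m) ℕ.≤ a →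
           ∀ q → q ∈ exp₂ x → ∃ λ s → s ^ suc m < ι a × q < s
  exp₂-< x h x<h m a 2^≤a q (s , (0≤s , r , r∈x , le) , q<s) = s , Powers.pow-<⇐ s 0≤s (suc m) a (begin-strict
      u ℕ.^ suc m                                 <⟨ ℕ.^-monoˡ-< (suc m) u< ⟩
      (2 ℕ.^ h ℕ.* v) ℕ.^ suc m                   ≡⟨ ^-distribʳ-* (suc m) (2 ℕ.^ h) v ⟩
      (2 ℕ.^ h) ℕ.^ suc m ℕ.* v ℕ.^ suc m         ≡⟨ cong (ℕ._* v ℕ.^ suc m) (ℕ.^-*-assoc 2 h (suc m)) ⟩
      2 ℕ.^ (h ℕ.* suc m) ℕ.* v ℕ.^ suc m         ≤⟨ ℕ.*-monoˡ-≤ (v ℕ.^ suc m) 2^≤a ⟩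
      a ℕ.* v ℕ.^ suc m                           ∎) , q<s
    where
    open ℕ.≤-Reasoning
    u v d : ℕ
    u = numerator s
    v = ↧ₙ s
    d = ↧ₙ r
    instance
      v≢0 : NonZero v
      v≢0 = ↧ₙ-nonZero {s}
      d≢0 : NonZero d
      d≢0 = ↧ₙ-nonZero {r}
    exponent : ∀ r → r < ι h → ∃ λ n → n ℕ.< h ℕ.* ↧ₙ r × 2^ℤ (↥ r) ≤ ι (2 ℕ.^ n)
    exponent r@(mkℚ (+ n) d _) r<h = n , Scaled.<⇒ (↧ₙ r) n (denominator-* r (ℚ.nonNegative⁻¹ r)) h r<h ,
      ℚ.≤-reflexive (sym (fromℕ′-^ 2 n))
    -- For negative `r` the exponent is raised to zero, since `2^r ≤ 1`.
    exponent r@(mkℚ -[1+ n ] d _) r<h = 0 , ℕ.>-nonZero⁻¹ _ {{ℕ.m*n≢0 h (suc d)}} , ½^≤1 (suc n)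
    u< : u ℕ.< 2 ℕ.^ h ℕ.* v
    u< = let n , n< , pow≤ = exponent r (x<h r r∈x) in ^-cancel-< d (begin-strict
      u ℕ.^ d                             ≤⟨ Powers.pow-≤⇒ s 0≤s d (2 ℕ.^ n) (ℚ.≤-trans le pow≤) ⟩
      2 ℕ.^ n ℕ.* v ℕ.^ d                 <⟨ ℕ.*-monoˡ-< (v ℕ.^ d) {{ℕ.m^n≢0 v d}} (ℕ.^-monoʳ-< 2 (s≤s (s≤s z≤n)) n<) ⟩
      2 ℕ.^ (h ℕ.* d) ℕ.* v ℕ.^ d         ≡⟨ cong (ℕ._* v ℕ.^ d) (ℕ.^-*-assoc 2 h d) ⟨
      (2 ℕ.^ h) ℕ.^ d ℕ.* v ℕ.^ d         ≡⟨ ^-distribʳ-* d (2 ℕ.^ h) v ⟨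
      (2 ℕ.^ h ℕ.* v) ℕ.^ d               ∎)

  fromℕ′-mkℚ : ∀ n → ι n ≡ mkℚ (+ n) 0 (Coprime.sym (Coprime.1-coprimeTo n))
  fromℕ′-mkℚ n = ℚ.toℚᵘ-injective (fromℕ′-toℚᵘ n)

  log₂-lower : ∀ g k .{{_ : NonZero k}} → 2 ℕ.^ g ℕ.≤ k → ∀ t → t < ι g → t ∈ log₂ k
  log₂-lower g k 2^g≤k t t<g = ι g , subst (λ r → 2^ℤ (↥ r) ≤ ι k ^ ↧ₙ r) (sym (fromℕ′-mkℚ g))
    (subst₂ _≤_ (fromℕ′-^ 2 g) (sym (ℚ.*-identityʳ (ι k))) (fromℕ′-mono-≤ 2^g≤k)) , t<g

  unit : (Q : ℕ) .{{_ : NonZero Q}} → ℚ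
  unit Q = (1/ ι Q) {{>-nonZero (0<ι Q)}}

  unit-* : ∀ Q .{{_ : NonZero Q}} → unit Q * ι Q ≡ 1ℚ
  unit-* Q = ℚ.*-inverseˡ (ι Q) {{>-nonZero (0<ι Q)}}

  module _ (Q h g k : ℕ) .{{_ : NonZero Q}} .{{_ : NonZero h}} .{{_ : NonZero g}} (2≤k : 2 ℕ.≤ k)
           (2^g≤k : 2 ℕ.^ g ℕ.≤ k) (k< : k ℕ.< (Q ℕ.* h) ℕ.^ 4 ℕ.* g) where
    private
      instance
        k≢0 : NonZero k
        k≢0 = ℕ.>-nonZero (ℕ.<-trans (s≤s z≤n) 2≤k)
        g-pos : ℚ.Positive (ι g)
        g-pos = positive (0<ι g)
        g-nonNeg : ℚ.NonNegative (ι g)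
        g-nonNeg = nonNegative (0≤ι g)
        Qh≢0 : NonZero (Q ℕ.* h)
        Qh≢0 = ℕ.m*n≢0 Q h

      quotient-bound : ∀ z → z ∈ n/log₂n k 2≤k → z * ι g < ι k
      quotient-bound z (s , inj₁ s≤0 , z<s) = ℚ.<-trans (subst (z * ι g <_) (ℚ.*-zeroˡ (ι g)) (ℚ.*-monoˡ-<-pos (ι g) (ℚ.<-≤-trans z<s s≤0))) (0<ι k)
      quotient-bound z (_ , inj₂ (p , q , (0≤p , (_ , refl , p<k)) , (0≤q , (s , (t , t∉ , st≡1) , q<s)) , refl) , z<pq) = begin-strict
        z * ι g        <⟨ ℚ.*-monoˡ-<-pos (ι g) z<pq ⟩
        p * q * ι g    ≡⟨ ℚ.*-assoc p q (ι g) ⟩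
        p * (q * ι g)  ≤⟨ ℚ.*-monoˡ-≤-nonNeg p {{nonNegative 0≤p}} qg≤1 ⟩
        p * 1ℚ         ≡⟨ ℚ.*-identityʳ p ⟩
        p              ≤⟨ ℚ.<⇒≤ p<k ⟩
        ι k            ∎
        where
        open ℚ.≤-Reasoning
        g≤t : ι g ≤ t
        g≤t = ℚ.≮⇒≥ λ t<g → t∉ (log₂-lower g k 2^g≤k t t<g)
        qg≤1 : q * ι g ≤ 1ℚ
        qg≤1 = begin
          q * ι g   ≤⟨ ℚ.*-monoʳ-≤-nonNeg (ι g) (ℚ.<⇒≤ q<s) ⟩
          s * ι g   ≤⟨ ℚ.*-monoˡ-≤-nonNeg s {{nonNegative (ℚ.≤-trans 0≤q (ℚ.<⇒≤ q<s))}} g≤t ⟩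
          s * t     ≡⟨ st≡1 ⟩
          1ℚ        ∎

      root-bound : ∀ y → y ∈ root 4 (n/log₂n k 2≤k) → y < ι (Q ℕ.* h)
      root-bound y (s , inj₁ s≤0 , y<s) = ℚ.<-≤-trans y<s (ℚ.≤-trans s≤0 (0≤ι (Q ℕ.* h)))
      root-bound y (s , inj₂ s⁴∈ , y<s) with s ℚ.≤? 0ℚ
      ... | yes s≤0 = ℚ.<-≤-trans y<s (ℚ.≤-trans s≤0 (0≤ι (Q ℕ.* h)))
      ... | no  s≰0 = ℚ.<-trans y<s (Powers.<⇐′ s 0≤s (Q ℕ.* h) (^-cancel-< 4 (subst (u ℕ.^ 4 ℕ.<_) (sym (^-distribʳ-* 4 (Q ℕ.* h) v))
          (ℕ.*-cancelʳ-< g _ _ (ℕ.<-trans scaled (subst (k ℕ.* v ℕ.^ 4 ℕ.<_) (swap ((Q ℕ.* h) ℕ.^ 4) g (v ℕ.^ 4)) (ℕ.*-monoˡ-< (v ℕ.^ 4) {{ℕ.m^n≢0 v 4}} k<)))))))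
        where
        0≤s : 0ℚ ≤ s
        0≤s = ℚ.<⇒≤ (ℚ.≰⇒> s≰0)
        u v : ℕ
        u = numerator s
        v = ↧ₙ s
        instance
          v≢0 : NonZero v
          v≢0 = ↧ₙ-nonZero {s}
        swap : ∀ x g w → x ℕ.* g ℕ.* w ≡ x ℕ.* w ℕ.* g
        swap = solve-∀
        scaled : u ℕ.^ 4 ℕ.* g ℕ.< k ℕ.* v ℕ.^ 4
        scaled = Scaled.<⇒ (v ℕ.^ 4) (u ℕ.^ 4 ℕ.* g) {{ℕ.m^n≢0 v 4}} {s ^ 4 * ι g}
          (trans (sym (ℚ.*-assoc (ι (v ℕ.^ 4)) (s ^ 4) (ι g))) (trans (cong (_* ι g) (denominator-^ s 4 0≤s)) (sym (fromℕ′-* (u ℕ.^ 4) g))))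
          k (quotient-bound (s ^ 4) s⁴∈)

    -- From `g ≤ log₂ k` follows `k / log₂ k ≤ k/g < (Q h)^4`, so the fourth root stays below `Q h`
    -- and the factor `1/Q` leaves `h`.
    exponent-bound : ∀ r → r ∈ fromℚ (unit Q) *ᴿ root 4 (n/log₂n k 2≤k) → r < ι h
    exponent-bound r (s , inj₁ s≤0 , r<s) = ℚ.<-≤-trans r<s (ℚ.≤-trans s≤0 (0≤ι h))
    exponent-bound r (_ , inj₂ (p , y , (0≤p , (_ , refl , p<)) , (0≤y , y∈) , refl) , r<py) = begin-strict
      r                      <⟨ r<py ⟩
      p * y                  ≤⟨ ℚ.*-monoˡ-≤-nonNeg p {{nonNegative 0≤p}} (ℚ.<⇒≤ (root-bound y y∈)) ⟩
      p * ι (Q ℕ.* h)        ≤⟨ ℚ.*-monoʳ-≤-nonNeg (ι (Q ℕ.* h)) {{nonNegative (0≤ι (Q ℕ.* h))}} (ℚ.<⇒≤ p<) ⟩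
      unit Q * ι (Q ℕ.* h)   ≡⟨ cong (unit Q *_) (fromℕ′-* Q h) ⟩
      unit Q * (ι Q * ι h)   ≡⟨ ℚ.*-assoc (unit Q) (ι Q) (ι h) ⟨
      unit Q * ι Q * ι h     ≡⟨ cong (_* ι h) (unit-* Q) ⟩
      1ℚ * ι h               ≡⟨ ℚ.*-identityˡ (ι h) ⟩
      ι h                    ∎
      where open ℚ.≤-Reasoning

  0<unit : ∀ Q .{{_ : NonZero Q}} → 0ℝ <ᴿ fromℚ (unit Q)
  0<unit Q = 0ℚ , (unit Q , refl , ℚ.positive⁻¹ (unit Q) {{ℚ.1/pos⇒pos (ι Q) {{positive (0<ι Q)}}}}) , ∉-fromℚ 0ℚ

open import Axiom.ExcludedMiddle using (ExcludedMiddle)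
open import Data.Bool using (Bool; true; false; not; _∧_; if_then_else_; T)
import Data.Bool.Properties as Bool
open import Data.Empty using (⊥)
open import Data.Fin as Fin using (Fin; zero; suc; toℕ; fromℕ<; combine; remQuot; funToFin; finToFun; inject≤; punchIn; punchOut; splitAt; _↑ˡ_; _↑ʳ_)
open import Data.Fin.Permutation as Permutation using (Permutation′; permutation; _⟨$⟩ʳ_; _⟨$⟩ˡ_; inverseˡ; inverseʳ; insert; insert-punchIn; _≈_)
import Data.Fin.Properties as Fin
open import Data.List using (List; []; _∷_; length; filter; map; _++_; lookup; tabulate; cartesianProductWith)
open import Data.List.Membership.Propositional using () renaming (_∈_ to _∈ˡ_)
open import Data.List.Membership.Propositional.Properties using (∈-lookup)
import Data.List.Membership.Setoid as Membership
import Data.List.Membership.Setoid.Properties as ∈ₛ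
open import Data.List.Properties using (length-++; length-map; length-filter; ∷-injectiveˡ; ∷-injectiveʳ)
open import Data.List.Relation.Unary.All as All using (All)
open import Data.List.Relation.Unary.All.Properties using (all-filter)
open import Data.List.Relation.Unary.AllPairs using ([]; _∷_)
open import Data.List.Relation.Unary.Any as Any using (here)
open import Data.List.Relation.Unary.Unique.Setoid using (Unique)
import Data.List.Relation.Unary.Unique.Setoid.Properties as Uniqueₛ
open import Data.Nat as ℕ hiding (_/_; _%_)
open import Data.Nat.DivMod using (m≡m%n+[m/n]*n; m%n<n; m*n/n≡m; /-monoˡ-≤; m/n*n≤m)
open import Data.Nat.Properties
open import Data.Nat.Tactic.RingSolver using (solve-∀)
open import Data.Product using (Σ; ∃; ∃₂; _×_; _,_; proj₁; proj₂)
open import Data.Sum using (inj₁; inj₂; [_,_]′)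
open import Data.Vec as Vec using (Vec; []; _∷_)
open import Defs hiding (_∈_; _∉_; _^_; ^-homo-*; ^-assocʳ)
open import Function using (_∘_; id; const; _⇔_; mk⇔; Equivalence)
open import Level using (0ℓ)
open import Relation.Binary using (Setoid; tri<; tri≈; tri>)
open import Relation.Binary.PropositionalEquality
open import Relation.Nullary
open import Relation.Nullary.Decidable using (dec-true; dec-false)
open import Algebra.Properties.Semiring.Sum +-*-semiring using (sum; sum-cong-≗; ∑-distrib-+; ∑-comm; sum-remove; *-distribˡ-sum; *-distribʳ-sum)
open Arithmetic
open Analysis using (ratio-near-1; module Fekete; exp₂-<; unit; 0<unit; exponent-bound)

-- Finite sums and cardinalities of Boolean subsets

sum-mono : ∀ {n} {f g : Fin n → ℕ} → (∀ i → f i ≤ g i) → sum f ≤ sum g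
sum-mono {zero}  f≤g = z≤n
sum-mono {suc n} f≤g = +-mono-≤ (f≤g zero) (sum-mono (f≤g ∘ suc))

sum-mono-< : ∀ {n} {f g : Fin n → ℕ} → (∀ i → f i ≤ g i) → ∀ j → f j < g j → sum f < sum g
sum-mono-< f≤g zero    f<g = +-mono-<-≤ f<g (sum-mono (f≤g ∘ suc))
sum-mono-< f≤g (suc j) f<g = +-mono-≤-< (f≤g zero) (sum-mono-< (f≤g ∘ suc) j f<g)

sum-const : ∀ n c → sum {n} (const c) ≡ n * c
sum-const zero    c = refl
sum-const (suc n) c = cong (c +_) (sum-const n c)

sum-≤-const : ∀ {n} {f : Fin n → ℕ} c → (∀ i → f i ≤ c) → sum f ≤ n * c
sum-≤-const {n} c f≤c = ≤-trans (sum-mono f≤c) (≤-reflexive (sum-const n c))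

sum-↑ : ∀ m {n} (f : Fin (m + n) → ℕ) → sum f ≡ sum (λ i → f (i ↑ˡ n)) + sum (λ i → f (m ↑ʳ i))
sum-↑ zero    f = refl
sum-↑ (suc m) f = trans (cong (f zero +_) (sum-↑ m (f ∘ suc))) (sym (+-assoc (f zero) _ _))

sum-combine : ∀ m {n} (f : Fin (m * n) → ℕ) → sum f ≡ sum λ i → sum λ j → f (combine {m} i j)
sum-combine zero    f = refl
sum-combine (suc m) {n} f = trans (sum-↑ n f) (cong (sum (λ j → f (j ↑ˡ (m * n))) +_) (sum-combine m (λ i → f (n ↑ʳ i))))

𝟙 : Bool → ℕ
𝟙 true  = 1
𝟙 false = 0

𝟙≤1 : ∀ b → 𝟙 b ≤ 1
𝟙≤1 true  = ≤-refl
𝟙≤1 false = z≤n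

card : ∀ {n} → (Fin n → Bool) → ℕ
card V = sum (𝟙 ∘ V)

card≤ : ∀ {n} (V : Fin n → Bool) → card V ≤ n
card≤ {n} V = ≤-trans (sum-≤-const 1 (𝟙≤1 ∘ V)) (≤-reflexive (*-identityʳ n))

card-cong : ∀ {n} {V W : Fin n → Bool} → (∀ i → V i ≡ W i) → card V ≡ card W
card-cong V≗W = sum-cong-≗ (cong 𝟙 ∘ V≗W)

card-not : ∀ {n} (V : Fin n → Bool) → card V + card (not ∘ V) ≡ n
card-not {n} V = trans (sym (∑-distrib-+ (𝟙 ∘ V) (𝟙 ∘ not ∘ V)))
  (trans (sum-cong-≗ (λ i → one (V i))) (trans (sum-const n 1) (*-identityʳ n)))
  where
  one : ∀ b → 𝟙 b + 𝟙 (not b) ≡ 1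
  one true  = refl
  one false = refl

injective⇒≤card : ∀ {t n} (V : Fin n → Bool) (e : Fin t → Fin n) →
                  (∀ {i j} → e i ≡ e j → i ≡ j) → (∀ i → V (e i) ≡ true) → t ≤ card V
injective⇒≤card {zero}          V e inj V∘e = z≤n
injective⇒≤card {suc t} {zero}  V e inj V∘e with () ← e zero
injective⇒≤card {suc t} {suc n} V e inj V∘e = begin
  1 + t                                        ≤⟨ s≤s (injective⇒≤card (V ∘ punchIn (e zero)) e′ inj′ V∘e′) ⟩
  1 + card (V ∘ punchIn (e zero))              ≡⟨ cong (λ b → 𝟙 b + card (V ∘ punchIn (e zero))) (V∘e zero) ⟨
  𝟙 (V (e zero)) + card (V ∘ punchIn (e zero)) ≡⟨ sum-remove {i = e zero} (𝟙 ∘ V) ⟨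
  card V                                       ∎
  where
  open ≤-Reasoning
  e₀≢ : ∀ i → e zero ≢ e (suc i)
  e₀≢ i eq with () ← inj eq
  e′ : Fin t → Fin n
  e′ i = punchOut (e₀≢ i)
  inj′ : ∀ {i j} → e′ i ≡ e′ j → i ≡ j
  inj′ {i} {j} eq = Fin.suc-injective (inj (Fin.punchOut-injective (e₀≢ i) (e₀≢ j) eq))
  V∘e′ : ∀ i → V (punchIn (e zero) (e′ i)) ≡ true
  V∘e′ i = trans (cong V (Fin.punchIn-punchOut (e₀≢ i))) (V∘e (suc i))

enumerate : ∀ {n} t (V : Fin n → Bool) → t ≤ card V →
            ∃ λ (e : Fin t → Fin n) → (∀ {i j} → i Fin.< j → e i Fin.< e j) × (∀ i → V (e i) ≡ true)
enumerate         zero    V le = (λ ()) , (λ { {()} }) , λ ()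
enumerate {suc n} (suc t) V le with V zero in eq
... | true with e , mono , V∘e ← enumerate t (V ∘ suc) (s≤s⁻¹ le) =
  e′ , (λ {i} {j} → mono′ {i} {j}) , V∘e′
  where
  e′ : Fin (suc t) → Fin (suc n)
  e′ zero    = zero
  e′ (suc i) = suc (e i)
  mono′ : ∀ {i j} → i Fin.< j → e′ i Fin.< e′ j
  mono′ {zero}  {suc j} i<j = s≤s z≤n
  mono′ {suc i} {suc j} i<j = s≤s (mono (s≤s⁻¹ i<j))
  V∘e′ : ∀ i → V (e′ i) ≡ true
  V∘e′ zero    = eq
  V∘e′ (suc i) = V∘e i
... | false with e , mono , V∘e ← enumerate (suc t) (V ∘ suc) le =
  suc ∘ e , (λ i<j → s≤s (mono i<j)) , V∘e

increasing⇒injective : ∀ {m n} (e : Fin m → Fin n) → (∀ {i j} → i Fin.< j → e i Fin.< e j) →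
                       ∀ {i j} → e i ≡ e j → i ≡ j
increasing⇒injective e mono {i} {j} eq with <-cmp (toℕ i) (toℕ j)
... | tri< i<j _ _ = contradiction (cong toℕ eq) (<⇒≢ (mono i<j))
... | tri≈ _ i≡j _ = Fin.toℕ-injective i≡j
... | tri> _ _ j<i = contradiction (cong toℕ (sym eq)) (<⇒≢ (mono j<i))

anyᵇ : ∀ {n} → (Fin n → Bool) → Bool
anyᵇ {zero}  V = false
anyᵇ {suc n} V = if V zero then true else anyᵇ (V ∘ suc)

anyᵇ⁺ : ∀ {n} (V : Fin n → Bool) i → V i ≡ true → anyᵇ V ≡ true
anyᵇ⁺ V zero    Vi rewrite Vi = refl
anyᵇ⁺ V (suc i) Vi with V zero
... | true  = refl
... | false = anyᵇ⁺ (V ∘ suc) i Vi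

anyᵇ⁻ : ∀ {n} (V : Fin n → Bool) → anyᵇ V ≡ true → ∃ λ i → V i ≡ true
anyᵇ⁻ {suc n} V any with V zero in eq
... | true  = zero , eq
... | false with i , Vi ← anyᵇ⁻ (V ∘ suc) any = suc i , Vi

-- Counting permutations

unique-lookup-injective : ∀ {a ℓ} (A : Setoid a ℓ) {xs} → Unique A xs → ∀ i j → Setoid._≈_ A (lookup xs i) (lookup xs j) → i ≡ j
unique-lookup-injective A (x≉ ∷ u) zero    zero    eq = refl
unique-lookup-injective A (x≉ ∷ u) zero    (suc j) eq = contradiction eq (All.lookup x≉ (∈-lookup j))
unique-lookup-injective A (x≉ ∷ u) (suc i) zero    eq = contradiction (Setoid.sym A eq) (All.lookup x≉ (∈-lookup i))
unique-lookup-injective A (x≉ ∷ u) (suc i) (suc j) eq = cong suc (unique-lookup-injective A u i j eq)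

Avoids-resp : ∀ {n k} (U : PermutationSet k) {σ τ : Permutation′ n} → σ ≈ τ → Avoids σ U → Avoids τ U
Avoids-resp U {σ} {τ} σ≈τ = All.map λ {π} ¬c (x , mono , iso) → ¬c (x , mono , λ i j →
  subst₂ (λ a b → (a Fin.< b) Function.⇔ (π ⟨$⟩ʳ i Fin.< π ⟨$⟩ʳ j)) (sym (σ≈τ (x i))) (sym (σ≈τ (x j))) (iso i j))

module _ {n k : ℕ} (U : PermutationSet k) where
  private
    open Membership (permutationSetoid n)

    avoiders : List (Permutation′ n)
    avoiders = filter (avoids? U) (permutations n)

    ∈-avoiders : ∀ σ → Avoids σ U → σ ∈ avoiders
    ∈-avoiders σ av = ∈ₛ.∈-filter⁺ (permutationSetoid n) (avoids? U)
      (λ {σ} {τ} → Avoids-resp U {σ} {τ}) {v = σ} (permutations-complete σ) av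

    unique-avoiders : Unique (permutationSetoid n) avoiders
    unique-avoiders = Uniqueₛ.filter⁺ (permutationSetoid n) (avoids? U) (permutations-unique n)

  avoider : Fin (S n U) → Permutation′ n
  avoider = lookup avoiders

  avoider-avoids : ∀ i → Avoids (avoider i) U
  avoider-avoids i = All.lookup (all-filter (avoids? U) (permutations n)) (∈-lookup i)

  avoider-injective : ∀ i j → avoider i ≈ avoider j → i ≡ j
  avoider-injective = unique-lookup-injective (permutationSetoid n) unique-avoiders

  avoiderIndex : ∀ σ → Avoids σ U → Fin (S n U)
  avoiderIndex σ av = Any.index (∈-avoiders σ av)

  avoiderIndex-injective : ∀ σ τ σ-av τ-av → avoiderIndex σ σ-av ≡ avoiderIndex τ τ-av → σ ≈ τ
  avoiderIndex-injective σ τ σ-av τ-av =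
    ∈ₛ.index-injective (permutationSetoid n) {σ} {τ} (∈-avoiders σ σ-av) (∈-avoiders τ τ-av)

  avoiders≥ : ∀ {t} (F : Fin t → Permutation′ n) → (∀ i → Avoids (F i) U) →
              (∀ i j → F i ≈ F j → i ≡ j) → t ≤ S n U
  avoiders≥ F av inj = Fin.injective⇒≤ {f = λ i → avoiderIndex (F i) (av i)} λ {i} {j} eq →
    inj i j (avoiderIndex-injective (F i) (F j) (av i) (av j) eq)

  avoiders≤ : ∀ {t} (code : Permutation′ n → Fin t) →
              (∀ σ τ → Avoids σ U → Avoids τ U → code σ ≡ code τ → σ ≈ τ) → S n U ≤ t
  avoiders≤ code inj = Fin.injective⇒≤ {f = code ∘ avoider} λ {i} {j} eq →
    avoider-injective i j (inj (avoider i) (avoider j) (avoider-avoids i) (avoider-avoids j) eq)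

# : ∀ {A : Set} → (A → Bool) → List A → ℕ
# p []       = 0
# p (x ∷ xs) = 𝟙 (p x) + # p xs

module _ {A : Set} where

  #-++ : ∀ (p : A → Bool) xs ys → # p (xs ++ ys) ≡ # p xs + # p ys
  #-++ p []       ys = refl
  #-++ p (x ∷ xs) ys = trans (cong (𝟙 (p x) +_) (#-++ p xs ys)) (sym (+-assoc (𝟙 (p x)) _ _))

  #-map : ∀ {B : Set} (p : A → Bool) (f : B → A) xs → # p (map f xs) ≡ # (p ∘ f) xs
  #-map p f []       = refl
  #-map p f (x ∷ xs) = cong (𝟙 (p (f x)) +_) (#-map p f xs)

  #-cong : ∀ {p q : A → Bool} → (∀ x → p x ≡ q x) → ∀ xs → # p xs ≡ # q xs
  #-cong p≗q []       = refl
  #-cong p≗q (x ∷ xs) = cong₂ _+_ (cong 𝟙 (p≗q x)) (#-cong p≗q xs)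

  #-false : ∀ (xs : List A) → # (const false) xs ≡ 0
  #-false []       = refl
  #-false (x ∷ xs) = #-false xs

  #-product : ∀ {B : Set} {m n} (p : A → Bool) (f : Fin m → B → A) (g : Fin n → Fin m) ys →
              # p (cartesianProductWith f (tabulate g) ys) ≡ sum λ i → # (p ∘ f (g i)) ys
  #-product {n = zero}  p f g ys = refl
  #-product {n = suc n} p f g ys = trans (#-++ p (map (f (g zero)) ys) _)
    (cong₂ _+_ (#-map p (f (g zero)) ys) (#-product p f (g ∘ suc) ys))

  -- The union bound: every element that fails `P` is charged to an event that covers it.
  #-filter : ∀ {m} {P : A → Set} (P? : ∀ x → Dec (P x)) (p : Fin m → A → Bool) →
             (∀ x → ¬ P x → ∃ λ e → p e x ≡ true) → ∀ xs →
             length xs ≤ length (filter P? xs) + sum λ e → # (p e) xs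
  #-filter P? p cover []       = z≤n
  #-filter {m} P? p cover (x ∷ xs) with P? x
  ... | yes Px = s≤s (≤-trans (#-filter P? p cover xs)
                   (+-monoʳ-≤ _ (sum-mono λ e → m≤n+m _ (𝟙 (p e x)))))
  ... | no ¬Px = begin
    1 + length xs                                           ≤⟨ s≤s (#-filter P? p cover xs) ⟩
    1 + (length (filter P? xs) + sum λ e → # (p e) xs)      ≡⟨ +-suc _ _ ⟨
    length (filter P? xs) + (1 + sum λ e → # (p e) xs)      ≤⟨ +-monoʳ-≤ _ (sum-mono-< (λ e → m≤n+m _ (𝟙 (p e x))) e e-hits) ⟩
    length (filter P? xs) + sum (λ e → # (p e) (x ∷ xs))    ∎
    where
    open ≤-Reasoning
    e : Fin m
    e = proj₁ (cover x ¬Px)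
    e-hits : # (p e) xs < # (p e) (x ∷ xs)
    e-hits rewrite proj₂ (cover x ¬Px) = ≤-refl

-- The falling factorial `c (c - 1) ... (c - a + 1)`. It vanishes for `a > c`, since the factor zero
-- is then among the factors.
fall : ℕ → ℕ → ℕ
fall c zero    = 1
fall c (suc a) = c * fall (pred c) a

fall-suc : ∀ c a → fall c (suc a) ≡ fall c a * (c ∸ a)
fall-suc c zero    = trans (*-identityʳ c) (sym (+-identityʳ c))
fall-suc c (suc a) = begin
  c * fall (pred c) (suc a)          ≡⟨ cong (c *_) (fall-suc (pred c) a) ⟩
  c * (fall (pred c) a * (pred c ∸ a)) ≡⟨ *-assoc c _ _ ⟨
  fall c (suc a) * (pred c ∸ a)      ≡⟨ cong (fall c (suc a) *_) (pred-∸ c) ⟩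
  fall c (suc a) * (c ∸ suc a)       ∎
  where
  open ≡-Reasoning
  pred-∸ : ∀ c → pred c ∸ a ≡ c ∸ suc a
  pred-∸ zero    = 0∸n≡0 a
  pred-∸ (suc c) = refl

fall-zero : ∀ {c a} → c < a → fall c a ≡ 0
fall-zero {zero}  {suc a} _         = refl
fall-zero {suc c} {suc a} (s≤s c<a) = trans (cong (suc c *_) (fall-zero c<a)) (*-zeroʳ (suc c))

fall-! : ∀ a e → fall (a + e) a * e ! ≡ (a + e) !
fall-! zero    e = +-identityʳ (e !)
fall-! (suc a) e = trans (*-assoc (suc (a + e)) (fall (a + e) a) (e !)) (cong (suc (a + e) *_) (fall-! a e))

-- Factor by factor, `(c - i)/(n - i) ≤ c/n`: draws without replacement all hit a fixed subset with
-- at most the probability of draws with replacement.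
fall-ratio : ∀ {c n} → c ≤ n → ∀ a → fall c a * n ^ a ≤ fall n a * c ^ a
fall-ratio         c≤n zero    = ≤-refl
fall-ratio {c} {n} c≤n (suc a) = begin
  fall c (suc a) * n ^ suc a              ≡⟨ cong (_* n ^ suc a) (fall-suc c a) ⟩
  fall c a * (c ∸ a) * (n * n ^ a)        ≡⟨ shuffle (fall c a) (c ∸ a) n (n ^ a) ⟩
  fall c a * n ^ a * ((c ∸ a) * n)        ≤⟨ *-mono-≤ (fall-ratio c≤n a) step ⟩
  fall n a * c ^ a * ((n ∸ a) * c)        ≡⟨ shuffle (fall n a) (n ∸ a) c (c ^ a) ⟨
  fall n a * (n ∸ a) * (c * c ^ a)        ≡⟨ cong (_* c ^ suc a) (fall-suc n a) ⟨
  fall n (suc a) * c ^ suc a              ∎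
  where
  open ≤-Reasoning
  shuffle : ∀ f d n p → f * d * (n * p) ≡ f * p * (d * n)
  shuffle = solve-∀
  step : (c ∸ a) * n ≤ (n ∸ a) * c
  step = begin
    (c ∸ a) * n   ≡⟨ *-distribʳ-∸ n c a ⟩
    c * n ∸ a * n ≤⟨ ∸-mono (≤-reflexive (*-comm c n)) (*-monoʳ-≤ a c≤n) ⟩
    n * c ∸ a * c ≡⟨ *-distribʳ-∸ c n a ⟨
    (n ∸ a) * c   ∎

into : ∀ {m n} → (Fin m → Bool) → (Fin n → Bool) → (Fin m → Fin n) → Bool
into {zero}  A V g = true
into {suc m} A V g = (if A zero then V (g zero) else true) ∧ into (A ∘ suc) V (g ∘ suc)

into-cong : ∀ {m n n′} (A : Fin m → Bool) (V : Fin n → Bool) (V′ : Fin n′ → Bool) {g g′} →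
            (∀ i → V (g i) ≡ V′ (g′ i)) → into A V g ≡ into A V′ g′
into-cong {zero}  A V V′ eq = refl
into-cong {suc m} A V V′ eq =
  cong₂ _∧_ (cong (λ b → if A zero then b else true) (eq zero)) (into-cong (A ∘ suc) V V′ (eq ∘ suc))

into-insert : ∀ {n} (A : Fin (suc n) → Bool) V j (π : Permutation′ n) {a b} → A zero ≡ a → V j ≡ b →
              into A V (insert zero j π ⟨$⟩ʳ_) ≡
              (if a then b else true) ∧ into (A ∘ suc) (V ∘ punchIn j) (π ⟨$⟩ʳ_)
into-insert A V j π refl refl = cong ((if A zero then V j else true) ∧_)
  (into-cong (A ∘ suc) V (V ∘ punchIn j) (λ i → cong V (insert-punchIn zero j π i)))

card-punchIn : ∀ {n} (V : Fin (suc n) → Bool) j → card V ≡ 𝟙 (V j) + card (V ∘ punchIn j)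
card-punchIn V j = sum-remove {i = j} (𝟙 ∘ V)

∸-+-suc : ∀ {a c d e} → a ≤ c → c + d ≡ suc (a + e) → c ∸ a + d ≡ suc e
∸-+-suc {a} {c} {d} {e} a≤c eq = +-cancelˡ-≡ a _ _ (begin
  a + (c ∸ a + d) ≡⟨ +-assoc a _ _ ⟨
  a + (c ∸ a) + d ≡⟨ cong (_+ d) (m+[n∸m]≡n a≤c) ⟩
  c + d           ≡⟨ eq ⟩
  suc (a + e)     ≡⟨ +-suc a e ⟨
  a + suc e       ∎)
  where open ≡-Reasoning

module _ where
  open ≤-Reasoning

  -- The restriction to `A` is an injection into `V`, and the remaining values are arranged freely.
  -- The induction fixes the first value `j`, whose removal shrinks `V` exactly when `j` belongs to
  -- `V`.
  #into≤ : ∀ n (A V : Fin n → Bool) →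
           # (into A V ∘ _⟨$⟩ʳ_) (permutations n) ≤ fall (card V) (card A) * card (not ∘ A) !
  #into≤ zero    A V = ≤-refl
  #into≤ (suc n) A V = cases (A zero) refl
    where
    product : # (into A V ∘ _⟨$⟩ʳ_) (permutations (suc n)) ≡ sum (λ j → # (into A V ∘ _⟨$⟩ʳ_ ∘ insert zero j) (permutations n))
    product = #-product (into A V ∘ _⟨$⟩ʳ_) (insert zero) id (permutations n)
    cases : ∀ b → A zero ≡ b → # (into A V ∘ _⟨$⟩ʳ_) (permutations (suc n)) ≤
            fall (card V) (𝟙 b + card (A ∘ suc)) * (𝟙 (not b) + card (not ∘ A ∘ suc)) !
    cases true A₀ = begin
      # (into A V ∘ _⟨$⟩ʳ_) (permutations (suc n))                        ≡⟨ product ⟩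
      sum (λ j → # (into A V ∘ _⟨$⟩ʳ_ ∘ insert zero j) (permutations n))  ≤⟨ sum-mono step ⟩
      sum (λ j → 𝟙 (V j) * X)                                             ≡⟨ *-distribʳ-sum X (𝟙 ∘ V) ⟨
      card V * X                                                          ≡⟨ *-assoc (card V) _ _ ⟨
      fall (card V) (suc (card (A ∘ suc))) * card (not ∘ A ∘ suc) !       ∎
      where
      X : ℕ
      X = fall (pred (card V)) (card (A ∘ suc)) * card (not ∘ A ∘ suc) !
      step : ∀ j → # (into A V ∘ _⟨$⟩ʳ_ ∘ insert zero j) (permutations n) ≤ 𝟙 (V j) * X
      step j = go (V j) refl
        where
        go : ∀ b → V j ≡ b → # (into A V ∘ _⟨$⟩ʳ_ ∘ insert zero j) (permutations n) ≤ 𝟙 b * X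
        go false Vⱼ = ≤-reflexive (trans (#-cong (λ π → into-insert A V j π A₀ Vⱼ) (permutations n)) (#-false (permutations n)))
        go true  Vⱼ = begin
          # (into A V ∘ _⟨$⟩ʳ_ ∘ insert zero j) (permutations n)                             ≡⟨ #-cong (λ π → into-insert A V j π A₀ Vⱼ) (permutations n) ⟩
          # (into (A ∘ suc) (V ∘ punchIn j) ∘ _⟨$⟩ʳ_) (permutations n)                       ≤⟨ #into≤ n (A ∘ suc) (V ∘ punchIn j) ⟩
          fall (card (V ∘ punchIn j)) (card (A ∘ suc)) * card (not ∘ A ∘ suc) !              ≡⟨ cong (λ c → fall (pred c) (card (A ∘ suc)) * card (not ∘ A ∘ suc) !) eq ⟨
          X                                                                                  ≡⟨ +-identityʳ X ⟨
          X + 0                                                                              ∎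
          where
          eq : card V ≡ suc (card (V ∘ punchIn j))
          eq = trans (card-punchIn V j) (cong (λ b → 𝟙 b + card (V ∘ punchIn j)) Vⱼ)
    cases false A₀ = begin
      # (into A V ∘ _⟨$⟩ʳ_) (permutations (suc n))                        ≡⟨ product ⟩
      sum (λ j → # (into A V ∘ _⟨$⟩ʳ_ ∘ insert zero j) (permutations n))  ≤⟨ sum-mono step ⟩
      sum (λ j → 𝟙 (V j) * (X * e !) + 𝟙 (not (V j)) * (Y * e !))         ≡⟨ ∑-distrib-+ (λ j → 𝟙 (V j) * (X * e !)) (λ j → 𝟙 (not (V j)) * (Y * e !)) ⟩
      sum (λ j → 𝟙 (V j) * (X * e !)) + sum (λ j → 𝟙 (not (V j)) * (Y * e !))
        ≡⟨ cong₂ _+_ (*-distribʳ-sum (X * e !) (𝟙 ∘ V)) (*-distribʳ-sum (Y * e !) (𝟙 ∘ not ∘ V)) ⟨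
      card V * (X * e !) + card (not ∘ V) * (Y * e !)                     ≡⟨ cong (_+ card (not ∘ V) * (Y * e !)) (*-assoc (card V) X (e !)) ⟨
      fall (card V) (suc a) * e ! + card (not ∘ V) * (Y * e !)            ≡⟨ cong (λ z → z * e ! + card (not ∘ V) * (Y * e !)) (fall-suc (card V) a) ⟩
      Y * (card V ∸ a) * e ! + card (not ∘ V) * (Y * e !)                 ≡⟨ collect Y (card V ∸ a) (e !) (card (not ∘ V)) ⟩
      Y * ((card V ∸ a + card (not ∘ V)) * e !)                           ≡⟨ final ⟩
      Y * (suc e * e !)                                                   ∎
      where
      a e X Y : ℕ
      a = card (A ∘ suc)
      e = card (not ∘ A ∘ suc)
      X = fall (pred (card V)) a
      Y = fall (card V) a
      collect : ∀ y d f v → y * d * f + v * (y * f) ≡ y * ((d + v) * f)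
      collect = solve-∀
      step : ∀ j → # (into A V ∘ _⟨$⟩ʳ_ ∘ insert zero j) (permutations n) ≤ 𝟙 (V j) * (X * e !) + 𝟙 (not (V j)) * (Y * e !)
      step j = go (V j) refl
        where
        rest : # (into A V ∘ _⟨$⟩ʳ_ ∘ insert zero j) (permutations n) ≤ fall (card (V ∘ punchIn j)) a * e !
        rest = ≤-trans (≤-reflexive (#-cong (λ π → into-insert A V j π A₀ refl) (permutations n))) (#into≤ n (A ∘ suc) (V ∘ punchIn j))
        go : ∀ b → V j ≡ b → # (into A V ∘ _⟨$⟩ʳ_ ∘ insert zero j) (permutations n) ≤ 𝟙 b * (X * e !) + 𝟙 (not b) * (Y * e !)
        go true  Vⱼ = ≤-trans rest (≤-reflexive (trans
          (cong (λ c → fall (pred c) a * e !) (sym (trans (card-punchIn V j) (cong (λ b → 𝟙 b + card (V ∘ punchIn j)) Vⱼ))))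
          (sym (trans (+-identityʳ _) (+-identityʳ _)))))
        go false Vⱼ = ≤-trans rest (≤-reflexive (trans
          (cong (λ c → fall c a * e !) (sym (trans (card-punchIn V j) (cong (λ b → 𝟙 b + card (V ∘ punchIn j)) Vⱼ))))
          (sym (+-identityʳ _))))
      -- The contributions of values inside and outside `V` add up to `suc e`. If `a > card V`, the
      -- truncated difference breaks this count, but then `Y` is zero.
      final : Y * ((card V ∸ a + card (not ∘ V)) * e !) ≡ Y * (suc e * e !)
      final with a ≤? card V
      ... | yes a≤c = cong (λ z → Y * (z * e !)) (∸-+-suc a≤c
        (trans (card-not V) (cong suc (sym (card-not (A ∘ suc))))))
      ... | no a≰c rewrite fall-zero (≰⇒> a≰c) = refl

  -- By `fall-ratio` a uniform permutation does no better at mapping `A` into `V` than independent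
  -- uniform values. All density estimates for the grid set rest on this.
  #into-ratio : ∀ n (A V : Fin n → Bool) →
                # (into A V ∘ _⟨$⟩ʳ_) (permutations n) * n ^ card A ≤ n ! * card V ^ card A
  #into-ratio n A V = begin
    # (into A V ∘ _⟨$⟩ʳ_) (permutations n) * n ^ a ≤⟨ *-monoˡ-≤ (n ^ a) (#into≤ n A V) ⟩
    fall c a * e ! * n ^ a                         ≡⟨ swap (fall c a) (e !) (n ^ a) ⟩
    fall c a * n ^ a * e !                         ≤⟨ *-monoˡ-≤ (e !) (fall-ratio (card≤ V) a) ⟩
    fall n a * c ^ a * e !                         ≡⟨ swap (fall n a) (c ^ a) (e !) ⟩
    fall n a * e ! * c ^ a                         ≡⟨ cong (_* c ^ a) (subst (λ n → fall n a * e ! ≡ n !) (card-not A) (fall-! a e)) ⟩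
    n ! * c ^ a                                    ∎
    where
    a c e : ℕ
    a = card A
    c = card V
    e = card (not ∘ A)
    swap : ∀ x y z → x * y * z ≡ x * z * y
    swap = solve-∀

length-permutations : ∀ n → length (permutations n) ≡ n !
length-permutations zero    = refl
length-permutations (suc n) = trans (length-product (suc n) id)
  (cong (suc n *_) (length-permutations n))
  where
  length-product : ∀ m (g : Fin m → Fin (suc n)) →
    length (cartesianProductWith (insert zero) (tabulate g) (permutations n)) ≡ m * length (permutations n)
  length-product zero    g = refl
  length-product (suc m) g = trans (length-++ (map (insert zero (g zero)) (permutations n)))
    (cong₂ _+_ (length-map (insert zero (g zero)) (permutations n)) (length-product m (g ∘ suc)))

into⁻ : ∀ {m n} (A : Fin m → Bool) (V : Fin n → Bool) g → into A V g ≡ false →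
        ∃ λ i → A i ≡ true × V (g i) ≡ false
into⁻ {suc m} A V g eq with A zero in A₀ | V (g zero) in V₀
... | true  | false = zero , A₀ , V₀
... | true  | true  = let i , Aᵢ , Vᵢ = into⁻ (A ∘ suc) V (g ∘ suc) eq in suc i , Aᵢ , Vᵢ
... | false | _     = let i , Aᵢ , Vᵢ = into⁻ (A ∘ suc) V (g ∘ suc) eq in suc i , Aᵢ , Vᵢ

between : ℕ → ℕ → ∀ {n} → Fin n → Bool
between lo hi i = (lo ≤ᵇ toℕ i) ∧ (toℕ i <ᵇ hi)

≤ᵇ-true : ∀ {m n} → m ≤ n → (m ≤ᵇ n) ≡ true
≤ᵇ-true m≤n = Equivalence.to Bool.T-≡ (≤⇒≤ᵇ m≤n)

between⁺ : ∀ {lo hi n} {i : Fin n} → lo ≤ toℕ i → toℕ i < hi → between lo hi i ≡ true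
between⁺ lo≤i i<hi = cong₂ _∧_ (≤ᵇ-true lo≤i) (≤ᵇ-true i<hi)

between⁻ : ∀ lo hi {n} (i : Fin n) → between lo hi i ≡ true → lo ≤ toℕ i × toℕ i < hi
between⁻ lo hi i eq with lo ≤ᵇ toℕ i in p | toℕ i <ᵇ hi in q
... | true | true = ≤ᵇ⇒≤ lo (toℕ i) (subst T (sym p) _) , <ᵇ⇒< (toℕ i) hi (subst T (sym q) _)

card-between : ∀ {lo hi n} t → lo + t ≤ hi → hi ≤ n → t ≤ card {n} (between lo hi)
card-between {lo} {hi} {n} t lo+t≤hi hi≤n = injective⇒≤card (between lo hi) e inj bet
  where
  lo+i< : ∀ (i : Fin t) → lo + toℕ i < hi
  lo+i< i = <-≤-trans (+-monoʳ-< lo (Fin.toℕ<n i)) lo+t≤hi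
  e : Fin t → Fin n
  e i = fromℕ< (<-≤-trans (lo+i< i) hi≤n)
  toℕ-e : ∀ i → toℕ (e i) ≡ lo + toℕ i
  toℕ-e i = Fin.toℕ-fromℕ< _
  inj : ∀ {i j} → e i ≡ e j → i ≡ j
  inj {i} {j} eq = Fin.toℕ-injective (+-cancelˡ-≡ lo _ _ (trans (sym (toℕ-e i)) (trans (cong toℕ eq) (toℕ-e j))))
  bet : ∀ i → between lo hi (e i) ≡ true
  bet i = between⁺ (subst (lo ≤_) (sym (toℕ-e i)) (m≤m+n lo _)) (subst (_< hi) (sym (toℕ-e i)) (lo+i< i))

card-between≤ : ∀ n {hi} → card {n} (between 0 hi) ≤ hi
card-between≤ zero             = z≤n
card-between≤ (suc n) {zero}   = card-between≤ n {zero}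
card-between≤ (suc n) {suc hi} = s≤s (card-between≤ n {hi})

card-not≤ : ∀ {n t} (V : Fin n → Bool) → t ≤ card V → card (not ∘ V) ≤ n ∸ t
card-not≤ {n} {t} V t≤ = m+n≤o⇒m≤o∸n (card (not ∘ V)) (begin
  card (not ∘ V) + t      ≤⟨ +-monoʳ-≤ _ t≤ ⟩
  card (not ∘ V) + card V ≡⟨ +-comm (card (not ∘ V)) _ ⟩
  card V + card (not ∘ V) ≡⟨ card-not V ⟩
  n                       ∎)
  where open ≤-Reasoning

-- Permutations hitting every block of a grid, and their density

module _ (ρ s k : ℕ) where

  -- Mapping source e into target e means: for e = 0 the first entry is too large, for e = 1 the last entry is
  -- too small, and for the other e a block of the grid is missed.
  source target : Fin (2 + ρ * ρ) → Fin k → Bool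
  source zero          = between 0 1
  source (suc zero)    = between (pred k) k
  source (suc (suc e)) = let a = toℕ (proj₁ (remQuot {ρ} ρ e)) in between (a * s) (suc a * s)
  target zero          = not ∘ between 0 (pred ρ * s)
  target (suc zero)    = between 0 s
  target (suc (suc e)) = let b = toℕ (proj₂ (remQuot {ρ} ρ e)) in not ∘ between (b * s) (suc b * s)

  violates : Fin (2 + ρ * ρ) → Permutation′ k → Bool
  violates e π = into (source e) (target e) (π ⟨$⟩ʳ_)

  good? : (π : Permutation′ k) → Dec (∀ e → violates e π ≡ false)
  good? π = Fin.all? λ e → violates e π Bool.≟ false

  gridSet : PermutationSet k
  gridSet = record
    { elements = filter good? (permutations k)
    ; distinct = Uniqueₛ.filter⁺ (permutationSetoid k) good? (permutations-unique k)
    }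

  record Grid (π : Permutation′ k) : Set where
    field
      hit   : ∀ a b → a < ρ → b < ρ → ∃ λ i →
              (a * s ≤ toℕ i × toℕ i < suc a * s) × (b * s ≤ toℕ (π ⟨$⟩ʳ i) × toℕ (π ⟨$⟩ʳ i) < suc b * s)
      first : ∀ i → toℕ i ≡ 0 → toℕ (π ⟨$⟩ʳ i) < pred ρ * s
      last  : ∀ i → suc (toℕ i) ≡ k → s ≤ toℕ (π ⟨$⟩ʳ i)

  good⇒Grid : ∀ π → (∀ e → violates e π ≡ false) → Grid π
  good⇒Grid π good = record { hit = hit ; first = first ; last = last }
    where
    hit : ∀ a b → a < ρ → b < ρ → ∃ λ i →
          (a * s ≤ toℕ i × toℕ i < suc a * s) × (b * s ≤ toℕ (π ⟨$⟩ʳ i) × toℕ (π ⟨$⟩ʳ i) < suc b * s)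
    hit a b a<ρ b<ρ =
      let split = Fin.remQuot-combine (fromℕ< a<ρ) (fromℕ< b<ρ)
          i , Aᵢ , Vᵢ = into⁻ (between (a * s) (suc a * s)) (not ∘ between (b * s) (suc b * s)) (π ⟨$⟩ʳ_)
            (subst₂ (λ a b → into (between (a * s) (suc a * s)) (not ∘ between (b * s) (suc b * s)) (π ⟨$⟩ʳ_) ≡ false)
              (trans (cong (toℕ ∘ proj₁) split) (Fin.toℕ-fromℕ< a<ρ)) (trans (cong (toℕ ∘ proj₂) split) (Fin.toℕ-fromℕ< b<ρ))
              (good (suc (suc (combine (fromℕ< a<ρ) (fromℕ< b<ρ))))))
      in i , between⁻ (a * s) (suc a * s) i Aᵢ , between⁻ (b * s) (suc b * s) (π ⟨$⟩ʳ i) (Bool.not-injective Vᵢ)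
    first : ∀ i → toℕ i ≡ 0 → toℕ (π ⟨$⟩ʳ i) < pred ρ * s
    first i i≡0 with j , Aⱼ , Vⱼ ← into⁻ (source zero) (target zero) (π ⟨$⟩ʳ_) (good zero)
      with refl ← Fin.toℕ-injective {i = i} {j} (trans i≡0 (sym (n<1⇒n≡0 (proj₂ (between⁻ 0 1 j Aⱼ))))) =
      proj₂ (between⁻ 0 (pred ρ * s) (π ⟨$⟩ʳ i) (Bool.not-injective Vⱼ))
    last : ∀ i → suc (toℕ i) ≡ k → s ≤ toℕ (π ⟨$⟩ʳ i)
    last i i≡k with j , Aⱼ , Vⱼ ← into⁻ (source (suc zero)) (target (suc zero)) (π ⟨$⟩ʳ_) (good (suc zero))
      with refl ← Fin.toℕ-injective {i = i} {j} (trans (cong pred i≡k)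
                    (≤-antisym (proj₁ (between⁻ (pred k) k j Aⱼ)) (<⇒≤pred (Fin.toℕ<n j))))
      with s ≤? toℕ (π ⟨$⟩ʳ i)
    ... | yes s≤ = s≤
    ... | no s≰ with () ← trans (sym (between⁺ {i = π ⟨$⟩ʳ i} z≤n (≰⇒> s≰))) Vⱼ

  gridSet-Grid : All Grid (elements gridSet)
  gridSet-Grid = All.map (λ {π} → good⇒Grid π) (all-filter good? (permutations k))

  module _ (h y : ℕ) (3≤ρ : 3 ≤ ρ) (ρ≤s : ρ ≤ s) (h≤ρ : h ≤ ρ) (ρs≤k : ρ * s ≤ k) (k≤ : k ≤ ρ * s + s + ρ)
           (4ρy≤s : 4 * ρ * y ≤ s) (ρρh≤ : ρ * ρ * h ≤ 2 ^ y) where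
    private
      open ≤-Reasoning

      1≤s : 1 ≤ s
      1≤s = ≤-trans (≤-trans (s≤s z≤n) 3≤ρ) ρ≤s

      3s≤k : 3 * s ≤ k
      3s≤k = ≤-trans (*-monoˡ-≤ s 3≤ρ) ρs≤k

      s≤k : s ≤ k
      s≤k = ≤-trans (m≤m+n s _) 3s≤k

      1≤k : 1 ≤ k
      1≤k = ≤-trans 1≤s s≤k

      instance
        k≢0 : NonZero k
        k≢0 = >-nonZero 1≤k

      ν : Fin (2 + ρ * ρ) → ℕ
      ν e = # (violates e) (permutations k)

      -- Only bounds on the two cardinalities are at hand; lowering the exponent to `a` is allowed
      -- because `c/k` is at most one.
      ratio : ∀ e a c → a ≤ card (source e) → card (target e) ≤ c → c ≤ k → ν e * k ^ a ≤ k ! * c ^ a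
      ratio e a c a≤ ≤c c≤k = *-cancelʳ-≤ _ _ (k ^ b) {{m^n≢0 k b}} (begin
        ν e * k ^ a * k ^ b             ≡⟨ *-assoc (ν e) _ _ ⟩
        ν e * (k ^ a * k ^ b)           ≡⟨ cong (ν e *_) (^-distribˡ-+-* k a b) ⟨
        ν e * k ^ (a + b)               ≡⟨ cong (λ a → ν e * k ^ a) (m+[n∸m]≡n a≤) ⟩
        ν e * k ^ card (source e)       ≤⟨ #into-ratio k (source e) (target e) ⟩
        k ! * card (target e) ^ card (source e) ≤⟨ *-monoʳ-≤ (k !) (^-monoˡ-≤ (card (source e)) ≤c) ⟩
        k ! * c ^ card (source e)       ≡⟨ cong (λ a → k ! * c ^ a) (m+[n∸m]≡n a≤) ⟨
        k ! * c ^ (a + b)               ≡⟨ cong (k ! *_) (^-distribˡ-+-* c a b) ⟩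
        k ! * (c ^ a * c ^ b)           ≡⟨ *-assoc (k !) _ _ ⟨
        k ! * c ^ a * c ^ b             ≤⟨ *-monoʳ-≤ (k ! * c ^ a) (^-monoˡ-≤ b c≤k) ⟩
        k ! * c ^ a * k ^ b             ∎)
        where
        b : ℕ
        b = card (source e) ∸ a

      edge : ∀ e c w → 1 ≤ card (source e) → card (target e) ≤ c → c ≤ k → c * h ≤ w * k → ν e * h ≤ w * k !
      edge e c w 1≤ ≤c c≤k ch≤ = *-cancelʳ-≤ _ _ k (begin
        ν e * h * k         ≡⟨ shuffle (ν e) h k ⟩
        ν e * k ^ 1 * h     ≤⟨ *-monoˡ-≤ h (ratio e 1 c 1≤ ≤c c≤k) ⟩
        k ! * c ^ 1 * h     ≡⟨ shuffle′ (k !) c h ⟩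
        k ! * (c * h)       ≤⟨ *-monoʳ-≤ (k !) ch≤ ⟩
        k ! * (w * k)       ≡⟨ shuffle″ (k !) w k ⟩
        w * k ! * k         ∎)
        where
        shuffle : ∀ x h k → x * h * k ≡ x * (k * 1) * h
        shuffle = solve-∀
        shuffle′ : ∀ x c h → x * (c * 1) * h ≡ x * (c * h)
        shuffle′ = solve-∀
        shuffle″ : ∀ x w k → x * (w * k) ≡ w * x * k
        shuffle″ = solve-∀

      sh≤k : s * h ≤ k
      sh≤k = ≤-trans (*-monoʳ-≤ s h≤ρ) (≤-trans (≤-reflexive (*-comm s ρ)) ρs≤k)

      edge₁ : ν zero * h ≤ 3 * k !
      -- At most `s + ρ ≤ 2 * s` values lie above the grid; with the top row of blocks this makes at
      -- most `3 * s` forbidden values.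
      edge₁ = edge zero (3 * s) 3 (card-between {0} 1 ≤-refl 1≤k)
        (≤-trans (card-not≤ {k} (between 0 (pred ρ * s)) (card-between {0} (pred ρ * s) ≤-refl (≤-trans (*-monoˡ-≤ s (pred[n]≤n {ρ})) ρs≤k)))
          (m≤n+o⇒m∸n≤o k (pred ρ * s) (begin
            k                                   ≤⟨ k≤ ⟩
            ρ * s + s + ρ                       ≤⟨ +-monoʳ-≤ (ρ * s + s) ρ≤s ⟩
            ρ * s + s + s                       ≡⟨ cong (λ ρ → ρ * s + s + s) (suc-pred ρ {{>-nonZero (≤-trans (s≤s z≤n) 3≤ρ)}}) ⟨
            s + pred ρ * s + s + s              ≡⟨ collect s (pred ρ * s) ⟩
            pred ρ * s + 3 * s                  ∎)))
        3s≤k (≤-trans (≤-reflexive (*-assoc 3 s h)) (*-monoʳ-≤ 3 sh≤k))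
        where
        collect : ∀ s t → s + t + s + s ≡ t + 3 * s
        collect = solve-∀

      edge₂ : ν (suc zero) * h ≤ 1 * k !
      edge₂ = edge (suc zero) s 1
        (card-between {pred k} 1 (≤-reflexive (trans (+-comm (pred k) 1) (suc-pred k))) ≤-refl)
        (card-between≤ k) s≤k (≤-trans sh≤k (≤-reflexive (sym (+-identityʳ k))))

      -- Each of the `ρ * ρ` block events receives the share `1/(ρ * ρ * h)`: a block is missed with
      -- probability at most `(1 - s/k)^s ≤ 2^(-y)`.
      block : ∀ e → ρ * ρ * (ν (suc (suc e)) * h) ≤ k !
      block e = begin
        ρ * ρ * (ν e′ * h) ≡⟨ shuffle ρ (ν e′) h ⟩
        ν e′ * (ρ * ρ * h) ≤⟨ *-monoʳ-≤ (ν e′) ρρh≤ ⟩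
        ν e′ * 2 ^ y       ≤⟨ *-cancelʳ-≤ _ _ (k ^ s) {{m^n≢0 k s}} halved ⟩
        k !                ∎
        where
        e′ : Fin (2 + ρ * ρ)
        e′ = suc (suc e)
        a b : Fin ρ
        a = proj₁ (remQuot {ρ} ρ e)
        b = proj₂ (remQuot {ρ} ρ e)
        block≤k : ∀ (a : Fin ρ) → suc (toℕ a) * s ≤ k
        block≤k a = ≤-trans (*-monoˡ-≤ s (Fin.toℕ<n a)) ρs≤k
        block-card : ∀ (a : Fin ρ) → s ≤ card {k} (between (toℕ a * s) (suc (toℕ a) * s))
        block-card a = card-between {toℕ a * s} s (≤-reflexive (+-comm (toℕ a * s) s)) (block≤k a)
        shuffle : ∀ r x h → r * r * (x * h) ≡ x * (r * r * h)
        shuffle = solve-∀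
        x : ℕ
        x = k ∸ s
        x+s≡k : x + s ≡ k
        x+s≡k = m∸n+n≡m s≤k
        instance
          x≢0 : NonZero x
          x≢0 = >-nonZero (m<n⇒0<n∸m (<-≤-trans (m<m+n s (≤-trans 1≤s (m≤m+n s _))) 3s≤k))
        small : x ^ s * 2 ^ y ≤ k ^ s
        -- From `k ≤ 4 ρ s` follows `(1 - s/k)^(4ρ) ≤ 1/2`, and the exponent `s` contains `y`
        -- batches of length `4 ρ`.
        small = extend-≤ {x} {k} {2 ^ y} (m∸n≤m k s) 4ρy≤s (iterate-≤ (4 * ρ) y
          (subst (λ k → x ^ (4 * ρ) * 2 ≤ k ^ (4 * ρ)) x+s≡k (doubling (4 * ρ) x s (begin
            x                     ≤⟨ m∸n≤m k s ⟩
            k                     ≤⟨ k≤ ⟩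
            ρ * s + s + ρ         ≤⟨ +-mono-≤ (+-monoʳ-≤ (ρ * s) (m≤n*m s ρ {{>-nonZero (≤-trans (s≤s z≤n) 3≤ρ)}})) (m≤m*n ρ s {{>-nonZero 1≤s}}) ⟩
            ρ * s + ρ * s + ρ * s ≤⟨ m≤m+n _ (ρ * s) ⟩
            ρ * s + ρ * s + ρ * s + ρ * s ≡⟨ collect ρ s ⟩
            4 * ρ * s             ∎))))
          where
          collect : ∀ r s → r * s + r * s + r * s + r * s ≡ 4 * r * s
          collect = solve-∀
        halved : ν e′ * 2 ^ y * k ^ s ≤ k ! * k ^ s
        halved = begin
          ν e′ * 2 ^ y * k ^ s ≡⟨ swap (ν e′) (2 ^ y) (k ^ s) ⟩
          ν e′ * k ^ s * 2 ^ y ≤⟨ *-monoˡ-≤ (2 ^ y) (ratio e′ s x (block-card a) (card-not≤ {k} _ (block-card b)) (m∸n≤m k s)) ⟩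
          k ! * x ^ s * 2 ^ y  ≡⟨ *-assoc (k !) _ _ ⟩
          k ! * (x ^ s * 2 ^ y) ≤⟨ *-monoʳ-≤ (k !) small ⟩
          k ! * k ^ s          ∎
          where
          swap : ∀ x y z → x * y * z ≡ x * z * y
          swap = solve-∀

      blocks : sum (λ e → ν (suc (suc e))) * h ≤ k !
      blocks = *-cancelˡ-≤ (ρ * ρ) {{>-nonZero (*-mono-≤ {1} {ρ} {1} {ρ} 1≤ρ 1≤ρ)}} (begin
        ρ * ρ * (sum (λ e → ν (suc (suc e))) * h)    ≡⟨ cong (ρ * ρ *_) (*-distribʳ-sum h (λ e → ν (suc (suc e)))) ⟩
        ρ * ρ * sum (λ e → ν (suc (suc e)) * h)      ≡⟨ *-distribˡ-sum (ρ * ρ) (λ e → ν (suc (suc e)) * h) ⟩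
        sum (λ e → ρ * ρ * (ν (suc (suc e)) * h))    ≤⟨ sum-≤-const (k !) block ⟩
        ρ * ρ * k !                                  ∎)
        where
        1≤ρ : 1 ≤ ρ
        1≤ρ = ≤-trans (s≤s z≤n) 3≤ρ

    -- The missing proportion `5/h` is made up of `3/h` and `1/h` for the two end conditions and
    -- `1/h` for all blocks together.
    gridSet-size : k ! * h ≤ size gridSet * h + 5 * k !
    gridSet-size = begin
      k ! * h                                         ≡⟨ cong (_* h) (length-permutations k) ⟨
      length (permutations k) * h                     ≤⟨ *-monoˡ-≤ h (#-filter good? violates cover (permutations k)) ⟩
      (size gridSet + sum ν) * h                      ≡⟨ *-distribʳ-+ h (size gridSet) (sum ν) ⟩
      size gridSet * h + sum ν * h                    ≤⟨ +-monoʳ-≤ (size gridSet * h) bad ⟩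
      size gridSet * h + 5 * k !                      ∎
      where
      cover : ∀ π → ¬ (∀ e → violates e π ≡ false) → ∃ λ e → violates e π ≡ true
      cover π ¬good with e , ¬f ← Fin.¬∀⟶∃¬ (2 + ρ * ρ) _ (λ e → violates e π Bool.≟ false) ¬good = e , Bool.¬-not ¬f
      bad : sum ν * h ≤ 5 * k !
      bad = begin
        (ν zero + (ν (suc zero) + B)) * h            ≡⟨ expand (ν zero) (ν (suc zero)) B h ⟩
        ν zero * h + (ν (suc zero) * h + B * h)      ≤⟨ +-mono-≤ edge₁ (+-mono-≤ edge₂ blocks) ⟩
        3 * k ! + (1 * k ! + k !)                    ≡⟨ collect (k !) ⟩
        5 * k !                                      ∎
        where
        B : ℕ
        B = sum (λ e → ν (suc (suc e)))
        expand : ∀ x y z h → (x + (y + z)) * h ≡ x * h + (y * h + z * h)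
        expand = solve-∀
        collect : ∀ x → 3 * x + (1 * x + x) ≡ 5 * x
        collect = solve-∀

-- Skew sums

injective⇒surjective : ∀ {n} (f : Fin n → Fin n) → (∀ {i j} → f i ≡ f j → i ≡ j) → ∀ y → ∃ λ x → f x ≡ y
injective⇒surjective {suc n} f inj y with Fin.any? (λ x → f x Fin.≟ y)
... | yes found = found
... | no  ¬found = contradiction
  (Fin.injective⇒≤ {f = λ x → punchOut (λ y≡fx → ¬found (x , sym y≡fx))}
    (λ {i} {j} eq → inj (Fin.punchOut-injective (λ y≡fi → ¬found (i , sym y≡fi)) (λ y≡fj → ¬found (j , sym y≡fj)) eq)))
  1+n≰n

-- Ranking distinct keys produces a permutation of prescribed relative order, inverse included, so
-- skew sums and placements of points need only a key function.
module Sorting {n : ℕ} (key : Fin n → ℕ) (key-injective : ∀ {i j} → key i ≡ key j → i ≡ j) where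
  private
    below : Fin n → Fin n → Bool
    below i j = key j <ᵇ key i

    rank : Fin n → ℕ
    rank i = card (below i)

    <ᵇ-irrefl : ∀ x → (x <ᵇ x) ≡ false
    <ᵇ-irrefl x = Bool.¬-not λ eq → <-irrefl refl (<ᵇ⇒< x x (Equivalence.from Bool.T-≡ eq))

    rank< : ∀ i → rank i < n
    rank< i = subst (rank i <_) (trans (sum-const n 1) (*-identityʳ n))
      (sum-mono-< {f = 𝟙 ∘ below i} {const 1} (λ j → 𝟙≤1 (below i j)) i (subst (λ b → 𝟙 b < 1) (sym (<ᵇ-irrefl (key i))) ≤-refl))

    rank-mono : ∀ {i j} → key i < key j → rank i < rank j
    rank-mono {i} {j} i<j = sum-mono-< {f = 𝟙 ∘ below i} le i
      (subst₂ (λ b c → 𝟙 b < 𝟙 c) (sym (<ᵇ-irrefl (key i))) (sym (≤ᵇ-true i<j)) ≤-refl)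
      where
      le : ∀ l → 𝟙 (below i l) ≤ 𝟙 (below j l)
      le l with key l <ᵇ key i in eq
      ... | false = z≤n
      ... | true  rewrite ≤ᵇ-true (<-trans (<ᵇ⇒< (key l) (key i) (Equivalence.from Bool.T-≡ eq)) i<j) = ≤-refl

    to : Fin n → Fin n
    to i = fromℕ< (rank< i)

    to-mono : ∀ {i j} → key i < key j → to i Fin.< to j
    to-mono {i} {j} i<j = subst₂ _<_ (sym (Fin.toℕ-fromℕ< (rank< i))) (sym (Fin.toℕ-fromℕ< (rank< j))) (rank-mono i<j)

    to-injective : ∀ {i j} → to i ≡ to j → i ≡ j
    to-injective {i} {j} eq with <-cmp (key i) (key j)
    ... | tri< i<j _ _ = contradiction (cong toℕ eq) (<⇒≢ (to-mono i<j))
    ... | tri≈ _ i≡j _ = key-injective i≡j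
    ... | tri> _ _ j<i = contradiction (cong toℕ (sym eq)) (<⇒≢ (to-mono j<i))

  sorting : Permutation′ n
  sorting = permutation to (λ y → proj₁ (injective⇒surjective to to-injective y))
    (λ y → proj₂ (injective⇒surjective to to-injective y))
    (λ x → to-injective (proj₂ (injective⇒surjective to to-injective (to x))))

  sorting-⇔ : ∀ i j → (sorting ⟨$⟩ʳ i Fin.< sorting ⟨$⟩ʳ j) ⇔ (key i < key j)
  sorting-⇔ i j = mk⇔ from to-mono
    where
    from : to i Fin.< to j → key i < key j
    from lt with <-cmp (key i) (key j)
    ... | tri< i<j _ _ = i<j
    ... | tri≈ _ i≡j _ = contradiction (cong (toℕ ∘ to) (key-injective i≡j)) (<⇒≢ lt)
    ... | tri> _ _ j<i = contradiction lt (<-asym (to-mono j<i))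

open Sorting public

increasing⇒≤ : ∀ {m n} (f : Fin m → Fin n) → (∀ {i j} → i Fin.< j → f i Fin.< f j) → ∀ t i → toℕ i ≡ t → t ≤ toℕ (f i)
increasing⇒≤ f mono zero    i       eq = z≤n
increasing⇒≤ f mono (suc t) (suc i) eq =
  ≤-<-trans (increasing⇒≤ f mono t (Fin.inject₁ i) (trans (Fin.toℕ-inject₁ i) (suc-injective eq)))
            (mono (s≤s (≤-reflexive (Fin.toℕ-inject₁ i))))

-- The map `τ ∘ σ⁻¹` is increasing and hence at least the identity; exchanging `σ` and `τ` gives
-- equality.
order-determines : ∀ {n} (σ τ : Permutation′ n) →
                   (∀ i j → (σ ⟨$⟩ʳ i Fin.< σ ⟨$⟩ʳ j) ⇔ (τ ⟨$⟩ʳ i Fin.< τ ⟨$⟩ʳ j)) → σ ≈ τ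
order-determines σ τ iso i = Fin.toℕ-injective (≤-antisym (half σ τ (λ i j → Equivalence.to (iso i j)) i)
                                                          (half τ σ (λ i j → Equivalence.from (iso i j)) i))
  where
  half : ∀ σ τ → (∀ i j → σ ⟨$⟩ʳ i Fin.< σ ⟨$⟩ʳ j → τ ⟨$⟩ʳ i Fin.< τ ⟨$⟩ʳ j) → ∀ i → toℕ (σ ⟨$⟩ʳ i) ≤ toℕ (τ ⟨$⟩ʳ i)
  half σ τ mono i = subst (λ l → toℕ (σ ⟨$⟩ʳ i) ≤ toℕ (τ ⟨$⟩ʳ l)) (inverseˡ σ)
    (increasing⇒≤ (λ v → τ ⟨$⟩ʳ (σ ⟨$⟩ˡ v))
      (λ {u} {v} u<v → mono _ _ (subst₂ Fin._<_ (sym (inverseʳ σ)) (sym (inverseʳ σ)) u<v)) _ (σ ⟨$⟩ʳ i) refl)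

module _ {m n : ℕ} (σ : Permutation′ m) (τ : Permutation′ n) where

  skewKey : Fin (m + n) → ℕ
  skewKey i = [ (λ a → n + toℕ (σ ⟨$⟩ʳ a)) , (λ b → toℕ (τ ⟨$⟩ʳ b)) ]′ (splitAt m i)

  skewKey-ˡ : ∀ a → skewKey (a ↑ˡ n) ≡ n + toℕ (σ ⟨$⟩ʳ a)
  skewKey-ˡ a rewrite Fin.splitAt-↑ˡ m a n = refl

  skewKey-ʳ : ∀ b → skewKey (m ↑ʳ b) ≡ toℕ (τ ⟨$⟩ʳ b)
  skewKey-ʳ b rewrite Fin.splitAt-↑ʳ m n b = refl

  private
    perm-injective : ∀ {l} (π : Permutation′ l) {i j} → π ⟨$⟩ʳ i ≡ π ⟨$⟩ʳ j → i ≡ j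
    perm-injective π eq = trans (sym (inverseˡ π)) (trans (cong (π ⟨$⟩ˡ_) eq) (inverseˡ π))

  skewKey-injective : ∀ {i j} → skewKey i ≡ skewKey j → i ≡ j
  skewKey-injective {i} {j} eq with splitAt m i in p | splitAt m j in q
  ... | inj₁ a | inj₁ a′ = trans (sym (Fin.splitAt⁻¹-↑ˡ p)) (trans (cong (_↑ˡ n) (perm-injective σ (Fin.toℕ-injective (+-cancelˡ-≡ n _ _ eq)))) (Fin.splitAt⁻¹-↑ˡ q))
  ... | inj₁ a | inj₂ b = contradiction eq (>⇒≢ (<-≤-trans (Fin.toℕ<n (τ ⟨$⟩ʳ b)) (m≤m+n n _)))
  ... | inj₂ b | inj₁ a = contradiction eq (<⇒≢ (<-≤-trans (Fin.toℕ<n (τ ⟨$⟩ʳ b)) (m≤m+n n _)))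
  ... | inj₂ b | inj₂ b′ = trans (sym (Fin.splitAt⁻¹-↑ʳ p)) (trans (cong (m ↑ʳ_) (perm-injective τ (Fin.toℕ-injective eq))) (Fin.splitAt⁻¹-↑ʳ q))

  infixl 6 _⊖_
  _⊖_ : Permutation′ (m + n)
  _⊖_ = sorting skewKey skewKey-injective

  ⊖-⇔ : ∀ i j → (_⊖_ ⟨$⟩ʳ i Fin.< _⊖_ ⟨$⟩ʳ j) ⇔ (skewKey i < skewKey j)
  ⊖-⇔ = sorting-⇔ skewKey skewKey-injective

  ⊖-ˡ : ∀ a a′ → (_⊖_ ⟨$⟩ʳ (a ↑ˡ n) Fin.< _⊖_ ⟨$⟩ʳ (a′ ↑ˡ n)) ⇔ (σ ⟨$⟩ʳ a Fin.< σ ⟨$⟩ʳ a′)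
  ⊖-ˡ a a′ = mk⇔
    (λ lt → +-cancelˡ-< n _ _ (subst₂ _<_ (skewKey-ˡ a) (skewKey-ˡ a′) (Equivalence.to (⊖-⇔ _ _) lt)))
    (λ lt → Equivalence.from (⊖-⇔ _ _) (subst₂ _<_ (sym (skewKey-ˡ a)) (sym (skewKey-ˡ a′)) (+-monoʳ-< n lt)))

  ⊖-ʳ : ∀ b b′ → (_⊖_ ⟨$⟩ʳ (m ↑ʳ b) Fin.< _⊖_ ⟨$⟩ʳ (m ↑ʳ b′)) ⇔ (τ ⟨$⟩ʳ b Fin.< τ ⟨$⟩ʳ b′)
  ⊖-ʳ b b′ = mk⇔
    (λ lt → subst₂ _<_ (skewKey-ʳ b) (skewKey-ʳ b′) (Equivalence.to (⊖-⇔ _ _) lt))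
    (λ lt → Equivalence.from (⊖-⇔ _ _) (subst₂ _<_ (sym (skewKey-ʳ b)) (sym (skewKey-ʳ b′)) lt))

  ⊖-ʳˡ : ∀ a b → _⊖_ ⟨$⟩ʳ (m ↑ʳ b) Fin.< _⊖_ ⟨$⟩ʳ (a ↑ˡ n)
  ⊖-ʳˡ a b = Equivalence.from (⊖-⇔ _ _) (subst₂ _<_ (sym (skewKey-ʳ b)) (sym (skewKey-ˡ a)) (<-≤-trans (Fin.toℕ<n (τ ⟨$⟩ʳ b)) (m≤m+n n _)))

⇔-trans : ∀ {A B C : Set} → A ⇔ B → B ⇔ C → A ⇔ C
⇔-trans f g = mk⇔ (Equivalence.to g ∘ Equivalence.to f) (Equivalence.from f ∘ Equivalence.from g)

⇔-sym : ∀ {A B : Set} → A ⇔ B → B ⇔ A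
⇔-sym f = mk⇔ (Equivalence.from f) (Equivalence.to f)

SkewIndecomposable : ∀ {k} → Permutation′ k → Set
SkewIndecomposable {k} π = ∀ j → 0 < j → j < k →
  ¬ (∀ p q → toℕ p < j → j ≤ toℕ q → π ⟨$⟩ʳ q Fin.< π ⟨$⟩ʳ p)

module _ {k m n : ℕ} (σ : Permutation′ m) (τ : Permutation′ n) (π : Permutation′ k) where
  private
    left : ∀ (z : Fin (m + n)) → toℕ z < m → ∃ λ a → z ≡ a ↑ˡ n
    left z z<m = Fin.fromℕ< z<m , Fin.toℕ-injective (trans (sym (Fin.toℕ-fromℕ< z<m)) (sym (Fin.toℕ-↑ˡ _ n)))

    right : ∀ (z : Fin (m + n)) → m ≤ toℕ z → ∃ λ b → z ≡ m ↑ʳ b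
    right z m≤z with splitAt m z in eq
    ... | inj₁ a = contradiction (subst (_< m) (trans (sym (Fin.toℕ-↑ˡ a n)) (cong toℕ (Fin.splitAt⁻¹-↑ˡ eq))) (Fin.toℕ<n a)) (≤⇒≯ m≤z)
    ... | inj₂ b = b , sym (Fin.splitAt⁻¹-↑ʳ eq)

  -- The pattern positions that fall into the left summand form an initial segment. An empty or full
  -- segment puts the whole copy into one summand; any other segment is a skew cut of `π`.
  ⊖-avoids : SkewIndecomposable π → ¬ Contains σ π → ¬ Contains τ π → ¬ Contains (σ ⊖ τ) π
  ⊖-avoids indec ¬σ ¬τ (x , mono , iso) with Fin.all? (λ i → toℕ (x i) <? m)
  ... | yes all-left = ¬σ (a , a-mono , a-iso)
    where
    a : Fin k → Fin m
    a i = proj₁ (left (x i) (all-left i))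
    xa : ∀ i → x i ≡ a i ↑ˡ n
    xa i = proj₂ (left (x i) (all-left i))
    toℕ-a : ∀ i → toℕ (x i) ≡ toℕ (a i)
    toℕ-a i = trans (cong toℕ (xa i)) (Fin.toℕ-↑ˡ (a i) n)
    a-mono : ∀ i j → i Fin.< j → a i Fin.< a j
    a-mono i j i<j = subst₂ _<_ (toℕ-a i) (toℕ-a j) (mono i j i<j)
    a-iso : ∀ i j → (σ ⟨$⟩ʳ a i Fin.< σ ⟨$⟩ʳ a j) ⇔ (π ⟨$⟩ʳ i Fin.< π ⟨$⟩ʳ j)
    a-iso i j = ⇔-trans (⇔-sym (⊖-ˡ σ τ (a i) (a j)))
      (subst₂ (λ u v → (σ ⊖ τ ⟨$⟩ʳ u Fin.< σ ⊖ τ ⟨$⟩ʳ v) ⇔ (π ⟨$⟩ʳ i Fin.< π ⟨$⟩ʳ j)) (xa i) (xa j) (iso i j))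
  ... | no ¬all-left with Fin.¬∀⟶∃¬-smallest k _ (λ i → toℕ (x i) <? m) ¬all-left
  ...   | zero , x₀≮ , _ = ¬τ (b , b-mono , b-iso)
    where
    x≥ : ∀ i → m ≤ toℕ (x i)
    x≥ zero    = ≮⇒≥ x₀≮
    x≥ (suc i) = ≤-trans (≮⇒≥ x₀≮) (<⇒≤ (mono zero (suc i) (s≤s z≤n)))
    b : Fin k → Fin n
    b i = proj₁ (right (x i) (x≥ i))
    xb : ∀ i → x i ≡ m ↑ʳ b i
    xb i = proj₂ (right (x i) (x≥ i))
    toℕ-b : ∀ i → toℕ (x i) ≡ m + toℕ (b i)
    toℕ-b i = trans (cong toℕ (xb i)) (Fin.toℕ-↑ʳ m (b i))
    b-mono : ∀ i j → i Fin.< j → b i Fin.< b j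
    b-mono i j i<j = +-cancelˡ-< m _ _ (subst₂ _<_ (toℕ-b i) (toℕ-b j) (mono i j i<j))
    b-iso : ∀ i j → (τ ⟨$⟩ʳ b i Fin.< τ ⟨$⟩ʳ b j) ⇔ (π ⟨$⟩ʳ i Fin.< π ⟨$⟩ʳ j)
    b-iso i j = ⇔-trans (⇔-sym (⊖-ʳ σ τ (b i) (b j)))
      (subst₂ (λ u v → (σ ⊖ τ ⟨$⟩ʳ u Fin.< σ ⊖ τ ⟨$⟩ʳ v) ⇔ (π ⟨$⟩ʳ i Fin.< π ⟨$⟩ʳ j)) (xb i) (xb j) (iso i j))
  ...   | suc q₀ , x≮ , smaller = indec (suc (toℕ q₀)) (s≤s z≤n) (Fin.toℕ<n (suc q₀)) decomposed
    where
    decomposed : ∀ p q → toℕ p < suc (toℕ q₀) → suc (toℕ q₀) ≤ toℕ q → π ⟨$⟩ʳ q Fin.< π ⟨$⟩ʳ p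
    decomposed p q p< ≤q = Equivalence.to (iso q p)
      (subst₂ (λ u v → σ ⊖ τ ⟨$⟩ʳ u Fin.< σ ⊖ τ ⟨$⟩ʳ v) (sym (proj₂ (right (x q) xq≥))) (sym (proj₂ (left (x p) xp<))) (⊖-ʳˡ σ τ _ _))
      where
      xp< : toℕ (x p) < m
      xp< = subst (λ i → toℕ (x i) < m) (Fin.toℕ-injective (trans (Fin.toℕ-inject _) (Fin.toℕ-fromℕ< p<))) (smaller (fromℕ< p<))
      xq≥ : m ≤ toℕ (x q)
      xq≥ with m≤n⇒m<n∨m≡n ≤q
      ... | inj₁ lt = ≤-trans (≮⇒≥ x≮) (<⇒≤ (mono (suc q₀) q lt))
      ... | inj₂ eq = subst (λ i → m ≤ toℕ (x i)) (Fin.toℕ-injective eq) (≮⇒≥ x≮)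

supermultiplicative : ∀ {k} (U : PermutationSet k) → All SkewIndecomposable (elements U) →
                      ∀ m n → S m U * S n U ≤ S (m + n) U
supermultiplicative {k} U indec m n = avoiders≥ U F F-avoids F-injective
  where
  i : Fin (S m U * S n U) → Fin (S m U)
  i t = proj₁ (remQuot {S m U} (S n U) t)
  j : Fin (S m U * S n U) → Fin (S n U)
  j t = proj₂ (remQuot {S m U} (S n U) t)
  σ : Fin (S m U * S n U) → Permutation′ m
  σ t = avoider {m} U (i t)
  τ : Fin (S m U * S n U) → Permutation′ n
  τ t = avoider {n} U (j t)
  F : Fin (S m U * S n U) → Permutation′ (m + n)
  F t = σ t ⊖ τ t
  F-avoids : ∀ t → Avoids (F t) U
  F-avoids t = All.map (λ {π} (ind , ¬σ , ¬τ) → ⊖-avoids (σ t) (τ t) π ind ¬σ ¬τ)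
    (All.zip (indec , All.zip (avoider-avoids {m} U (i t) , avoider-avoids {n} U (j t))))
  F-injective : ∀ t t′ → F t ≈ F t′ → t ≡ t′
  F-injective t t′ eq = trans (sym (Fin.combine-remQuot {S m U} (S n U) t))
    (trans (cong₂ combine i≡ j≡) (Fin.combine-remQuot {S m U} (S n U) t′))
    where
    same : ∀ u v → (F t ⟨$⟩ʳ u Fin.< F t ⟨$⟩ʳ v) ⇔ (F t′ ⟨$⟩ʳ u Fin.< F t′ ⟨$⟩ʳ v)
    same u v = mk⇔ (subst₂ Fin._<_ (eq u) (eq v)) (subst₂ Fin._<_ (sym (eq u)) (sym (eq v)))
    i≡ : i t ≡ i t′
    i≡ = avoider-injective {m} U (i t) (i t′) (order-determines (σ t) (σ t′) λ a a′ →
      ⇔-trans (⇔-sym (⊖-ˡ (σ t) (τ t) a a′)) (⇔-trans (same (a ↑ˡ n) (a′ ↑ˡ n)) (⊖-ˡ (σ t′) (τ t′) a a′)))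
    j≡ : j t ≡ j t′
    j≡ = avoider-injective {n} U (j t) (j t′) (order-determines (τ t) (τ t′) λ b b′ →
      ⇔-trans (⇔-sym (⊖-ʳ (σ t) (τ t) b b′)) (⇔-trans (same (m ↑ʳ b) (m ↑ʳ b′)) (⊖-ʳ (σ t′) (τ t′) b b′)))

module _ {ρ s k : ℕ} (2≤ρ : 2 ≤ ρ) (1≤s : 1 ≤ s) (ρs≤k : ρ * s ≤ k) where
  private
    pred< : pred ρ < ρ
    pred< = ≤-reflexive (suc-pred ρ {{>-nonZero (≤-trans (s≤s z≤n) 2≤ρ)}})

    1≤pred : 1 ≤ pred ρ
    1≤pred = <⇒≤pred 2≤ρ

    s≤pred : s ≤ pred ρ * s
    s≤pred = m≤n*m s (pred ρ) {{>-nonZero 1≤pred}}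

  -- A point of the bottom left block and a point of the top right block force
  -- a cut to lie within s of an end; there the first and last entries exclude it.
  Grid⇒SkewIndecomposable : ∀ π → Grid ρ s k π → SkewIndecomposable π
  Grid⇒SkewIndecomposable π grid j 0<j j<k dec
    with p , (_ , p<s) , (_ , πp<s) ← Grid.hit grid 0 0 (≤-trans (s≤s z≤n) 2≤ρ) (≤-trans (s≤s z≤n) 2≤ρ)
       | q , (≤q , _) , (≤πq , _) ← Grid.hit grid (pred ρ) (pred ρ) pred< pred<
       | q′ , (≤q′ , _) , (≤πq′ , _) ← Grid.hit grid 1 (pred ρ) 2≤ρ pred<
       | toℕ p <? j | j ≤? toℕ q
  ... | yes p<j | yes j≤q = <-asym (dec p q p<j j≤q)
        (<-≤-trans πp<s (≤-trans (≤-trans (≤-reflexive (+-identityʳ s)) s≤pred) ≤πq))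
  ... | no  p≮j | _ = <-asym (dec o q′ (subst (_< j) (sym o≡0) 0<j) (≤-trans (≮⇒≥ p≮j) (≤-trans (<⇒≤ p<s) ≤q′)))
        (<-≤-trans (Grid.first grid o o≡0) ≤πq′)
    where
    o : Fin k
    o = fromℕ< (<-trans 0<j j<k)
    o≡0 : toℕ o ≡ 0
    o≡0 = Fin.toℕ-fromℕ< _
  ... | yes p<j | no j≰q = <-irrefl refl (<-trans (dec p l p<j j≤l)
        (<-≤-trans πp<s (≤-trans (≤-reflexive (+-identityʳ s)) (Grid.last grid l l≡k))))
    where
    instance
      k≢0 : NonZero k
      k≢0 = >-nonZero (<-trans 0<j j<k)
    l : Fin k
    l = fromℕ< (≤-reflexive (suc-pred k))
    l≡k : suc (toℕ l) ≡ k
    l≡k = trans (cong suc (Fin.toℕ-fromℕ< _)) (suc-pred k)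
    j≤l : j ≤ toℕ l
    j≤l = subst (j ≤_) (sym (Fin.toℕ-fromℕ< _)) (<⇒≤pred j<k)

-- The Marcus–Tardos theorem

Matrix : ℕ → ℕ → Set
Matrix m n = Fin m → Fin n → Bool

-- J_k as an interval minor, given by one point in each of its k × k blocks.
Minor : ∀ k {m n} → Matrix m n → Set
Minor k {m} {n} A = ∃₂ λ (x : Fin k → Fin k → Fin m) (y : Fin k → Fin k → Fin n) →
  (∀ a b → A (x a b) (y a b) ≡ true) ×
  (∀ {a a′} b b′ → a Fin.< a′ → x a b Fin.< x a′ b′) ×
  (∀ a a′ {b b′} → b Fin.< b′ → y a b Fin.< y a′ b′)

transpose : ∀ {m n} → Matrix m n → Matrix n m
transpose A y x = A x y

minor-transpose : ∀ {k m n} (A : Matrix m n) → Minor k (transpose A) → Minor k A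
minor-transpose A (x , y , A∋ , x-mono , y-mono) =
  (λ a b → y b a) , (λ a b → x b a) , (λ a b → A∋ b a) , (λ b b′ lt → y-mono b b′ lt) , (λ a a′ lt → x-mono a a′ lt)

ones : ∀ {m n} → Matrix m n → ℕ
ones A = sum λ i → card (A i)

block : ∀ s {m n} → Matrix (m * s) (n * s) → Fin m → Fin n → Matrix s s
block s A X Y u v = A (combine X u) (combine Y v)

rows : ∀ {m n} → Matrix m n → Fin m → Bool
rows A u = anyᵇ (A u)

columns : ∀ {m n} → Matrix m n → Fin n → Bool
columns A v = anyᵇ λ u → A u v

contract : ∀ s {m n} → Matrix (m * s) (n * s) → Matrix m n
contract s A X Y = anyᵇ (rows (block s A X Y))

contract⁺ : ∀ s {m n} (A : Matrix (m * s) (n * s)) (X : Fin m) (Y : Fin n) u v → block s A X Y u v ≡ true → contract s A X Y ≡ true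
contract⁺ s A X Y u v A∋ = anyᵇ⁺ _ u (anyᵇ⁺ _ v A∋)

contract⁻ : ∀ s {m n} (A : Matrix (m * s) (n * s)) (X : Fin m) (Y : Fin n) → contract s A X Y ≡ true → ∃₂ λ u v → block s A X Y u v ≡ true
contract⁻ s A X Y any = let u , row = anyᵇ⁻ _ any ; v , A∋ = anyᵇ⁻ _ row in u , v , A∋

minor-contract : ∀ {k} s {m n} (A : Matrix (m * s) (n * s)) → Minor k (contract s {m} {n} A) → Minor k A
minor-contract s A (x , y , A∋ , x-mono , y-mono) =
  (λ a b → combine (x a b) (u a b)) , (λ a b → combine (y a b) (v a b)) ,
  (λ a b → proj₂ (proj₂ (point a b))) ,
  (λ {a} {a′} b b′ lt → Fin.combine-monoˡ-< (u a b) (u a′ b′) (x-mono b b′ lt)) ,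
  (λ a a′ {b} {b′} lt → Fin.combine-monoˡ-< (v a b) (v a′ b′) (y-mono a a′ lt))
  where
  point : ∀ a b → ∃₂ λ u v → block s A (x a b) (y a b) u v ≡ true
  point a b = contract⁻ s A (x a b) (y a b) (A∋ a b)
  u : ∀ a b → Fin _
  u a b = proj₁ (point a b)
  v : ∀ a b → Fin _
  v a b = proj₁ (proj₂ (point a b))

bit : Bool → Fin 2
bit true  = suc zero
bit false = zero

unbit : Fin 2 → Bool
unbit zero    = false
unbit (suc _) = true

unbit-bit : ∀ b → unbit (bit b) ≡ b
unbit-bit true  = refl
unbit-bit false = refl

encode : ∀ {n} → (Fin n → Bool) → Fin (2 ^ n)
encode V = funToFin (bit ∘ V)

decode : ∀ {n} → Fin (2 ^ n) → Fin n → Bool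
decode c i = unbit (finToFun c i)

decode-encode : ∀ {n} (V : Fin n → Bool) i → decode (encode V) i ≡ V i
decode-encode V i = trans (cong unbit (Fin.finToFun-funToFin (bit ∘ V) i)) (unbit-bit (V i))

term≤sum : ∀ {n} (f : Fin n → ℕ) i → f i ≤ sum f
term≤sum f zero    = m≤m+n (f zero) _
term≤sum f (suc i) = ≤-trans (term≤sum (f ∘ suc) i) (m≤n+m _ (f zero))

is : ∀ {n} → Fin n → Fin n → Bool
is c d = does (c Fin.≟ d)

is-refl : ∀ {n} (c : Fin n) → is c c ≡ true
is-refl c = dec-true (c Fin.≟ c) refl

is⁻ : ∀ {n} (c d : Fin n) → is c d ≡ true → c ≡ d
is⁻ c d eq with c Fin.≟ d
... | yes c≡d = c≡d

pigeonhole-card : ∀ {m p} k (g : Fin m → Fin p) (V : Fin m → Bool) →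
                  p * k < card V → ∃ λ c → k ≤ card (λ i → V i ∧ is (g i) c)
pigeonhole-card {m} {p} k g V pk< with Fin.any? (λ c → k ≤? card (λ i → V i ∧ is (g i) c))
... | yes found = found
... | no ¬found = contradiction (begin
  card V                                          ≤⟨ sum-mono le ⟩
  sum (λ i → sum (λ c → 𝟙 (V i ∧ is (g i) c)))    ≡⟨ ∑-comm (λ i c → 𝟙 (V i ∧ is (g i) c)) ⟩
  sum (λ c → card (λ i → V i ∧ is (g i) c))       ≤⟨ sum-≤-const k (λ c → <⇒≤ (≰⇒> (λ k≤ → ¬found (c , k≤)))) ⟩
  p * k                                           ∎) (<⇒≱ pk<)
  where
  open ≤-Reasoning
  le : ∀ i → 𝟙 (V i) ≤ sum (λ c → 𝟙 (V i ∧ is (g i) c))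
  le i = ≤-trans (≤-reflexive (cong 𝟙 (sym (trans (cong (V i ∧_) (is-refl (g i))) (Bool.∧-identityʳ (V i))))))
    (term≤sum (λ c → 𝟙 (V i ∧ is (g i) c)) (g i))

wide : ∀ k s {m n} → Matrix (m * s) (n * s) → Matrix m n
wide k s A X Y = k ≤ᵇ card (columns (block s A X Y))

∧-true : ∀ {a b} → a ∧ b ≡ true → a ≡ true × b ≡ true
∧-true {true} {true} _ = refl , refl

≤ᵇ-true⁻ : ∀ m n → (m ≤ᵇ n) ≡ true → m ≤ n
≤ᵇ-true⁻ m n eq = ≤ᵇ⇒≤ m n (subst T (sym eq) _)

-- Among more than 2 ^ s * k wide blocks above each other, k have the same nonempty columns.
wide-count : ∀ k s {m n} (A : Matrix (m * s) (n * s)) → ¬ Minor k A →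
             ∀ (Y : Fin n) → card (λ (X : Fin m) → wide k s A X Y) ≤ 2 ^ s * k
wide-count zero    s A ¬minor Y = contradiction ((λ ()) , (λ ()) , (λ ()) , (λ { {()} }) , λ ()) ¬minor
wide-count k@(suc _) s {m} {n} A ¬minor Y = ≮⇒≥ λ lt → ¬minor (minor lt)
  where
  V : Fin m → Bool
  V X = wide k s A X Y
  cols : Fin m → Fin s → Bool
  cols X = columns (block s A X Y)
  minor : 2 ^ s * k < card V → Minor k A
  minor lt with c , k≤ ← pigeonhole-card k (encode ∘ cols) V lt
    with X , X-mono , X∈ ← enumerate k (λ X → V X ∧ is (encode (cols X)) c) k≤ =
    let v , v-mono , v∈ = enumerate k W k≤W in
    (λ a b → combine (X a) (proj₁ (point v v∈ a b))) , (λ a b → combine Y (v b)) ,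
    (λ a b → proj₂ (point v v∈ a b)) ,
    (λ {a} {a′} b b′ a<a′ → Fin.combine-monoˡ-< (proj₁ (point v v∈ a b)) (proj₁ (point v v∈ a′ b′)) (X-mono a<a′)) ,
    (λ a a′ {b} {b′} b<b′ → combine-monoʳ-< Y (v-mono b<b′))
    where
    combine-monoʳ-< : ∀ (Y : Fin n) {u v : Fin s} → u Fin.< v → combine Y u Fin.< combine Y v
    combine-monoʳ-< Y {u} {v} u<v = subst₂ _<_ (sym (Fin.toℕ-combine Y u)) (sym (Fin.toℕ-combine Y v)) (+-monoʳ-< (s * toℕ Y) u<v)
    W : Fin s → Bool
    W = decode c
    W≗ : ∀ a v → W v ≡ cols (X a) v
    W≗ a v = trans (cong (λ c → decode c v) (sym (is⁻ _ c (proj₂ (∧-true {V (X a)} (X∈ a)))))) (decode-encode (cols (X a)) v)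
    k≤W : k ≤ card W
    k≤W = ≤-trans (≤ᵇ-true⁻ k _ (proj₁ (∧-true {V (X zero)} (X∈ zero)))) (≤-reflexive (card-cong (sym ∘ W≗ zero)))
    point : ∀ v → (∀ i → W (v i) ≡ true) → ∀ a b → ∃ λ u → A (combine (X a) u) (combine Y (v b)) ≡ true
    point v v∈ a b = anyᵇ⁻ _ (trans (sym (W≗ a (v b))) (v∈ b))

ones≤ : ∀ {m n} (A : Matrix m n) → ones A ≤ m * n
ones≤ {m} {n} A = sum-≤-const n (λ i → card≤ (A i))

ones≤rows*columns : ∀ {m n} (A : Matrix m n) → ones A ≤ card (rows A) * card (columns A)
ones≤rows*columns A = begin
  ones A                                                 ≤⟨ sum-mono (λ u → sum-mono (le u)) ⟩
  sum (λ u → sum (λ v → 𝟙 (rows A u) * 𝟙 (columns A v)))  ≡⟨ sum-cong-≗ (λ u → sym (*-distribˡ-sum (𝟙 (rows A u)) (𝟙 ∘ columns A))) ⟩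
  sum (λ u → 𝟙 (rows A u) * card (columns A))            ≡⟨ *-distribʳ-sum (card (columns A)) (𝟙 ∘ rows A) ⟨
  card (rows A) * card (columns A)                       ∎
  where
  open ≤-Reasoning
  le : ∀ u v → 𝟙 (A u v) ≤ 𝟙 (rows A u) * 𝟙 (columns A v)
  le u v with A u v in eq
  ... | false = z≤n
  ... | true rewrite anyᵇ⁺ (A u) v eq | anyᵇ⁺ (λ u → A u v) u eq = ≤-refl

contract-empty : ∀ s {m n} (A : Matrix (m * s) (n * s)) (X : Fin m) (Y : Fin n) → contract s A X Y ≡ false → ones (block s A X Y) ≡ 0
contract-empty s A X Y empty = n≤0⇒n≡0 (≤-trans (sum-≤-const 0 (λ u → ≤-trans (sum-≤-const 0 (λ v → zero-entry u v)) (≤-reflexive (*-zeroʳ s)))) (≤-reflexive (*-zeroʳ s)))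
  where
  zero-entry : ∀ u v → 𝟙 (block s A X Y u v) ≤ 0
  zero-entry u v with block s A X Y u v in eq
  ... | false = z≤n
  ... | true with () ← trans (sym (contract⁺ s A X Y u v eq)) empty

module _ where
  open ≤-Reasoning

  -- A nonempty block that is neither wide nor, in the transpose, wide has at most `k` nonempty rows
  -- and at most `k` nonempty columns. Every other nonempty block is charged its full area.
  ones-block : ∀ k s {m n} (A : Matrix (m * s) (n * s)) (X : Fin m) (Y : Fin n) → ones (block s A X Y) ≤
               k * k * 𝟙 (contract s A X Y) + (s * s * 𝟙 (wide k s A X Y) + s * s * 𝟙 (wide k s (transpose A) Y X))
  ones-block k s A X Y with contract s A X Y in eq
  ... | false rewrite contract-empty s A X Y eq = z≤n
  ... | true with wide k s A X Y in eq₁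
  ...   | true  = begin
    ones (block s A X Y) ≤⟨ ones≤ (block s A X Y) ⟩
    s * s              ≡⟨ *-identityʳ (s * s) ⟨
    s * s * 1          ≤⟨ m≤m+n _ _ ⟩
    s * s * 1 + _      ≤⟨ m≤n+m _ (k * k * 1) ⟩
    _                  ∎
  ...   | false with wide k s (transpose A) Y X in eq₂
  ...     | true  = begin
    ones (block s A X Y)    ≤⟨ ones≤ (block s A X Y) ⟩
    s * s                 ≡⟨ *-identityʳ (s * s) ⟨
    s * s * 1             ≤⟨ m≤n+m _ _ ⟩
    s * s * 0 + s * s * 1 ≤⟨ m≤n+m _ (k * k * 1) ⟩
    _                     ∎
  ...     | false = begin
    ones (block s A X Y)                                          ≤⟨ ones≤rows*columns (block s A X Y) ⟩
    card (rows (block s A X Y)) * card (columns (block s A X Y))    ≤⟨ *-mono-≤ (small eq₂) (small eq₁) ⟩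
    k * k                                                       ≡⟨ *-identityʳ (k * k) ⟨
    k * k * 1                                                   ≤⟨ m≤m+n _ _ ⟩
    _                                                           ∎
    where
    small : ∀ {x} → (k ≤ᵇ x) ≡ false → x ≤ k
    small {x} ≰ = ≮⇒≥ λ k<x → contradiction (trans (sym (≤ᵇ-true (<⇒≤ k<x))) ≰) λ ()

  ones-blocks : ∀ s {m n} (A : Matrix (m * s) (n * s)) → ones A ≡ sum λ (X : Fin m) → sum λ (Y : Fin n) → ones (block s A X Y)
  ones-blocks s {m} {n} A = trans (sum-combine m {s} (λ i → card (A i))) (sum-cong-≗ swapped)
    where
    swapped : ∀ (X : Fin m) → (sum λ u → card (A (combine X u))) ≡ sum λ (Y : Fin n) → ones (block s A X Y)
    swapped X = trans (sum-cong-≗ (λ u → sum-combine n {s} (λ z → 𝟙 (A (combine X u) z))))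
      (∑-comm {s} {n} λ u Y → sum λ v → 𝟙 (block s A X Y u v))

  sum-linear : ∀ {m n} a b c (f g h : Fin m → Fin n → ℕ) →
               (sum λ i → sum λ j → a * f i j + (b * g i j + c * h i j)) ≡
               a * (sum λ i → sum (f i)) + (b * (sum λ i → sum (g i)) + c * (sum λ i → sum (h i)))
  sum-linear a b c f g h = trans (sum-cong-≗ λ i → linear₁ (f i) (g i) (h i)) (linear₁ (sum ∘ f) (sum ∘ g) (sum ∘ h))
    where
    linear₁ : ∀ {n} (f g h : Fin n → ℕ) → (sum λ j → a * f j + (b * g j + c * h j)) ≡ a * sum f + (b * sum g + c * sum h)
    linear₁ f g h = trans (∑-distrib-+ (λ j → a * f j) (λ j → b * g j + c * h j))
      (cong₂ _+_ (sym (*-distribˡ-sum a f)) (trans (∑-distrib-+ (λ j → b * g j) (λ j → c * h j))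
        (cong₂ _+_ (sym (*-distribˡ-sum b g)) (sym (*-distribˡ-sum c h)))))

  -- The Marcus-Tardos recursion: by `wide-count` each block row or block column contains boundedly
  -- many exceptional blocks, so their total cost is linear in the number of block rows and columns.
  ones-recurrence : ∀ k s {m n} (A : Matrix (m * s) (n * s)) → ¬ Minor k A →
                    ones A ≤ k * k * ones (contract s {m} {n} A) + (s * s * (n * (2 ^ s * k)) + s * s * (m * (2 ^ s * k)))
  ones-recurrence k s {m} {n} A ¬minor = begin
    ones A                                       ≡⟨ ones-blocks s {m} {n} A ⟩
    (sum λ (X : Fin m) → sum λ (Y : Fin n) → ones (block s A X Y))     ≤⟨ sum-mono (λ (X : Fin m) → sum-mono (λ (Y : Fin n) → ones-block k s {m} {n} A X Y)) ⟩
    (sum λ (X : Fin m) → sum λ (Y : Fin n) → k * k * 𝟙 (contract s A X Y) + (s * s * 𝟙 (wide k s A X Y) + s * s * 𝟙 (wide k s (transpose A) Y X)))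
      ≡⟨ sum-linear (k * k) (s * s) (s * s) (λ (X : Fin m) (Y : Fin n) → 𝟙 (contract s A X Y)) (λ (X : Fin m) (Y : Fin n) → 𝟙 (wide k s A X Y)) (λ (X : Fin m) (Y : Fin n) → 𝟙 (wide k s (transpose A) Y X)) ⟩
    k * k * ones (contract s {m} {n} A) + (s * s * ones (wide k s {m} {n} A) + s * s * (sum λ (X : Fin m) → card (λ (Y : Fin n) → wide k s (transpose A) Y X)))
      ≤⟨ +-monoʳ-≤ (k * k * ones (contract s {m} {n} A)) (+-mono-≤
           (*-monoʳ-≤ (s * s) (≤-trans (≤-reflexive (∑-comm λ (X : Fin m) (Y : Fin n) → 𝟙 (wide k s A X Y))) (sum-≤-const (2 ^ s * k) (wide-count k s {m} {n} A ¬minor))))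
           (*-monoʳ-≤ (s * s) (sum-≤-const (2 ^ s * k) (wide-count k s {n} {m} (transpose A) (¬minor ∘ minor-transpose A))))) ⟩
    k * k * ones (contract s {m} {n} A) + (s * s * (n * (2 ^ s * k)) + s * s * (m * (2 ^ s * k))) ∎

-- Recovering a matrix from the nonempty blocks of its contractions

compress : ∀ {X : Set} {n} → (Fin n → Bool) → (Fin n → X) → List X
compress {n = zero}  V f = []
compress {n = suc n} V f = if V zero then f zero ∷ compress (V ∘ suc) (f ∘ suc) else compress (V ∘ suc) (f ∘ suc)

length-compress : ∀ {X : Set} {n} (V : Fin n → Bool) (f : Fin n → X) → length (compress V f) ≡ card V
length-compress {n = zero}  V f = refl
length-compress {n = suc n} V f with V zero
... | true  = cong suc (length-compress (V ∘ suc) (f ∘ suc))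
... | false = length-compress (V ∘ suc) (f ∘ suc)

compress-injective : ∀ {X : Set} {n} (V W : Fin n → Bool) (f g : Fin n → X) → (∀ i → V i ≡ W i) →
                     compress V f ≡ compress W g → ∀ i → V i ≡ true → f i ≡ g i
compress-injective {n = suc n} V W f g V≗W eq i Vi with V zero in V₀ | W zero | V≗W zero
compress-injective V W f g V≗W eq zero    Vi | true  | true  | _ = ∷-injectiveˡ eq
compress-injective V W f g V≗W eq (suc i) Vi | true  | true  | _ =
  compress-injective (V ∘ suc) (W ∘ suc) (f ∘ suc) (g ∘ suc) (V≗W ∘ suc) (∷-injectiveʳ eq) i Vi
compress-injective V W f g V≗W eq zero    Vi | false | false | _ with () ← trans (sym Vi) V₀
compress-injective V W f g V≗W eq (suc i) Vi | false | false | _ =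
  compress-injective (V ∘ suc) (W ∘ suc) (f ∘ suc) (g ∘ suc) (V≗W ∘ suc) eq i Vi

pad : ∀ {X : Set} {n} → X → List X → Fin n → X
pad x []       i       = x
pad x (y ∷ ys) zero    = y
pad x (y ∷ ys) (suc i) = pad x ys i

-- The filler may also occur as a list entry, so padding is injective only among lists of equal
-- length that are not truncated.
pad-injective : ∀ {X : Set} {n} (x : X) xs ys → length xs ≤ n → length xs ≡ length ys →
                (∀ (i : Fin n) → pad x xs i ≡ pad x ys i) → xs ≡ ys
pad-injective         x []       []       le       eq pads = refl
pad-injective {n = suc n} x (y ∷ xs) (z ∷ ys) (s≤s le) eq pads =
  cong₂ _∷_ (pads zero) (pad-injective x xs ys le (suc-injective eq) (pads ∘ suc))

encode-injective : ∀ {n} (V W : Fin n → Bool) → encode V ≡ encode W → ∀ i → V i ≡ W i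
encode-injective V W eq i = trans (sym (decode-encode V i)) (trans (cong (λ c → decode c i) eq) (decode-encode W i))

funToFin-injective : ∀ {m n} (f g : Fin m → Fin n) → funToFin f ≡ funToFin g → ∀ i → f i ≡ g i
funToFin-injective f g eq i = trans (sym (Fin.finToFun-funToFin f i)) (trans (cong (λ c → finToFun c i) eq) (Fin.finToFun-funToFin g i))

module MarcusTardos (k : ℕ) .{{_ : NonZero k}} where

  -- This side makes the recursion close: `k * k` ones per nonempty block use up half of the factor
  -- `s` by which the order grows, and the other half pays for the exceptional blocks, whose cost
  -- per block row is `c`.
  s : ℕ
  s = 2 * (k * k)

  w : ℕ
  w = 2 ^ s * k

  c : ℕ
  c = s * s * w + s * s * w

  order : ℕ → ℕ
  order zero    = 1
  order (suc j) = order j * s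

  private
    1≤k : 1 ≤ k
    1≤k = >-nonZero⁻¹ k

    1≤kk : 1 ≤ k * k
    1≤kk = *-mono-≤ 1≤k 1≤k

    2≤s : 2 ≤ s
    2≤s = *-monoʳ-≤ 2 1≤kk

    1≤c : 1 ≤ c
    1≤c = ≤-trans (*-mono-≤ (*-mono-≤ 1≤s 1≤s) (*-mono-≤ (m^n>0 2 s) 1≤k)) (m≤m+n _ _)
      where
      1≤s : 1 ≤ s
      1≤s = ≤-trans (s≤s z≤n) 2≤s

  open ≤-Reasoning

  ones-linear : ∀ j (A : Matrix (order j) (order j)) → ¬ Minor k A → ones A ≤ c * order j
  ones-linear zero    A ¬minor = ≤-trans (ones≤ A) (≤-trans 1≤c (≤-reflexive (sym (*-identityʳ c))))
  ones-linear (suc j) A ¬minor = begin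
    ones A
      ≤⟨ ones-recurrence k s {m} {m} A ¬minor ⟩
    k * k * ones (contract s {m} {m} A) + (s * s * (m * w) + s * s * (m * w))
      ≤⟨ +-monoˡ-≤ _ (*-monoʳ-≤ (k * k) (ones-linear j (contract s A) (¬minor ∘ minor-contract s {m} {m} A))) ⟩
    k * k * (c * m) + (s * s * (m * w) + s * s * (m * w)) ≡⟨ cong (k * k * (c * m) +_) (factor (s * s) m w) ⟩
    k * k * (c * m) + 1 * (c * m)                    ≤⟨ +-monoʳ-≤ (k * k * (c * m)) (*-monoˡ-≤ (c * m) 1≤kk) ⟩
    k * k * (c * m) + k * k * (c * m)                ≡⟨ double (k * k) c m ⟩
    c * (m * s)                                      ∎
    where
    m : ℕ
    m = order j
    factor : ∀ s m w → s * (m * w) + s * (m * w) ≡ 1 * ((s * w + s * w) * m)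
    factor = solve-∀
    double : ∀ q c m → q * (c * m) + q * (c * m) ≡ c * (m * (2 * q))
    double = solve-∀

  -- A matrix is determined by its contraction together with the blocks over the ones of the contraction.
  base : ℕ
  base = 2 ^ (s * s)

  codes : ℕ → ℕ
  codes zero    = 2
  codes (suc j) = codes j * base ^ (c * order j)

  mask : ∀ {m n} → Matrix m n → Fin (m * n) → Bool
  mask {m} {n} A t = let X , Y = remQuot {m} n t in A X Y

  mask-combine : ∀ {m n} (A : Matrix m n) X Y → mask A (combine X Y) ≡ A X Y
  mask-combine A X Y = cong (λ (X , Y) → A X Y) (Fin.remQuot-combine X Y)

  card-mask : ∀ {m n} (A : Matrix m n) → card (mask A) ≡ ones A
  card-mask {m} {n} A = trans (sum-combine m (𝟙 ∘ mask A)) (sum-cong-≗ λ X → sum-cong-≗ λ Y → cong 𝟙 (mask-combine A X Y))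

  blockCode : ∀ {m n} → Matrix (m * s) (n * s) → Fin (m * n) → Fin base
  blockCode {m} {n} A t = let X , Y = remQuot {m} n t in encode (mask (block s {m} {n} A X Y))

  blocks : ∀ {m n} → Matrix (m * s) (n * s) → List (Fin base)
  blocks {m} {n} A = compress (mask (contract s {m} {n} A)) (blockCode {m} {n} A)

  0-base : Fin base
  0-base = encode {s * s} (const false)

  code : ∀ j → Matrix (order j) (order j) → Fin (codes j)
  code zero    A = bit (A zero zero)
  code (suc j) A = combine (code j (contract s {order j} {order j} A)) (funToFin (pad {n = c * order j} 0-base (blocks {order j} {order j} A)))

  -- Klazar's reduction. Contractions inherit the absence of the minor, so `ones-linear` bounds the
  -- number of blocks to be recorded. Equal contractions make the two lists equally long, and the
  -- padded list is then read back position by position.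
  code-injective : ∀ j (A B : Matrix (order j) (order j)) → ¬ Minor k A → ¬ Minor k B →
                   code j A ≡ code j B → ∀ x y → A x y ≡ B x y
  code-injective zero    A B ¬A ¬B eq zero zero = trans (sym (unbit-bit _)) (trans (cong unbit eq) (unbit-bit _))
  code-injective (suc j) A B ¬A ¬B eq x y = subst₂ (λ x y → A x y ≡ B x y)
      (Fin.combine-remQuot {m} s x) (Fin.combine-remQuot {m} s y)
      (entry (proj₁ (remQuot {m} s x)) (proj₂ (remQuot {m} s x)) (proj₁ (remQuot {m} s y)) (proj₂ (remQuot {m} s y)))
    where
    m : ℕ
    m = order j
    A′ B′ : Matrix m m
    A′ = contract s A
    B′ = contract s B
    split : code j A′ ≡ code j B′ × funToFin (pad {n = c * m} 0-base (blocks {m} {m} A)) ≡ funToFin (pad {n = c * m} 0-base (blocks {m} {m} B))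
    split = Fin.combine-injective (code j A′) _ (code j B′) _ eq
    A′≗B′ : ∀ X Y → A′ X Y ≡ B′ X Y
    A′≗B′ = code-injective j A′ B′ (¬A ∘ minor-contract s A) (¬B ∘ minor-contract s B) (proj₁ split)
    masks : ∀ t → mask A′ t ≡ mask B′ t
    masks t = A′≗B′ (proj₁ (remQuot {m} m t)) (proj₂ (remQuot {m} m t))
    length-blocks : ∀ C → length (blocks {m} {m} C) ≡ card (mask (contract s {m} {m} C))
    length-blocks C = length-compress (mask (contract s {m} {m} C)) (blockCode {m} {m} C)
    lists : blocks {m} {m} A ≡ blocks {m} {m} B
    lists = pad-injective {n = c * m} 0-base _ _
      (≤-trans (≤-reflexive (trans (length-blocks A) (card-mask A′))) (ones-linear j A′ (¬A ∘ minor-contract s A)))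
      (trans (length-blocks A) (trans (card-cong masks) (sym (length-blocks B))))
      (funToFin-injective _ _ (proj₂ split))
    entry : ∀ X u Y v → block s A X Y u v ≡ block s B X Y u v
    entry X u Y v with A′ X Y in A′XY
    ... | false = trans (empty A A′XY) (sym (empty B (trans (sym (A′≗B′ X Y)) A′XY)))
      where
      empty : ∀ C → contract s C X Y ≡ false → block s C X Y u v ≡ false
      empty C eq = Bool.¬-not λ one → contradiction (trans (sym (contract⁺ s C X Y u v one)) eq) λ ()
    ... | true  = trans (sym (mask-combine (block s A X Y) u v))
        (trans (encode-injective _ _ codes≡ (combine u v)) (mask-combine (block s B X Y) u v))
      where
      at : ∀ C → blockCode {m} {m} C (combine X Y) ≡ encode (mask (block s C X Y))
      at C = cong (λ (X , Y) → encode (mask (block s C X Y))) (Fin.remQuot-combine X Y)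
      codes≡ : encode (mask (block s A X Y)) ≡ encode (mask (block s B X Y))
      codes≡ = trans (sym (at A)) (trans
        (compress-injective (mask A′) (mask B′) (blockCode {m} {m} A) (blockCode {m} {m} B) masks lists (combine X Y) (trans (mask-combine A′ X Y) A′XY))
        (at B))

  -- The exponents `c * order j` at least double with each level, so the sum of the earlier ones
  -- stays below the next.
  codes≤ : ∀ j → codes j ≤ base ^ (c * order j)
  codes≤ zero    = begin
    2 ^ 1                 ≤⟨ ^-monoʳ-≤ 2 (*-mono-≤ (≤-trans (s≤s z≤n) 2≤s) (≤-trans (s≤s z≤n) 2≤s)) ⟩
    base                  ≡⟨ *-identityʳ base ⟨
    base ^ 1              ≤⟨ ^-monoʳ-≤ base {{m^n≢0 2 (s * s)}} (≤-trans 1≤c (≤-reflexive (sym (*-identityʳ c)))) ⟩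
    base ^ (c * 1)        ∎
  codes≤ (suc j) = begin
    codes j * base ^ (c * order j)              ≤⟨ *-monoˡ-≤ _ (codes≤ j) ⟩
    base ^ (c * order j) * base ^ (c * order j) ≡⟨ ^-distribˡ-+-* base (c * order j) (c * order j) ⟨
    base ^ (c * order j + c * order j)          ≤⟨ ^-monoʳ-≤ base {{m^n≢0 2 (s * s)}} (≤-trans (≤-reflexive (twice c (order j))) (*-monoʳ-≤ c (*-monoʳ-≤ (order j) 2≤s))) ⟩
    base ^ (c * (order j * s))                  ∎
    where
    twice : ∀ c m → c * m + c * m ≡ c * (m * 2)
    twice = solve-∀

  scale : ∀ n → ∃ λ j → suc n ≤ order j × order j ≤ suc n * s
  scale zero    = 0 , ≤-refl , ≤-trans (≤-trans (s≤s z≤n) 2≤s) (m≤m+n s 0)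
  scale (suc n) with scale n
  ... | j , n≤ , ≤ns with m≤n⇒m<n∨m≡n n≤
  ...   | inj₁ n< = j , n< , ≤-trans ≤ns (m≤n+m _ s)
  ...   | inj₂ n≡ = suc j , subst (λ m → suc (suc n) ≤ m * s) n≡ (begin
    suc (suc n)       ≤⟨ s≤s (m≤n+m (suc n) n) ⟩
    suc n + suc n     ≡⟨ twice (suc n) ⟨
    suc n * 2         ≤⟨ *-monoʳ-≤ (suc n) 2≤s ⟩
    suc n * s         ∎) , subst (λ m → m * s ≤ suc (suc n) * s) n≡ (m≤n+m _ s)
    where
    twice : ∀ n → n * 2 ≡ n + n
    twice = solve-∀

  permMatrix : ∀ {n m} → Permutation′ n → Matrix m m
  permMatrix σ x y = anyᵇ λ i → (toℕ i ≡ᵇ toℕ x) ∧ (toℕ (σ ⟨$⟩ʳ i) ≡ᵇ toℕ y)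

  ≡ᵇ-true : ∀ {x y} → x ≡ y → (x ≡ᵇ y) ≡ true
  ≡ᵇ-true {x} {y} x≡y = Equivalence.to Bool.T-≡ (≡⇒≡ᵇ x y x≡y)

  permMatrix⁻ : ∀ {n m} (σ : Permutation′ n) (x y : Fin m) → permMatrix σ x y ≡ true →
                ∃ λ i → toℕ i ≡ toℕ x × toℕ (σ ⟨$⟩ʳ i) ≡ toℕ y
  permMatrix⁻ σ x y eq with i , both ← anyᵇ⁻ _ eq with p , q ← ∧-true {toℕ i ≡ᵇ toℕ x} both =
    i , ≡ᵇ⇒≡ _ _ (subst T (sym p) _) , ≡ᵇ⇒≡ _ _ (subst T (sym q) _)

  -- A minor `J_k` yields every `k`-permutation: the point of the block `(a , π a)` plays the role
  -- of the entry at `a`.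
  minor⇒Contains : ∀ {n m} (σ : Permutation′ n) (π : Permutation′ k) → Minor k (permMatrix {n} {m} σ) → Contains σ π
  minor⇒Contains {n} σ π (x , y , A∋ , x-mono , y-mono) = i , i-mono , λ a b → mk⇔ (iso⁻ a b) (iso a b)
    where
    i : Fin k → Fin n
    i a = proj₁ (permMatrix⁻ σ _ _ (A∋ a (π ⟨$⟩ʳ a)))
    i-x : ∀ a → toℕ (i a) ≡ toℕ (x a (π ⟨$⟩ʳ a))
    i-x a = proj₁ (proj₂ (permMatrix⁻ σ _ _ (A∋ a (π ⟨$⟩ʳ a))))
    i-y : ∀ a → toℕ (σ ⟨$⟩ʳ i a) ≡ toℕ (y a (π ⟨$⟩ʳ a))
    i-y a = proj₂ (proj₂ (permMatrix⁻ σ _ _ (A∋ a (π ⟨$⟩ʳ a))))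
    i-mono : ∀ a b → a Fin.< b → i a Fin.< i b
    i-mono a b a<b = subst₂ _<_ (sym (i-x a)) (sym (i-x b)) (x-mono _ _ a<b)
    iso : ∀ a b → π ⟨$⟩ʳ a Fin.< π ⟨$⟩ʳ b → σ ⟨$⟩ʳ i a Fin.< σ ⟨$⟩ʳ i b
    iso a b lt = subst₂ _<_ (sym (i-y a)) (sym (i-y b)) (y-mono a b lt)
    iso⁻ : ∀ a b → σ ⟨$⟩ʳ i a Fin.< σ ⟨$⟩ʳ i b → π ⟨$⟩ʳ a Fin.< π ⟨$⟩ʳ b
    iso⁻ a b lt with <-cmp (toℕ (π ⟨$⟩ʳ a)) (toℕ (π ⟨$⟩ʳ b))
    ... | tri< a<b _ _ = a<b
    ... | tri> _ _ b<a = contradiction (iso b a b<a) (<-asym lt)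
    ... | tri≈ _ πa≡πb _ = contradiction (cong (λ a → toℕ (σ ⟨$⟩ʳ i a))
            (trans (sym (inverseˡ π)) (trans (cong (π ⟨$⟩ˡ_) (Fin.toℕ-injective πa≡πb)) (inverseˡ π)))) (<⇒≢ lt)

  permMatrix-injective : ∀ {n m} (σ τ : Permutation′ n) → n ≤ m →
                         (∀ x y → permMatrix {n} {m} σ x y ≡ permMatrix τ x y) → σ ≈ τ
  permMatrix-injective {n} {m} σ τ n≤m eq i =
    Fin.toℕ-injective (trans (sym (trans at-τ (Fin.toℕ-inject≤ (σ ⟨$⟩ʳ i) n≤m))) (cong (λ i → toℕ (τ ⟨$⟩ʳ i)) j≡i))
    where
    x y : Fin m
    x = inject≤ i n≤m
    y = inject≤ (σ ⟨$⟩ʳ i) n≤m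
    σ∋ : permMatrix σ x y ≡ true
    σ∋ = anyᵇ⁺ _ i (cong₂ _∧_ (≡ᵇ-true (sym (Fin.toℕ-inject≤ i n≤m))) (≡ᵇ-true (sym (Fin.toℕ-inject≤ (σ ⟨$⟩ʳ i) n≤m))))
    j : Fin n
    j = proj₁ (permMatrix⁻ τ x y (trans (sym (eq x y)) σ∋))
    j≡i : j ≡ i
    j≡i = Fin.toℕ-injective (trans (proj₁ (proj₂ (permMatrix⁻ τ x y (trans (sym (eq x y)) σ∋)))) (Fin.toℕ-inject≤ i n≤m))
    at-τ : toℕ (τ ⟨$⟩ʳ j) ≡ toℕ y
    at-τ = proj₂ (proj₂ (permMatrix⁻ τ x y (trans (sym (eq x y)) σ∋)))

  growthBound : ℕ
  growthBound = base ^ (c * s)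

  -- Avoiding one member already excludes the minor `J_k` from the permutation matrix. The matrix is
  -- enlarged by zeros to a side `order j`, which is at most `s` times too large.
  S-bounded : ∀ (U : PermutationSet k) π → π ∈ˡ elements U → ∀ n → S (suc n) U ≤ growthBound ^ suc n
  S-bounded U π π∈U n with j , n≤ , ≤ns ← scale n = begin
    S (suc n) U             ≤⟨ avoiders≤ U (λ σ → code j (permMatrix σ)) (λ σ τ σ-av τ-av eq →
                                 permMatrix-injective σ τ n≤ (code-injective j _ _ (free σ σ-av) (free τ τ-av) eq)) ⟩
    codes j                 ≤⟨ codes≤ j ⟩
    base ^ (c * order j)    ≤⟨ ^-monoʳ-≤ base {{m^n≢0 2 (s * s)}} (*-monoʳ-≤ c ≤ns) ⟩
    base ^ (c * (suc n * s)) ≡⟨ cong (base ^_) (swap c (suc n) s) ⟩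
    base ^ (c * s * suc n)  ≡⟨ ^-*-assoc base (c * s) (suc n) ⟨
    growthBound ^ suc n      ∎
    where
    swap : ∀ c n s → c * (n * s) ≡ c * s * n
    swap = solve-∀
    free : ∀ {m} σ → Avoids σ U → ¬ Minor k (permMatrix {suc n} {m} σ)
    free σ av minor = All.lookup av π∈U (minor⇒Contains σ π minor)

-- The random dyadic construction

hull : ∀ {t n} → (Fin t → Fin n) → Fin n → Bool
hull e x = anyᵇ λ i → is (e i) x

card-is : ∀ {n} (c : Fin n) → card (is c) ≤ 1
card-is {suc n} c = begin
  card (is c)                                ≡⟨ card-punchIn (is c) c ⟩
  𝟙 (is c c) + card (is c ∘ punchIn c)       ≤⟨ +-mono-≤ (𝟙≤1 (is c c)) (sum-≤-const 0 λ j →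
    ≤-reflexive (cong 𝟙 (dec-false (c Fin.≟ punchIn c j) (Fin.punchInᵢ≢i c j ∘ sym)))) ⟩
  1 + n * 0                                  ≡⟨ cong suc (*-zeroʳ n) ⟩
  1                                          ∎
  where open ≤-Reasoning

card-hull≤ : ∀ {t n} (e : Fin t → Fin n) → card (hull e) ≤ t
card-hull≤ {t} {n} e = begin
  card (hull e)                         ≤⟨ sum-mono (λ x → any≤ (λ i → is (e i) x)) ⟩
  sum (λ x → card (λ i → is (e i) x))   ≡⟨ ∑-comm {n} {t} (λ x i → 𝟙 (is (e i) x)) ⟩
  sum (λ i → card (is (e i)))           ≤⟨ sum-≤-const 1 (λ i → card-is (e i)) ⟩
  t * 1                                 ≡⟨ *-identityʳ t ⟩
  t                                     ∎
  where
  open ≤-Reasoning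
  any≤ : ∀ {t} (V : Fin t → Bool) → 𝟙 (anyᵇ V) ≤ card V
  any≤ V with anyᵇ V in eq
  ... | false = z≤n
  ... | true with i , Vᵢ ← anyᵇ⁻ V eq = ≤-trans (≤-reflexive (cong 𝟙 (sym Vᵢ))) (term≤sum (𝟙 ∘ V) i)

card-hull≥ : ∀ {t n} (e : Fin t → Fin n) → (∀ {i j} → e i ≡ e j → i ≡ j) → t ≤ card (hull e)
card-hull≥ e inj = injective⇒≤card (hull e) e inj λ i → anyᵇ⁺ _ i (is-refl (e i))

keeps : ∀ {n} → (Fin n → Bool) → Vec Bool n → ℕ
keeps X []      = 1
keeps X (k ∷ K) = if X zero ∧ not k then 0 else keeps (X ∘ suc) K

keeps⁺ : ∀ {n} (X : Fin n → Bool) K → (∀ x → X x ≡ true → Vec.lookup K x ≡ true) → keeps X K ≡ 1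
keeps⁺ X []      X⊆K = refl
keeps⁺ X (k ∷ K) X⊆K with X zero in eq
... | false = keeps⁺ (X ∘ suc) K (X⊆K ∘ suc)
... | true rewrite X⊆K zero eq = keeps⁺ (X ∘ suc) K (X⊆K ∘ suc)

keeps⁻ : ∀ {n} (X : Fin n → Bool) K → 0 < keeps X K → ∀ x → X x ≡ true → Vec.lookup K x ≡ true
keeps⁻ X (k ∷ K) 0< x Xx with X zero in eq
keeps⁻ X (k ∷ K)     0< (suc x) Xx | false = keeps⁻ (X ∘ suc) K 0< x Xx
keeps⁻ X (k ∷ K)     0< zero    Xx | false with () ← trans (sym Xx) eq
keeps⁻ X (true ∷ K)  0< zero    Xx | true  = refl
keeps⁻ X (true ∷ K)  0< (suc x) Xx | true  = keeps⁻ (X ∘ suc) K 0< x Xx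

keeps≤1 : ∀ {n} (X : Fin n → Bool) K → keeps X K ≤ 1
keeps≤1 X []      = ≤-refl
keeps≤1 X (k ∷ K) with X zero ∧ not k
... | true  = z≤n
... | false = keeps≤1 (X ∘ suc) K

-- (1 + q)^n times the expectation of F, each coordinate being true with probability q / (1 + q).
module Expectation (q : ℕ) where

  Q : ℕ
  Q = suc q

  E : ∀ n → (Vec Bool n → ℕ) → ℕ
  E zero    F = F []
  E (suc n) F = q * E n (F ∘ (true ∷_)) + E n (F ∘ (false ∷_))

  E-const : ∀ n c → E n (const c) ≡ c * Q ^ n
  E-const zero    c = sym (*-identityʳ c)
  E-const (suc n) c rewrite E-const n c = collect q c (Q ^ n)
    where
    collect : ∀ q c p → q * (c * p) + c * p ≡ c * (suc q * p)
    collect = solve-∀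

  E-+ : ∀ n F G → E n (λ K → F K + G K) ≡ E n F + E n G
  E-+ zero    F G = refl
  E-+ (suc n) F G rewrite E-+ n (F ∘ (true ∷_)) (G ∘ (true ∷_)) | E-+ n (F ∘ (false ∷_)) (G ∘ (false ∷_)) =
    collect q (E n (F ∘ (true ∷_))) (E n (G ∘ (true ∷_))) (E n (F ∘ (false ∷_))) (E n (G ∘ (false ∷_)))
    where
    collect : ∀ q a b c d → q * (a + b) + (c + d) ≡ (q * a + c) + (q * b + d)
    collect = solve-∀

  E-* : ∀ n c F → E n (λ K → c * F K) ≡ c * E n F
  E-* zero    c F = refl
  E-* (suc n) c F rewrite E-* n c (F ∘ (true ∷_)) | E-* n c (F ∘ (false ∷_)) =
    collect q c (E n (F ∘ (true ∷_))) (E n (F ∘ (false ∷_)))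
    where
    collect : ∀ q c a b → q * (c * a) + c * b ≡ c * (q * a + b)
    collect = solve-∀

  E-sum : ∀ n {m} (F : Fin m → Vec Bool n → ℕ) → E n (λ K → sum λ i → F i K) ≡ sum λ i → E n (F i)
  E-sum n {zero}  F = E-const n 0
  E-sum n {suc m} F = trans (E-+ n (F zero) (λ K → sum λ i → F (suc i) K)) (cong (E n (F zero) +_) (E-sum n (F ∘ suc)))

  -- The method of conditional expectations: some value of the first coordinate preserves the strict
  -- inequality.
  E-pick : ∀ n F G → E n F < E n G → ∃ λ K → F K < G K
  E-pick zero    F G lt = [] , lt
  E-pick (suc n) F G lt with E n (F ∘ (true ∷_)) <? E n (G ∘ (true ∷_)) | E n (F ∘ (false ∷_)) <? E n (G ∘ (false ∷_))
  ... | yes t | _     = let K , F<G = E-pick n _ _ t in true ∷ K , F<G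
  ... | no  _ | yes f = let K , F<G = E-pick n _ _ f in false ∷ K , F<G
  ... | no ¬t | no ¬f = contradiction lt (≤⇒≯ (+-mono-≤ (*-monoʳ-≤ q (≮⇒≥ ¬t)) (≮⇒≥ ¬f)))

  E-keeps : ∀ n (X : Fin n → Bool) → E n (keeps X) * Q ^ card X ≡ q ^ card X * Q ^ n
  E-keeps zero    X = refl
  E-keeps (suc n) X with X zero | E-keeps n (X ∘ suc)
  ... | true  | ih = begin
    (q * e + E n (const 0)) * (Q * p) ≡⟨ cong (λ z → (q * e + z) * (Q * p)) (E-const n 0) ⟩
    (q * e + 0) * (Q * p)             ≡⟨ shuffle q e Q p ⟩
    q * Q * (e * p)                   ≡⟨ cong (q * Q *_) ih ⟩
    q * Q * (q ^ a * Q ^ n)           ≡⟨ shuffle′ q Q (q ^ a) (Q ^ n) ⟩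
    q * q ^ a * (Q * Q ^ n)           ∎
    where
    open ≡-Reasoning
    e a p : ℕ
    e = E n (keeps (X ∘ suc))
    a = card (X ∘ suc)
    p = Q ^ a
    shuffle : ∀ q e Q p → (q * e + 0) * (Q * p) ≡ q * Q * (e * p)
    shuffle = solve-∀
    shuffle′ : ∀ q Q a b → q * Q * (a * b) ≡ q * a * (Q * b)
    shuffle′ = solve-∀
  ... | false | ih = begin
    (q * e + e) * p       ≡⟨ shuffle q e p ⟩
    Q * (e * p)           ≡⟨ cong (Q *_) ih ⟩
    Q * (q ^ a * Q ^ n)   ≡⟨ shuffle′ Q (q ^ a) (Q ^ n) ⟩
    q ^ a * (Q * Q ^ n)   ∎
    where
    open ≡-Reasoning
    e a p : ℕ
    e = E n (keeps (X ∘ suc))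
    a = card (X ∘ suc)
    p = Q ^ a
    shuffle : ∀ q e p → (q * e + e) * p ≡ suc q * (e * p)
    shuffle = solve-∀
    shuffle′ : ∀ Q a b → Q * (a * b) ≡ a * (Q * b)
    shuffle′ = solve-∀

  open ≤-Reasoning

  private
    swap : ∀ a b c → a * b * c ≡ a * c * b
    swap = solve-∀

    scale-up : ∀ x b c d → x ^ (b + c) * d ≡ x ^ b * d * x ^ c
    scale-up x b c d = trans (cong (_* d) (^-distribˡ-+-* x b c)) (swap (x ^ b) (x ^ c) d)

  -- Only an upper bound on the number of required elements is known for a hull; fewer requirements
  -- are met at least as often.
  E-keeps≥ : ∀ n X t → card X ≤ t → q ^ t * Q ^ n ≤ E n (keeps X) * Q ^ t
  E-keeps≥ n X t a≤t = begin
    q ^ t * Q ^ n              ≡⟨ cong (λ t → q ^ t * Q ^ n) (m+[n∸m]≡n a≤t) ⟨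
    q ^ (a + d) * Q ^ n        ≡⟨ scale-up q a d (Q ^ n) ⟩
    q ^ a * Q ^ n * q ^ d      ≤⟨ *-monoʳ-≤ (q ^ a * Q ^ n) (^-monoˡ-≤ d (n≤1+n q)) ⟩
    q ^ a * Q ^ n * Q ^ d      ≡⟨ cong (_* Q ^ d) (E-keeps n X) ⟨
    e * Q ^ a * Q ^ d          ≡⟨ *-assoc e (Q ^ a) (Q ^ d) ⟩
    e * (Q ^ a * Q ^ d)        ≡⟨ cong (e *_) (^-distribˡ-+-* Q a d) ⟨
    e * Q ^ (a + d)            ≡⟨ cong (λ t → e * Q ^ t) (m+[n∸m]≡n a≤t) ⟩
    e * Q ^ t                  ∎
    where
    a d e : ℕ
    a = card X
    d = t ∸ a
    e = E n (keeps X)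

  E-keeps≤ : ∀ n X t → t ≤ card X → E n (keeps X) * Q ^ t ≤ q ^ t * Q ^ n
  E-keeps≤ n X t t≤a = *-cancelʳ-≤ _ _ (Q ^ d) {{m^n≢0 Q d}} (begin
    e * Q ^ t * Q ^ d          ≡⟨ *-assoc e (Q ^ t) (Q ^ d) ⟩
    e * (Q ^ t * Q ^ d)        ≡⟨ cong (e *_) (^-distribˡ-+-* Q t d) ⟨
    e * Q ^ (t + d)            ≡⟨ cong (λ a → e * Q ^ a) (m+[n∸m]≡n t≤a) ⟩
    e * Q ^ card X             ≡⟨ E-keeps n X ⟩
    q ^ card X * Q ^ n         ≡⟨ cong (λ a → q ^ a * Q ^ n) (m+[n∸m]≡n t≤a) ⟨
    q ^ (t + d) * Q ^ n        ≡⟨ scale-up q t d (Q ^ n) ⟩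
    q ^ t * Q ^ n * q ^ d      ≤⟨ *-monoʳ-≤ (q ^ t * Q ^ n) (^-monoˡ-≤ d (n≤1+n q)) ⟩
    q ^ t * Q ^ n * Q ^ d      ∎)
    where
    d e : ℕ
    d = card X ∸ t
    e = E n (keeps X)

  -- First moment method; a bad family has weight m, so that a surviving one would outweigh all m cells.
  survivors : ∀ {n m l t w} v (cell : Fin m → Fin t → Fin n) (bad : Fin l → Fin w → Fin n) →
              suc v * Q ^ t ≤ m * q ^ t → m * l * q ^ w < Q ^ w →
              ∃ λ K → (∀ b → (∀ {i j} → bad b i ≡ bad b j → i ≡ j) → ¬ (∀ i → Vec.lookup K (bad b i) ≡ true)) ×
                      v < sum λ c → keeps (hull (cell c)) K
  survivors {n} {m} {l} {t} {w} v cell bad many few = K , no-bad , ≤-<-trans (m≤m+n v _) Φ<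
    where
    W : Fin l → Vec Bool n → ℕ
    -- A family with repetitions may survive with probability above `(q/Q)^w`, so only families with
    -- at least `w` distinct members carry weight.
    W b K = if w ≤ᵇ card (hull (bad b)) then keeps (hull (bad b)) K else 0

    E-W : ∀ b → E n (W b) * Q ^ w ≤ q ^ w * Q ^ n
    E-W b with w ≤ᵇ card (hull (bad b)) in eq
    ... | true  = E-keeps≤ n (hull (bad b)) w (≤ᵇ-true⁻ w _ eq)
    ... | false = ≤-trans (≤-reflexive (cong (_* Q ^ w) (E-const n 0))) z≤n

    Φ Ψ : Vec Bool n → ℕ
    Φ K = v + m * sum λ b → W b K
    Ψ K = sum λ c → keeps (hull (cell c)) K

    E-Φ : E n Φ ≡ v * Q ^ n + m * sum λ b → E n (W b)
    E-Φ = trans (E-+ n (const v) (λ K → m * sum λ b → W b K)) (cong₂ _+_ (E-const n v)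
      (trans (E-* n m (λ K → sum λ b → W b K)) (cong (m *_) (E-sum n W))))

    -- The expected weight of the bad families is below one, which is the gap between `v` and the
    -- `suc v` ones expected.
    bads : m * sum (λ b → E n (W b)) < Q ^ n
    bads = *-cancelʳ-< (Q ^ w) _ _ (begin-strict
      m * sum (λ b → E n (W b)) * Q ^ w        ≡⟨ *-assoc m _ (Q ^ w) ⟩
      m * (sum (λ b → E n (W b)) * Q ^ w)      ≡⟨ cong (m *_) (*-distribʳ-sum (Q ^ w) (λ b → E n (W b))) ⟩
      m * sum (λ b → E n (W b) * Q ^ w)        ≤⟨ *-monoʳ-≤ m (sum-≤-const (q ^ w * Q ^ n) E-W) ⟩
      m * (l * (q ^ w * Q ^ n))                ≡⟨ shuffle m l (q ^ w) (Q ^ n) ⟩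
      m * l * q ^ w * Q ^ n                    <⟨ *-monoˡ-< (Q ^ n) {{m^n≢0 Q n}} few ⟩
      Q ^ w * Q ^ n                            ≡⟨ *-comm (Q ^ w) (Q ^ n) ⟩
      Q ^ n * Q ^ w                            ∎)
      where
      shuffle : ∀ m l a b → m * (l * (a * b)) ≡ m * l * a * b
      shuffle = solve-∀

    E-Ψ : suc v * Q ^ n ≤ E n Ψ
    E-Ψ = *-cancelʳ-≤ _ _ (Q ^ t) {{m^n≢0 Q t}} (begin
      suc v * Q ^ n * Q ^ t        ≡⟨ swap (suc v) (Q ^ n) (Q ^ t) ⟩
      suc v * Q ^ t * Q ^ n        ≤⟨ *-monoˡ-≤ (Q ^ n) many ⟩
      m * q ^ t * Q ^ n            ≡⟨ *-assoc m (q ^ t) (Q ^ n) ⟩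
      m * (q ^ t * Q ^ n)          ≡⟨ sum-const m (q ^ t * Q ^ n) ⟨
      sum {m} (λ c → q ^ t * Q ^ n) ≤⟨ sum-mono (λ c → E-keeps≥ n (hull (cell c)) t (card-hull≤ (cell c))) ⟩
      sum (λ c → E n (keeps (hull (cell c))) * Q ^ t) ≡⟨ *-distribʳ-sum (Q ^ t) (λ c → E n (keeps (hull (cell c)))) ⟨
      sum (λ c → E n (keeps (hull (cell c)))) * Q ^ t ≡⟨ cong (_* Q ^ t) (E-sum n (λ c → keeps (hull (cell c)))) ⟨
      E n Ψ * Q ^ t                ∎)

    picked : ∃ λ K → Φ K < Ψ K
    picked = E-pick n Φ Ψ (begin-strict
      E n Φ                                          ≡⟨ E-Φ ⟩
      v * Q ^ n + m * sum (λ b → E n (W b))          <⟨ +-monoʳ-< (v * Q ^ n) bads ⟩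
      v * Q ^ n + Q ^ n                              ≡⟨ +-comm (v * Q ^ n) (Q ^ n) ⟩
      suc v * Q ^ n                                  ≤⟨ E-Ψ ⟩
      E n Ψ                                          ∎)

    K : Vec Bool n
    K = proj₁ picked

    Φ< : Φ K < Ψ K
    Φ< = proj₂ picked

    no-bad : ∀ b → (∀ {i j} → bad b i ≡ bad b j → i ≡ j) → ¬ (∀ i → Vec.lookup K (bad b i) ≡ true)
    no-bad b inj all = <⇒≱ Φ< (begin
      Ψ K                         ≤⟨ sum-≤-const 1 (λ c → keeps≤1 (hull (cell c)) K) ⟩
      m * 1                       ≤⟨ *-monoʳ-≤ m (≤-trans (≤-reflexive (sym W≡1)) (term≤sum (λ b → W b K) b)) ⟩
      m * sum (λ b → W b K)       ≤⟨ m≤n+m _ v ⟩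
      Φ K                         ∎)
      where
      W≡1 : W b K ≡ 1
      W≡1 = trans (cong (λ large → if large then keeps (hull (bad b)) K else 0) (≤ᵇ-true (card-hull≥ (bad b) inj)))
        (keeps⁺ (hull (bad b)) K λ x x∈ →
          let i , eᵢ = anyᵇ⁻ _ x∈ in subst (λ x → Vec.lookup K x ≡ true) (is⁻ (bad b i) x eᵢ) (all i))

-- Dyadic intervals and least common ancestors

shift : ℕ → ℕ → ℕ
shift zero    x = x
shift (suc i) x = ⌊ shift i x /2⌋

shift-mono : ∀ i {x y} → x ≤ y → shift i x ≤ shift i y
shift-mono zero    x≤y = x≤y
shift-mono (suc i) x≤y = ⌊n/2⌋-mono (shift-mono i x≤y)

shift≤ : ∀ i x → shift i x ≤ x
shift≤ zero    x = ≤-refl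
shift≤ (suc i) x = ≤-trans (⌊n/2⌋≤n (shift i x)) (shift≤ i x)

shift-< : ∀ i j {x} → x < 2 ^ (i + j) → shift i x < 2 ^ j
shift-< zero    j x< = x<
shift-< (suc i) j {x} x< = ≰⇒> λ ≤half → <⇒≱ (shift-< i (suc j) (subst (λ e → x < 2 ^ e) (sym (+-suc i j)) x<)) (begin
  2 ^ j + (2 ^ j + 0)                      ≡⟨ cong (2 ^ j +_) (+-identityʳ (2 ^ j)) ⟩
  2 ^ j + 2 ^ j                            ≤⟨ +-mono-≤ ≤half (≤-trans ≤half (⌊n/2⌋≤⌈n/2⌉ (shift i x))) ⟩
  ⌊ shift i x /2⌋ + ⌈ shift i x /2⌉        ≡⟨ ⌊n/2⌋+⌈n/2⌉≡n (shift i x) ⟩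
  shift i x                                ∎)
  where open ≤-Reasoning

-- The strict inequality one level below puts the two ends into different children of their common
-- ancestor; `lca-disjoint` depends on it.
least-level : ∀ n lo hi → lo ≤ hi → shift n lo ≡ shift n hi →
              ∃ λ i → i ≤ n × shift i lo ≡ shift i hi × (∀ j → suc j ≡ i → shift j lo < shift j hi)
least-level zero    lo hi lo≤hi eq = 0 , z≤n , eq , λ _ ()
least-level (suc n) lo hi lo≤hi eq with shift n lo ≟ shift n hi
... | yes eq′ = let i , i≤n , rest = least-level n lo hi lo≤hi eq′ in i , m≤n⇒m≤1+n i≤n , rest
... | no  neq = suc n , ≤-refl , eq , λ { j refl → ≤∧≢⇒< (shift-mono n lo≤hi) neq }

-- A level with an index. Every level is allowed `2 ^ α` indices, more than the higher levels use;
-- the union bound only asks that the total be at most `2 ^ (2 α)`.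
Node : ℕ → Set
Node α = Fin (suc α * 2 ^ α)

-- The dyadic interval of length 2 ^ i containing x.
ancestor : ∀ {α} → Fin (suc α) → Fin (2 ^ α) → Node α
ancestor i x = combine i (fromℕ< (≤-<-trans (shift≤ (toℕ i) (toℕ x)) (Fin.toℕ<n x)))

ancestor-cong : ∀ {α} i (x y : Fin (2 ^ α)) → shift (toℕ i) (toℕ x) ≡ shift (toℕ i) (toℕ y) → ancestor {α} i x ≡ ancestor i y
ancestor-cong i x y eq = cong (combine i) (Fin.fromℕ<-cong _ _ eq _ _)

ancestor-injective : ∀ {α} i j (x y : Fin (2 ^ α)) → ancestor {α} i x ≡ ancestor j y →
                     i ≡ j × shift (toℕ i) (toℕ x) ≡ shift (toℕ j) (toℕ y)
ancestor-injective i j x y eq with i≡j , f≡ ← Fin.combine-injective i _ j _ eq = i≡j , Fin.fromℕ<-injective _ _ _ _ f≡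

module _ {α : ℕ} (lo hi : Fin (2 ^ α)) (lo≤hi : lo Fin.≤ hi) where
  private
    level : ∃ λ i → i ≤ α × shift i (toℕ lo) ≡ shift i (toℕ hi) × (∀ j → suc j ≡ i → shift j (toℕ lo) < shift j (toℕ hi))
    level = least-level α (toℕ lo) (toℕ hi) lo≤hi (trans (top lo) (sym (top hi)))
      where
      top : ∀ x → shift α (toℕ x) ≡ 0
      top x = n<1⇒n≡0 (shift-< α 0 (subst (λ e → toℕ x < 2 ^ e) (sym (+-identityʳ α)) (Fin.toℕ<n x)))

  lcaLevel : Fin (suc α)
  lcaLevel = fromℕ< (s≤s (proj₁ (proj₂ level)))

  private
    toℕ-level : toℕ lcaLevel ≡ proj₁ level
    toℕ-level = Fin.toℕ-fromℕ< _

  lca : Node α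
  lca = ancestor lcaLevel lo

  lca-ends : shift (toℕ lcaLevel) (toℕ lo) ≡ shift (toℕ lcaLevel) (toℕ hi)
  lca-ends = subst (λ i → shift i (toℕ lo) ≡ shift i (toℕ hi)) (sym toℕ-level) (proj₁ (proj₂ (proj₂ level)))

  lca-least : ∀ j → suc j ≡ toℕ lcaLevel → shift j (toℕ lo) < shift j (toℕ hi)
  lca-least j eq = proj₂ (proj₂ (proj₂ level)) j (trans eq toℕ-level)

  lca-ancestor : ∀ x → lo Fin.≤ x → x Fin.≤ hi → ancestor lcaLevel x ≡ lca
  lca-ancestor x lo≤x x≤hi = ancestor-cong lcaLevel x lo (≤-antisym
    (≤-trans (shift-mono (toℕ lcaLevel) x≤hi) (≤-reflexive (sym lca-ends))) (shift-mono (toℕ lcaLevel) lo≤x))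

-- Two disjoint intervals with the same least common ancestor would give it three children.
lca-disjoint : ∀ {α} (lo hi lo′ hi′ : Fin (2 ^ α)) lo≤hi lo′≤hi′ → hi Fin.< lo′ →
               lca {α} lo hi lo≤hi ≢ lca {α} lo′ hi′ lo′≤hi′
lca-disjoint {α} lo hi lo′ hi′ lo≤hi lo′≤hi′ hi<lo′ eq
  with i≡i′ , shifts ← ancestor-injective {α} (lcaLevel lo hi lo≤hi) (lcaLevel lo′ hi′ lo′≤hi′) lo lo′ eq
  = cases (toℕ i) refl
  where
  i i′ : Fin (suc α)
  i = lcaLevel {α} lo hi lo≤hi
  i′ = lcaLevel {α} lo′ hi′ lo′≤hi′
  ends : shift (toℕ i) (toℕ lo) ≡ shift (toℕ i) (toℕ hi′)
  ends = trans shifts (trans (lca-ends {α} lo′ hi′ lo′≤hi′) (cong (λ i → shift (toℕ i) (toℕ hi′)) (sym i≡i′)))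
  open ≤-Reasoning
  cases : ∀ n → toℕ i ≡ n → ⊥
  cases zero    i≡ = <⇒≢ (≤-<-trans lo≤hi (<-≤-trans hi<lo′ lo′≤hi′))
    (subst (λ n → shift n (toℕ lo) ≡ shift n (toℕ hi′)) i≡ ends)
  cases (suc j) i≡ = <⇒≢ (begin-strict
    ⌊ shift j (toℕ lo) /2⌋             <⟨ n<1+n _ ⟩
    ⌊ 2 + shift j (toℕ lo) /2⌋         ≤⟨ ⌊n/2⌋-mono (begin
      2 + shift j (toℕ lo)             ≤⟨ s≤s (lca-least {α} lo hi lo≤hi j (sym i≡)) ⟩
      1 + shift j (toℕ hi)             ≤⟨ s≤s (shift-mono j (<⇒≤ hi<lo′)) ⟩
      1 + shift j (toℕ lo′)            ≤⟨ lca-least {α} lo′ hi′ lo′≤hi′ j (trans (sym i≡) (cong toℕ i≡i′)) ⟩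
      shift j (toℕ hi′)                ∎) ⟩
    ⌊ shift j (toℕ hi′) /2⌋            ∎)
    (subst (λ n → shift n (toℕ lo) ≡ shift n (toℕ hi′)) i≡ ends)

argmin : ∀ {n} (f : Fin (suc n) → ℕ) → ∃ λ i → ∀ j → f i ≤ f j
argmin {zero}  f = zero , λ { zero → ≤-refl }
argmin {suc n} f with i , min ← argmin (f ∘ suc) with ≤-total (f zero) (f (suc i))
... | inj₁ le = zero , λ { zero → ≤-refl ; (suc j) → ≤-trans le (min j) }
... | inj₂ ge = suc i , λ { zero → ge ; (suc j) → min j }

argmax : ∀ {n} (f : Fin (suc n) → ℕ) → ∃ λ i → ∀ j → f j ≤ f i
argmax {zero}  f = zero , λ { zero → ≤-refl }
argmax {suc n} f with i , max ← argmax (f ∘ suc) with ≤-total (f zero) (f (suc i))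
... | inj₁ le = suc i , λ { zero → le ; (suc j) → max j }
... | inj₂ ge = zero , λ { zero → ≤-refl ; (suc j) → ≤-trans (max j) ge }

-- The points in one row group of a minor may lie in different rows. The least common ancestor of
-- their span is a single node containing all of them, and different groups have disjoint spans.
-- Columns use the same module with the indices exchanged.
module Groups {α r : ℕ} (x : Fin (suc r) → Fin (suc r) → Fin (2 ^ α))
              (x-mono : ∀ {a a′} b b′ → a Fin.< a′ → x a b Fin.< x a′ b′) where
  private
    lo hi : Fin (suc r) → Fin (2 ^ α)
    lo a = x a (proj₁ (argmin (toℕ ∘ x a)))
    hi a = x a (proj₁ (argmax (toℕ ∘ x a)))

    lo≤ : ∀ a b → lo a Fin.≤ x a b
    lo≤ a b = proj₂ (argmin (toℕ ∘ x a)) b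

    ≤hi : ∀ a b → x a b Fin.≤ hi a
    ≤hi a b = proj₂ (argmax (toℕ ∘ x a)) b

    lo≤hi : ∀ a → lo a Fin.≤ hi a
    lo≤hi a = ≤-trans (lo≤ a zero) (≤hi a zero)

  node : Fin (suc r) → Node α
  node a = lca {α} (lo a) (hi a) (lo≤hi a)

  node-ancestor : ∀ a b → ∃ λ i → ancestor {α} i (x a b) ≡ node a
  node-ancestor a b = lcaLevel {α} (lo a) (hi a) (lo≤hi a) , lca-ancestor {α} (lo a) (hi a) (lo≤hi a) (x a b) (lo≤ a b) (≤hi a b)

  node-injective : ∀ {a a′} → node a ≡ node a′ → a ≡ a′
  node-injective {a} {a′} eq with <-cmp (toℕ a) (toℕ a′)
  ... | tri≈ _ a≡a′ _ = Fin.toℕ-injective a≡a′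
  ... | tri< a<a′ _ _ = contradiction eq (lca-disjoint {α} (lo a) (hi a) (lo a′) (hi a′) (lo≤hi a) (lo≤hi a′) (x-mono _ _ a<a′))
  ... | tri> _ _ a′<a = contradiction (sym eq) (lca-disjoint {α} (lo a′) (hi a′) (lo a) (hi a) (lo≤hi a′) (lo≤hi a) (x-mono _ _ a′<a))

-- A dense matrix without a large complete minor

module _ (α β r q v : ℕ) where
  private
    P C t w : ℕ
    P = suc α * 2 ^ α
    C = suc β * 2 ^ β
    t = suc α * suc β
    w = suc r * suc r

    cell : Fin (2 ^ α * 2 ^ β) → Fin t → Fin (P * C)
    cell c e = let x , y = remQuot {2 ^ α} (2 ^ β) c ; i , j = remQuot {suc α} (suc β) e in
      combine (ancestor {α} i x) (ancestor {β} j y)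

    -- Sets of nodes are enumerated as functions, so some codes list a pair twice; `survivors`
    -- excludes only the injective families, and those are all that a minor produces.
    biclique : Fin (P ^ suc r * C ^ suc r) → Fin w → Fin (P * C)
    biclique b e = let f , g = remQuot {P ^ suc r} (C ^ suc r) b ; a , b = remQuot {suc r} (suc r) e in
      combine (finToFun {P} {suc r} f a) (finToFun {C} {suc r} g b)

  -- The first hypothesis bounds the expected number of ones from below by `suc v`; the second keeps
  -- the expected number of surviving bicliques, times the number of cells, below one.
  dense-minor-free : suc v * suc q ^ t ≤ 2 ^ α * 2 ^ β * q ^ t →
                     2 ^ α * 2 ^ β * (P ^ suc r * C ^ suc r) * q ^ w < suc q ^ w →
                     ∃ λ (A : Matrix (2 ^ α) (2 ^ β)) → v < ones A × ¬ Minor (suc r) A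
  dense-minor-free many few = A , subst (v <_) (sym ones≡) v< , no-minor
    where
    survivor : ∃ λ K → (∀ b → (∀ {i j} → biclique b i ≡ biclique b j → i ≡ j) → ¬ (∀ i → Vec.lookup K (biclique b i) ≡ true)) ×
                       v < sum λ c → keeps (hull (cell c)) K
    survivor = Expectation.survivors q v cell biclique many few

    K : Vec Bool (P * C)
    K = proj₁ survivor

    v< : v < sum λ c → keeps (hull (cell c)) K
    v< = proj₂ (proj₂ survivor)

    A : Matrix (2 ^ α) (2 ^ β)
    A x y = 0 <ᵇ keeps (hull (cell (combine x y))) K

    𝟙-0< : ∀ {z} → z ≤ 1 → 𝟙 (0 <ᵇ z) ≡ z
    𝟙-0< z≤n       = refl
    𝟙-0< (s≤s z≤n) = refl

    ones≡ : ones A ≡ sum λ c → keeps (hull (cell c)) K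
    ones≡ = trans (sum-cong-≗ {2 ^ α} λ x → sum-cong-≗ {2 ^ β} λ y → 𝟙-0< (keeps≤1 (hull (cell (combine x y))) K))
      (sym (sum-combine (2 ^ α) {2 ^ β} λ c → keeps (hull (cell c)) K))

    A⁻ : ∀ x y → A x y ≡ true → ∀ i j → Vec.lookup K (combine (ancestor {α} i x) (ancestor {β} j y)) ≡ true
    A⁻ x y A∋ i j = keeps⁻ (hull (cell (combine x y))) K (<ᵇ⇒< 0 _ (subst T (sym A∋) _)) _
      (anyᵇ⁺ (λ e → is (cell (combine x y) e) (combine (ancestor {α} i x) (ancestor {β} j y))) (combine i j) (trans (cong (λ e → is e (combine (ancestor {α} i x) (ancestor {β} j y))) edge) (is-refl (combine (ancestor {α} i x) (ancestor {β} j y)))))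
      where
      edge : cell (combine x y) (combine i j) ≡ combine (ancestor {α} i x) (ancestor {β} j y)
      edge = cong₂ (λ (x , y) (i , j) → combine (ancestor {α} i x) (ancestor {β} j y))
        (Fin.remQuot-combine x y) (Fin.remQuot-combine i j)

    no-minor : ¬ Minor (suc r) A
    no-minor (x , y , A∋ , x-mono , y-mono) = proj₁ (proj₂ survivor) b injective kept
      where
      module Rows = Groups {α} x x-mono
      module Cols = Groups {β} (λ b a → y a b) (λ a a′ lt → y-mono a a′ lt)
      b : Fin (P ^ suc r * C ^ suc r)
      b = combine (funToFin Rows.node) (funToFin Cols.node)
      edge : ∀ e → biclique b e ≡ combine (Rows.node (proj₁ (remQuot {suc r} (suc r) e))) (Cols.node (proj₂ (remQuot {suc r} (suc r) e)))
      edge e = trans (cong (λ (f , g) → combine (finToFun {P} {suc r} f (proj₁ (remQuot {suc r} (suc r) e))) (finToFun {C} {suc r} g (proj₂ (remQuot {suc r} (suc r) e))))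
          (Fin.remQuot-combine (funToFin Rows.node) (funToFin Cols.node)))
        (cong₂ combine (Fin.finToFun-funToFin Rows.node _) (Fin.finToFun-funToFin Cols.node _))
      injective : ∀ {i j} → biclique b i ≡ biclique b j → i ≡ j
      injective {i} {j} eq = trans (sym (Fin.combine-remQuot {suc r} (suc r) i))
        (trans (cong₂ combine (Rows.node-injective (proj₁ nodes)) (Cols.node-injective (proj₂ nodes))) (Fin.combine-remQuot {suc r} (suc r) j))
        where
        row column : Fin w → Fin (suc r)
        row e = proj₁ (remQuot {suc r} (suc r) e)
        column e = proj₂ (remQuot {suc r} (suc r) e)
        nodes : Rows.node (row i) ≡ Rows.node (row j) × Cols.node (column i) ≡ Cols.node (column j)
        nodes = Fin.combine-injective _ _ _ _ (trans (sym (edge i)) (trans eq (edge j)))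
      kept : ∀ e → Vec.lookup K (biclique b e) ≡ true
      kept e = trans (cong (Vec.lookup K) (trans (edge e) (cong₂ combine (sym (proj₂ row)) (sym (proj₂ col)))))
        (A⁻ (x a c) (y a c) (A∋ a c) (proj₁ row) (proj₁ col))
        where
        a c : Fin (suc r)
        a = proj₁ (remQuot {suc r} (suc r) e)
        c = proj₂ (remQuot {suc r} (suc r) e)
        row : ∃ λ i → ancestor {α} i (x a c) ≡ Rows.node a
        row = Rows.node-ancestor a c
        col : ∃ λ j → ancestor {β} j (y a c) ≡ Cols.node c
        col = Cols.node-ancestor c a

-- From matrices to permutations

-- The points (i , f i), ordered by column and then by row.
module Placement {R C : ℕ} (f : Fin R → Fin C) where

  key : Fin R → ℕ
  key i = toℕ (combine (f i) i)

  private
    key-injective : ∀ {i j} → key i ≡ key j → i ≡ j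
    key-injective {i} {j} eq = Fin.combine-injectiveʳ (f i) i (f j) j (Fin.toℕ-injective eq)

  placed : Permutation′ R
  placed = sorting key key-injective

  column-< : ∀ i j → f i Fin.< f j → placed ⟨$⟩ʳ i Fin.< placed ⟨$⟩ʳ j
  column-< i j lt = Equivalence.from (sorting-⇔ key key-injective i j) (Fin.combine-monoˡ-< i j lt)

  row-< : ∀ i j → f i ≡ f j → i Fin.< j → placed ⟨$⟩ʳ i Fin.< placed ⟨$⟩ʳ j
  row-< i j eq lt = Equivalence.from (sorting-⇔ key key-injective i j)
    (subst (λ c → toℕ (combine c i) < key j) (sym eq)
      (subst₂ _<_ (sym (Fin.toℕ-combine (f j) i)) (sym (Fin.toℕ-combine (f j) j)) (+-monoʳ-< _ lt)))

  column-≤ : ∀ i j → placed ⟨$⟩ʳ i Fin.< placed ⟨$⟩ʳ j → f i Fin.≤ f j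
  column-≤ i j lt = ≮⇒≥ λ fj<fi → <-asym lt (column-< j i fj<fi)

  occupancy : Fin C → Fin (suc R)
  occupancy c = fromℕ< (s≤s (card≤ λ i → toℕ (f i) <ᵇ toℕ c))

open Placement

-- The columns are recovered from the permutation and the number of points to the left of each column.
placement-≤ : ∀ {R C} (f g : Fin R → Fin C) → placed f ≈ placed g → (∀ c → occupancy f c ≡ occupancy g c) →
              ∀ i → g i Fin.≤ f i
placement-≤ {R} {C} f g σ≈ occ i = ≮⇒≥ λ fi<gi → <⇒≢
  (sum-mono-< {R} {λ j → 𝟙 (toℕ (g j) <ᵇ toℕ (g i))} {λ j → 𝟙 (toℕ (f j) <ᵇ toℕ (g i))} (le fi<gi) i
    (subst₂ (λ b c → 𝟙 b < 𝟙 c) (sym (Bool.¬-not (irrefl (toℕ (g i))))) (sym (≤ᵇ-true fi<gi)) ≤-refl))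
  (sym (trans (sym (Fin.toℕ-fromℕ< _)) (trans (cong toℕ (occ (g i))) (Fin.toℕ-fromℕ< _))))
  where
  irrefl : ∀ x → (x <ᵇ x) ≢ true
  irrefl x eq = <-irrefl refl (<ᵇ⇒< x x (Equivalence.from Bool.T-≡ eq))
  le : f i Fin.< g i → ∀ j → 𝟙 (toℕ (g j) <ᵇ toℕ (g i)) ≤ 𝟙 (toℕ (f j) <ᵇ toℕ (g i))
  le fi<gi j with toℕ (g j) <ᵇ toℕ (g i) in eq
  ... | false = z≤n
  ... | true  rewrite ≤ᵇ-true (≤-<-trans (column-≤ f j i (subst₂ Fin._<_ (sym (σ≈ j)) (sym (σ≈ i))
                        (column-< g j i (<ᵇ⇒< (toℕ (g j)) (toℕ (g i)) (Equivalence.from Bool.T-≡ eq))))) fi<gi) = ≤-refl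

placement-injective : ∀ {R C} (f g : Fin R → Fin C) → placed f ≈ placed g → (∀ c → occupancy f c ≡ occupancy g c) → ∀ i → f i ≡ g i
placement-injective f g σ≈ occ i = Fin.toℕ-injective (≤-antisym
  (placement-≤ g f (sym ∘ σ≈) (sym ∘ occ) i) (placement-≤ f g σ≈ occ i))

-- If π is contained in the placement, separated position blocks give separated rows, and every third value
-- block gives separated columns: two consecutive value blocks inside one column would be increasing.
placement-minor : ∀ {R C N r ρ s k} (A : Matrix N C) (row : Fin R → Fin N) (f : Fin R → Fin C) →
                  (∀ {i j} → i Fin.< j → row i Fin.< row j) → (∀ i → A (row i) (f i) ≡ true) →
                  3 * r ≤ ρ → (π : Permutation′ k) → Grid ρ s k π → Contains (placed f) π → Minor r A
placement-minor {R} {C} {N} {r} {ρ} {s} {k} A row f row-mono A∋ 3r≤ρ π grid (X , X-mono , iso) =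
  (λ a b → row (X (point a b))) , (λ a b → f (X (point a b))) , (λ a b → A∋ _) ,
  (λ {a} {a′} b b′ lt → row-mono (X-mono _ _ (rows< a b a′ b′ lt))) , columns<
  where
  triple : Fin r → ℕ
  triple b = 3 * toℕ b

  triple<ρ : ∀ b → 2 + triple b < ρ
  triple<ρ b = ≤-trans (≤-trans (≤-reflexive (sym (*-suc 3 (toℕ b)))) (*-monoʳ-≤ 3 (Fin.toℕ<n b))) 3r≤ρ

  r≤ρ : r ≤ ρ
  r≤ρ = ≤-trans (m≤n*m r 3) 3r≤ρ

  hit : ∀ (a b : Fin r) → ∃ λ i → (toℕ a * s ≤ toℕ i × toℕ i < suc (toℕ a) * s) ×
        (triple b * s ≤ toℕ (π ⟨$⟩ʳ i) × toℕ (π ⟨$⟩ʳ i) < suc (triple b) * s)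
  hit a b = Grid.hit grid (toℕ a) (triple b) (<-≤-trans (Fin.toℕ<n a) r≤ρ) (<-trans (m<n+m (triple b) {2} (s≤s z≤n)) (triple<ρ b))

  point : Fin r → Fin r → Fin k
  point a b = proj₁ (hit a b)

  rows< : ∀ a b a′ b′ → a Fin.< a′ → point a b Fin.< point a′ b′
  rows< a b a′ b′ a<a′ = <-≤-trans (proj₂ (proj₁ (proj₂ (hit a b))))
    (≤-trans (*-monoˡ-≤ s a<a′) (proj₁ (proj₁ (proj₂ (hit a′ b′)))))

  monotone : ∀ i j → π ⟨$⟩ʳ i Fin.< π ⟨$⟩ʳ j → f (X i) Fin.≤ f (X j)
  monotone i j lt = column-≤ f (X i) (X j) (Equivalence.from (iso i j) lt)

  columns< : ∀ a a′ {b b′} → b Fin.< b′ → f (X (point a b)) Fin.< f (X (point a′ b′))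
  columns< a a′ {b} {b′} b<b′ = ≰⇒> λ ge →
    -- Otherwise the values between those of the two points all lie in one column. The grid supplies
    -- a descent among them, `p₁` being to the right of `p₂` and below it, whereas points of one
    -- column ascend.
    let p₁ , (≤p₁ , _) , (≤πp₁ , πp₁<) = Grid.hit grid 1 (1 + triple b) (≤-trans (s≤s (s≤s z≤n)) (triple<ρ b)) (<-trans (n<1+n _) (triple<ρ b))
        p₂ , (_ , p₂<) , (≤πp₂ , πp₂<) = Grid.hit grid 0 (2 + triple b) (≤-trans (s≤s z≤n) (triple<ρ b)) (triple<ρ b)
        π< = <-≤-trans πp₁< ≤πp₂
        fi≤f₁ = monotone (point a b) p₁ (<-≤-trans (proj₂ (proj₂ (proj₂ (hit a b)))) ≤πp₁)
        f₁≤f₂ = monotone p₁ p₂ π<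
        f₂≤fi′ = monotone p₂ (point a′ b′) (<-≤-trans πp₂< (≤-trans (*-monoˡ-≤ s (≤-trans (≤-reflexive (sym (*-suc 3 (toℕ b)))) (*-monoʳ-≤ 3 b<b′)))
                   (proj₁ (proj₂ (proj₂ (hit a′ b′))))))
        f₂≡f₁ = Fin.toℕ-injective (≤-antisym (≤-trans f₂≤fi′ (≤-trans ge fi≤f₁)) f₁≤f₂)
        x< = X-mono p₂ p₁ (<-≤-trans p₂< ≤p₁)
    in <-asym π< (Equivalence.to (iso p₂ p₁) (row-< f (X p₂) (X p₁) f₂≡f₁ x<))

module _ {N C r ρ s k : ℕ} (A : Matrix N C) (¬minor : ¬ Minor r A) (3r≤ρ : 3 * r ≤ ρ) where
  private
    U : PermutationSet k
    U = gridSet ρ s k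

  open ≤-Reasoning

  -- Rows with fewer than `d` ones contribute at most `N * d` ones and the others at most `C` each,
  -- so at least `R` rows are rich. Of the `d ^ R` choices of columns, those that give the same
  -- permutation are told apart by their occupancies.
  choices≤ : ∀ R d → R * C + N * d < ones A → d ^ R ≤ S R U * suc R ^ C
  choices≤ R d lt = Fin.injective⇒≤ {f = code} code-injective
    where
    rich : Fin N → Bool
    rich x = d ≤ᵇ card (A x)

    card≤rich : ∀ x → card (A x) ≤ 𝟙 (rich x) * C + d
    card≤rich x with d ≤ᵇ card (A x) in eq
    ... | true  = ≤-trans (card≤ (A x)) (≤-trans (≤-reflexive (sym (+-identityʳ C))) (m≤m+n _ d))
    ... | false = ≮⇒≥ λ d< → contradiction (trans (sym (≤ᵇ-true (<⇒≤ d<))) eq) λ ()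

    R≤rich : R ≤ card rich
    R≤rich = <⇒≤ (*-cancelʳ-< C _ _ (+-cancelʳ-< (N * d) _ _ (begin-strict
      R * C + N * d                              <⟨ lt ⟩
      ones A                                     ≤⟨ sum-mono card≤rich ⟩
      sum (λ x → 𝟙 (rich x) * C + d)             ≡⟨ ∑-distrib-+ (λ x → 𝟙 (rich x) * C) (const d) ⟩
      sum (λ x → 𝟙 (rich x) * C) + sum {N} (const d) ≡⟨ cong₂ _+_ (sym (*-distribʳ-sum C (𝟙 ∘ rich))) (sum-const N d) ⟩
      card rich * C + N * d                      ∎)))

    rowsΣ : ∃ λ (e : Fin R → Fin N) → (∀ {i j} → i Fin.< j → e i Fin.< e j) × (∀ i → rich (e i) ≡ true)
    rowsΣ = enumerate R rich R≤rich

    row : Fin R → Fin N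
    row = proj₁ rowsΣ

    colsΣ : ∀ i → ∃ λ (e : Fin d → Fin C) → (∀ {i j} → i Fin.< j → e i Fin.< e j) × (∀ j → A (row i) (e j) ≡ true)
    colsΣ i = enumerate d (A (row i)) (≤ᵇ-true⁻ d _ (proj₂ (proj₂ rowsΣ) i))

    f : Fin (d ^ R) → Fin R → Fin C
    f φ i = proj₁ (colsΣ i) (finToFun φ i)

    f-injective : ∀ {φ ψ} → (∀ i → f φ i ≡ f ψ i) → φ ≡ ψ
    f-injective {φ} {ψ} eq = trans (sym (Fin.funToFin-finToFin {R} {d} φ)) (trans (funToFin-cong _ _ λ i →
        increasing⇒injective (proj₁ (colsΣ i)) (proj₁ (proj₂ (colsΣ i))) (eq i)) (Fin.funToFin-finToFin {R} {d} ψ))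
      where
      funToFin-cong : ∀ {m n} (f g : Fin m → Fin n) → (∀ i → f i ≡ g i) → funToFin f ≡ funToFin g
      funToFin-cong {zero}  f g eq = refl
      funToFin-cong {suc m} f g eq = cong₂ combine (eq zero) (funToFin-cong (f ∘ suc) (g ∘ suc) (eq ∘ suc))

    avoids : ∀ φ → Avoids (placed (f φ)) U
    avoids φ = All.map (λ {π} grid contains → ¬minor (placement-minor A row (f φ) (proj₁ (proj₂ rowsΣ))
      (λ i → proj₂ (proj₂ (colsΣ i)) (finToFun φ i)) 3r≤ρ π grid contains)) (gridSet-Grid ρ s k)

    code : Fin (d ^ R) → Fin (S R U * suc R ^ C)
    code φ = combine (avoiderIndex U (placed (f φ)) (avoids φ)) (funToFin (occupancy (f φ)))

    code-injective : ∀ {φ ψ} → code φ ≡ code ψ → φ ≡ ψ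
    code-injective {φ} {ψ} eq = f-injective (placement-injective (f φ) (f ψ)
      (avoiderIndex-injective U (placed (f φ)) (placed (f ψ)) (avoids φ) (avoids ψ) (proj₁ split))
      (funToFin-injective (occupancy (f φ)) (occupancy (f ψ)) (proj₂ split)))
      where
      split : avoiderIndex U (placed (f φ)) (avoids φ) ≡ avoiderIndex U (placed (f ψ)) (avoids ψ) ×
              funToFin (occupancy (f φ)) ≡ funToFin (occupancy (f ψ))
      split = Fin.combine-injective _ _ _ _ eq

-- Numerical constants of the lower bound

shrink-≥ : ∀ {x z w t n} .{{_ : NonZero z}} → x ≤ z → t ≤ n → z ^ n ≤ w * x ^ n → z ^ t ≤ w * x ^ t
shrink-≥ {x} {z} {w} {t} {n} x≤z t≤n le = *-cancelʳ-≤ _ _ (z ^ d) {{m^n≢0 z d}} (begin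
  z ^ t * z ^ d         ≡⟨ ^-distribˡ-+-* z t d ⟨
  z ^ (t + d)           ≡⟨ cong (z ^_) (m+[n∸m]≡n t≤n) ⟩
  z ^ n                 ≤⟨ le ⟩
  w * x ^ n             ≡⟨ cong (λ n → w * x ^ n) (m+[n∸m]≡n t≤n) ⟨
  w * x ^ (t + d)       ≡⟨ cong (w *_) (^-distribˡ-+-* x t d) ⟩
  w * (x ^ t * x ^ d)   ≡⟨ *-assoc w (x ^ t) (x ^ d) ⟨
  w * x ^ t * x ^ d     ≤⟨ *-monoʳ-≤ (w * x ^ t) (^-monoˡ-≤ d x≤z) ⟩
  w * x ^ t * z ^ d     ∎)
  where
  open ≤-Reasoning
  d : ℕ
  d = n ∸ t

-- Excluding J_r for r = side h leaves growth rate at least 2 ^ h.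
side : ℕ → ℕ
side h = h * 120 * (h * 67)

module _ (h : ℕ) .{{_ : NonZero h}} where
  open ≤-Reasoning
  private
    1≤h : 1 ≤ h
    1≤h = >-nonZero⁻¹ h

    Q q z r : ℕ
    -- A cell lies in `(16h + 1)(6h + 1) ≤ 120 h²` pairs, and `(1 - 1/Q)^(60h) ≥ 1/2`; hence it
    -- survives with probability at least `2^(-2h)`.
    Q = h * 120
    q = pred Q
    -- With `m = side h`, the `2^(22h)` cells times at most `2^(44 h m)` bicliques amount to at most
    -- `66 h m` bits; the survival exponent `m²/Q = z m` supplies `67 h m`.
    z = h * 67
    r = pred (side h)

    instance
      Q≢0 : NonZero Q
      Q≢0 = m*n≢0 h 120

      z≢0 : NonZero z
      z≢0 = m*n≢0 h 67

      side≢0 : NonZero (side h)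
      side≢0 = m*n≢0 Q z

    suc-q : suc q ≡ Q
    suc-q = suc-pred Q

    suc-r : suc r ≡ side h
    suc-r = suc-pred (side h)

    q≢0 : NonZero q
    q≢0 = >-nonZero (<⇒≤pred (*-mono-≤ {1} {h} {2} {120} 1≤h (s≤s (s≤s z≤n))))

    levels≤ : ∀ a b → suc a ≤ b → suc (h * a) ≤ h * b
    levels≤ a b a<b = begin
      1 + h * a       ≤⟨ +-monoˡ-≤ (h * a) 1≤h ⟩
      h + h * a       ≡⟨ *-suc h a ⟨
      h * suc a       ≤⟨ *-monoʳ-≤ h a<b ⟩
      h * b           ∎

    merge : ∀ a b → 2 ^ (h * a) * 2 ^ (h * b) ≡ 2 ^ (h * (a + b))
    merge a b = trans (sym (^-distribˡ-+-* 2 (h * a) (h * b))) (cong (2 ^_) (sym (*-distribˡ-+ h a b)))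

    t≤ : suc (h * 16) * suc (h * 6) ≤ h * 60 * (h * 2)
    t≤ = begin
      suc (h * 16) * suc (h * 6) ≤⟨ *-mono-≤ (levels≤ 16 17 ≤-refl) (levels≤ 6 7 ≤-refl) ⟩
      h * 17 * (h * 7)           ≡⟨ [m*n]*[o*p]≡[m*o]*[n*p] h 17 h 7 ⟩
      h * h * 119                ≤⟨ *-monoʳ-≤ (h * h) (n≤1+n 119) ⟩
      h * h * 120                ≡⟨ [m*n]*[o*p]≡[m*o]*[n*p] h 60 h 2 ⟨
      h * 60 * (h * 2)           ∎

    many : suc (pred (2 ^ (h * 20))) * suc q ^ (suc (h * 16) * suc (h * 6)) ≤
           2 ^ (h * 16) * 2 ^ (h * 6) * q ^ (suc (h * 16) * suc (h * 6))
    many = begin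
      suc (pred (2 ^ (h * 20))) * suc q ^ t ≡⟨ cong₂ (λ a b → a * b ^ t) (suc-pred (2 ^ (h * 20)) {{m^n≢0 2 (h * 20)}}) suc-q ⟩
      2 ^ (h * 20) * Q ^ t                  ≤⟨ *-monoʳ-≤ (2 ^ (h * 20)) (shrink-≥ {q} {Q} {2 ^ (h * 2)} (pred[n]≤n {Q}) t≤ halved) ⟩
      2 ^ (h * 20) * (2 ^ (h * 2) * q ^ t)  ≡⟨ *-assoc (2 ^ (h * 20)) (2 ^ (h * 2)) (q ^ t) ⟨
      2 ^ (h * 20) * 2 ^ (h * 2) * q ^ t    ≡⟨ cong (_* q ^ t) (merge 20 2) ⟩
      2 ^ (h * 22) * q ^ t                  ≡⟨ cong (_* q ^ t) (merge 16 6) ⟨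
      2 ^ (h * 16) * 2 ^ (h * 6) * q ^ t    ∎
      where
      t : ℕ
      t = suc (h * 16) * suc (h * 6)
      q+1≡Q : q + 1 ≡ Q
      q+1≡Q = trans (+-comm q 1) suc-q
      half : Q ^ (h * 60) ≤ q ^ (h * 60) * 2
      half = subst (λ Q → Q ^ (h * 60) ≤ q ^ (h * 60) * 2) q+1≡Q (halving (h * 60) q 1 {{subst NonZero (sym q+1≡Q) Q≢0}} (begin
        2 * (h * 60 * 1)   ≡⟨ cong (2 *_) (*-identityʳ (h * 60)) ⟩
        2 * (h * 60)       ≡⟨ *-comm 2 (h * 60) ⟩
        h * 60 * 2         ≡⟨ *-assoc h 60 2 ⟩
        Q                  ≡⟨ q+1≡Q ⟨
        q + 1              ∎))
      halved : Q ^ (h * 60 * (h * 2)) ≤ 2 ^ (h * 2) * q ^ (h * 60 * (h * 2))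
      halved = ≤-trans (iterate-≥ (h * 60) (h * 2) half) (≤-reflexive (*-comm (q ^ (h * 60 * (h * 2))) (2 ^ (h * 2))))

    few : 2 ^ (h * 16) * 2 ^ (h * 6) * ((suc (h * 16) * 2 ^ (h * 16)) ^ suc r * (suc (h * 6) * 2 ^ (h * 6)) ^ suc r) * q ^ (suc r * suc r) <
          suc q ^ (suc r * suc r)
    few = begin-strict
      2 ^ (h * 16) * 2 ^ (h * 6) * ((suc (h * 16) * 2 ^ (h * 16)) ^ suc r * (suc (h * 6) * 2 ^ (h * 6)) ^ suc r) * q ^ (suc r * suc r)
        ≡⟨ cong (λ r → 2 ^ (h * 16) * 2 ^ (h * 6) * ((suc (h * 16) * 2 ^ (h * 16)) ^ r * (suc (h * 6) * 2 ^ (h * 6)) ^ r) * q ^ (r * r)) suc-r ⟩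
      2 ^ (h * 16) * 2 ^ (h * 6) * ((suc (h * 16) * 2 ^ (h * 16)) ^ m * (suc (h * 6) * 2 ^ (h * 6)) ^ m) * q ^ (m * m)
        ≤⟨ *-monoˡ-≤ (q ^ (m * m)) (*-mono-≤ (≤-reflexive (merge 16 6)) (≤-trans (*-mono-≤ (^-monoˡ-≤ m (nodes 16)) (^-monoˡ-≤ m (nodes 6)))
             (≤-reflexive (trans (sym (^-distribʳ-* m (2 ^ (h * 32)) (2 ^ (h * 12)))) (trans (cong (_^ m) (merge 32 12)) (^-*-assoc 2 (h * 44) m)))))) ⟩
      2 ^ (h * 22) * 2 ^ (h * 44 * m) * q ^ (m * m)
        ≡⟨ cong (_* q ^ (m * m)) (^-distribˡ-+-* 2 (h * 22) (h * 44 * m)) ⟨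
      2 ^ (h * 22 + h * 44 * m) * q ^ (m * m)
        <⟨ *-monoˡ-< (q ^ (m * m)) {{m^n≢0 q (m * m) {{q≢0}}}} (^-monoʳ-< 2 (s≤s (s≤s z≤n)) exponent) ⟩
      2 ^ (z * m) * q ^ (m * m)
        ≡⟨ *-comm (2 ^ (z * m)) (q ^ (m * m)) ⟩
      q ^ (m * m) * 2 ^ (z * m)
        ≡⟨ cong (λ e → q ^ e * 2 ^ (z * m)) (*-assoc Q z m) ⟩
      q ^ (Q * (z * m)) * 2 ^ (z * m)
        ≤⟨ iterate-≤ Q (z * m) (doubling Q q 1 {{q≢0}} (≤-trans (pred[n]≤n {Q}) (≤-reflexive (sym (*-identityʳ Q))))) ⟩
      (q + 1) ^ (Q * (z * m))
        ≡⟨ cong₂ _^_ (+-comm q 1) (sym (trans (cong (λ m → m * m) suc-r) (*-assoc Q z m))) ⟩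
      suc q ^ (suc r * suc r) ∎
      where
      m : ℕ
      m = side h
      nodes : ∀ a → suc (h * a) * 2 ^ (h * a) ≤ 2 ^ (h * (a + a))
      nodes a = ≤-trans (*-monoˡ-≤ (2 ^ (h * a)) (n<2^n (h * a))) (≤-reflexive (merge a a))
      exponent : h * 22 + h * 44 * m < z * m
      exponent = begin-strict
        h * 22 + h * 44 * m       ≤⟨ +-monoˡ-≤ (h * 44 * m) (m≤m*n (h * 22) m) ⟩
        h * 22 * m + h * 44 * m   ≡⟨ *-distribʳ-+ m (h * 22) (h * 44) ⟨
        (h * 22 + h * 44) * m     ≡⟨ cong (_* m) (*-distribˡ-+ h 22 44) ⟨
        h * 66 * m                <⟨ *-monoˡ-< m (*-monoʳ-< h (n<1+n 66)) ⟩
        z * m                     ∎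

  -- In units of `h` the exponents are 16 for rows, 6 for columns, 12 for chosen rows and 2 for the
  -- ones used in each. Both `12 + 6` and `16 + 2` stay below 20, the exponent of the number of
  -- ones. As `C * C = R`, the occupancies cost at most `2^(h R)`, half of the exponent of `d ^ R`.
  exponential-lower-bound : ∀ {ρ s k} → 3 * side h ≤ ρ → ∃ λ m → 2 ^ (h * suc m) ≤ S (suc m) (gridSet ρ s k)
  exponential-lower-bound {ρ} {s} {k} 3r≤ρ = pred R , subst (λ R → 2 ^ (h * R) ≤ S R (gridSet ρ s k)) (sym (suc-pred R {{R≢0}})) bound
    where
    dense : ∃ λ (A : Matrix (2 ^ (h * 16)) (2 ^ (h * 6))) → pred (2 ^ (h * 20)) < ones A × ¬ Minor (suc r) A
    dense = dense-minor-free (h * 16) (h * 6) r q (pred (2 ^ (h * 20))) many few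
    A : Matrix (2 ^ (h * 16)) (2 ^ (h * 6))
    A = proj₁ dense
    R C d N : ℕ
    R = 2 ^ (h * 12)
    C = 2 ^ (h * 6)
    d = 2 ^ (h * 2)
    N = 2 ^ (h * 16)
    R≢0 : NonZero R
    R≢0 = m^n≢0 2 (h * 12)
    sparse : R * C + N * d < ones A
    sparse = begin-strict
      R * C + N * d                 ≡⟨ cong₂ _+_ (merge 12 6) (merge 16 2) ⟩
      2 ^ (h * 18) + 2 ^ (h * 18)   ≡⟨ cong (2 ^ (h * 18) +_) (+-identityʳ (2 ^ (h * 18))) ⟨
      2 ^ (1 + h * 18)              ≤⟨ ^-monoʳ-≤ 2 (levels≤ 18 19 ≤-refl) ⟩
      2 ^ (h * 19)                  ≤⟨ <⇒≤pred (^-monoʳ-< 2 (s≤s (s≤s z≤n)) (*-monoʳ-< h (n<1+n 19))) ⟩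
      pred (2 ^ (h * 20))           <⟨ proj₁ (proj₂ dense) ⟩
      ones A                        ∎
    occupancies : suc R ^ C ≤ 2 ^ (h * R)
    occupancies = begin
      suc R ^ C                ≤⟨ ^-monoˡ-≤ C (begin
        1 + R                  ≤⟨ +-monoˡ-≤ R (m^n>0 2 (h * 12)) ⟩
        R + R                  ≡⟨ cong (R +_) (+-identityʳ R) ⟨
        2 ^ (1 + h * 12)       ≤⟨ ^-monoʳ-≤ 2 (levels≤ 12 13 ≤-refl) ⟩
        2 ^ (h * 13)           ∎) ⟩
      (2 ^ (h * 13)) ^ C       ≡⟨ ^-*-assoc 2 (h * 13) C ⟩
      2 ^ (h * 13 * C)         ≤⟨ ^-monoʳ-≤ 2 (begin
        h * 13 * C             ≡⟨ *-assoc h 13 C ⟩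
        h * (13 * C)           ≤⟨ *-monoʳ-≤ h (*-monoˡ-≤ C 13≤C) ⟩
        h * (C * C)            ≡⟨ cong (h *_) (merge 6 6) ⟩
        h * R                  ∎) ⟩
      2 ^ (h * R)              ∎
      where
      13≤C : 13 ≤ C
      13≤C = ≤-trans (m≤m+n 13 51) (^-monoʳ-≤ 2 {6} (m≤n*m 6 h))
    bound : 2 ^ (h * R) ≤ S R (gridSet ρ s k)
    bound = *-cancelʳ-≤ _ _ (2 ^ (h * R)) {{m^n≢0 2 (h * R)}} (begin
      2 ^ (h * R) * 2 ^ (h * R)                ≡⟨ ^-distribˡ-+-* 2 (h * R) (h * R) ⟨
      2 ^ (h * R + h * R)                      ≡⟨ cong (2 ^_) (twice h R) ⟩
      2 ^ (h * 2 * R)                          ≡⟨ ^-*-assoc 2 (h * 2) R ⟨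
      d ^ R                                    ≤⟨ choices≤ A (proj₂ (proj₂ dense)) (subst (λ r → 3 * r ≤ ρ) (sym suc-r) 3r≤ρ) R d sparse ⟩
      S R (gridSet ρ s k) * suc R ^ C          ≤⟨ *-monoʳ-≤ (S R (gridSet ρ s k)) occupancies ⟩
      S R (gridSet ρ s k) * 2 ^ (h * R)        ∎)
      where
      twice : ∀ h R → h * R + h * R ≡ h * 2 * R
      twice = solve-∀

-- The choice of parameters

module Threshold where
  open ≤-Reasoning

  private
    positive-cases : ∀ {P : ℕ → Set} → P 0 → (∀ h .{{_ : NonZero h}} → P h) → ∀ h → P h
    positive-cases P₀ P₊ zero    = P₀
    positive-cases P₀ P₊ (suc h) = P₊ (suc h)

    side-mono : ∀ {h h′} → h ≤ h′ → side h ≤ side h′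
    side-mono h≤h′ = *-mono-≤ (*-monoˡ-≤ 120 h≤h′) (*-monoˡ-≤ 67 h≤h′)

    h≤side : ∀ h → h ≤ side h
    h≤side = positive-cases {λ h → h ≤ side h} z≤n λ h →
      ≤-trans (m≤m*n h 120) (m≤m*n (h * 120) (h * 67) {{m*n≢0 h 67}})

  -- These functions are abstract because unfolding them multiplies by large numerals.
  abstract
    blocks : ℕ → ℕ
    blocks h = 3 * side h

    -- The largest h with threshold h * log₂ k ≤ k governs the construction for k-permutations.
    threshold : ℕ → ℕ
    threshold h = 32 * (blocks h * blocks h)

    blocks≡ : ∀ h → 3 * side h ≡ blocks h
    blocks≡ h = refl

    threshold≡ : ∀ h → 32 * (blocks h * blocks h) ≡ threshold h
    threshold≡ h = refl

  blocks-mono : ∀ {h h′} → h ≤ h′ → blocks h ≤ blocks h′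
  blocks-mono {h} {h′} h≤h′ = subst₂ _≤_ (blocks≡ h) (blocks≡ h′) (*-monoʳ-≤ 3 (side-mono h≤h′))

  threshold-mono : ∀ {h h′} → h ≤ h′ → threshold h ≤ threshold h′
  threshold-mono {h} {h′} h≤h′ = subst₂ _≤_ (threshold≡ h) (threshold≡ h′)
    (*-monoʳ-≤ 32 (*-mono-≤ (blocks-mono h≤h′) (blocks-mono h≤h′)))

  h≤blocks : ∀ h → h ≤ blocks h
  h≤blocks h = ≤-trans (h≤side h) (subst (side h ≤_) (blocks≡ h) (m≤n*m (side h) 3))

  3≤blocks : ∀ h → 1 ≤ h → 3 ≤ blocks h
  3≤blocks h 1≤h = subst (3 ≤_) (blocks≡ h) (*-monoʳ-≤ 3 (≤-trans 1≤h (h≤side h)))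

  square≤threshold : ∀ h → blocks h * blocks h ≤ threshold h
  square≤threshold h = subst (blocks h * blocks h ≤_) (threshold≡ h) (m≤n*m (blocks h * blocks h) 32)

  h≤threshold : ∀ h → h ≤ threshold h
  h≤threshold = positive-cases {λ h → h ≤ threshold h} z≤n λ h → ≤-trans
    (≤-trans (h≤blocks h) (m≤m*n (blocks h) (blocks h) {{>-nonZero (≤-trans (>-nonZero⁻¹ h) (h≤blocks h))}})) (square≤threshold h)

  binary-length : ∀ k → ∃ λ g → 2 ^ g ≤ suc k × suc k < 2 ^ suc g
  binary-length zero    = 0 , ≤-refl , ≤-refl
  binary-length (suc k) with binary-length k
  ... | g , 2^g≤ , <2^ with m≤n⇒m<n∨m≡n <2^
  ...   | inj₁ lt = g , m≤n⇒m≤1+n 2^g≤ , lt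
  ...   | inj₂ eq = suc g , ≤-reflexive (sym eq) , (begin-strict
    suc (suc k)                    ≡⟨ eq ⟩
    2 ^ suc g                     <⟨ ^-monoʳ-< 2 (s≤s (s≤s z≤n)) (n<1+n (suc g)) ⟩
    2 ^ suc (suc g)               ∎)

  largest : ∀ g k .{{_ : NonZero g}} → ∃ λ h → threshold h * g ≤ k × k < threshold (suc h) * g
  largest g k = search k (≤-trans (h≤threshold (suc k)) (m≤m*n (threshold (suc k)) g))
    where
    search : ∀ n → k < threshold (suc n) * g → ∃ λ h → threshold h * g ≤ k × k < threshold (suc h) * g
    search zero    lt = 0 , subst (λ t → t * g ≤ k) (threshold≡ 0) (subst (λ b → 32 * (b * b) * g ≤ k) (blocks≡ 0) z≤n) , lt
    search (suc n) lt with threshold (suc n) * g ≤? k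
    ... | yes le = suc n , le , lt
    ... | no  gt = search n (≰⇒> gt)

  -- The base case is `3 F² ≤ (F + 1)³ ≤ 2^(3F)`; afterwards the left side grows by `F` while the
  -- right side doubles. This makes the height tend to infinity.
  2^-beats-linear : ∀ F j → F * (3 * F + j) ≤ 2 ^ (3 * F + j)
  2^-beats-linear F zero    = begin
    F * (3 * F + 0)          ≤⟨ m≤m+n _ (F * F * F + 3 * F + 1) ⟩
    F * (3 * F + 0) + (F * F * F + 3 * F + 1) ≡⟨ cube F ⟩
    suc F * (suc F * (suc F * 1)) ≤⟨ ^-monoˡ-≤ 3 (n<2^n F) ⟩
    (2 ^ F) ^ 3            ≡⟨ ^-*-assoc 2 F 3 ⟩
    2 ^ (F * 3)             ≡⟨ cong (2 ^_) (trans (*-comm F 3) (sym (+-identityʳ (3 * F)))) ⟩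
    2 ^ (3 * F + 0)         ∎
    where
    cube : ∀ F → F * (3 * F + 0) + (F * F * F + 3 * F + 1) ≡ suc F * (suc F * (suc F * 1))
    cube = solve-∀
  2^-beats-linear F (suc j) = begin
    F * (3 * F + suc j)      ≡⟨ step F j ⟩
    F * (3 * F + j) + F      ≤⟨ +-mono-≤ (2^-beats-linear F j) (≤-trans (<⇒≤ (n<2^n F)) (^-monoʳ-≤ 2 (≤-trans (m≤n*m F 3) (m≤m+n (3 * F) j)))) ⟩
    2 ^ e + 2 ^ e          ≡⟨ cong (λ z → 2 ^ e + z) (+-identityʳ (2 ^ e)) ⟨
    2 ^ suc e               ≡⟨ cong (2 ^_) (+-suc (3 * F) j) ⟨
    2 ^ (3 * F + suc j)     ∎
    where
    e : ℕ
    e = 3 * F + j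
    step : ∀ F j → F * (3 * F + suc j) ≡ F * (3 * F + j) + F
    step = solve-∀

  -- Here 1200 originates. With `h + 1 ≤ 2h` and `x = 240 h`, the number of blocks is at most
  -- `3 x²`, so the threshold is at most `32 * 9 * x⁴ ≤ (5 x)⁴`, and `5 x = 1200 h`.
  threshold≤ : ∀ Q h .{{_ : NonZero h}} → 1200 ≤ Q → threshold (suc h) ≤ (Q * h) ^ 4
  threshold≤ Q h 1200≤Q = begin
    threshold (suc h)                          ≤⟨ threshold-mono (≤-trans (+-monoˡ-≤ h (>-nonZero⁻¹ h)) (≤-reflexive (twice h))) ⟩
    threshold (h * 2)                          ≡⟨ threshold≡ (h * 2) ⟨
    32 * (blocks (h * 2) * blocks (h * 2))     ≤⟨ *-monoʳ-≤ 32 (*-mono-≤ coarse coarse) ⟩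
    32 * (3 * (x * x) * (3 * (x * x)))         ≡⟨ regroup 32 3 x ⟩
    288 * (x ^ 4)                             ≤⟨ *-monoˡ-≤ (x ^ 4) (m≤m+n 288 337) ⟩
    5 ^ 4 * x ^ 4                            ≡⟨ ^-distribʳ-* 4 5 x ⟨
    (5 * x) ^ 4                               ≤⟨ ^-monoˡ-≤ 4 (begin
      5 * x                                    ≡⟨ *-comm 5 x ⟩
      h * 240 * 5                              ≡⟨ *-assoc h 240 5 ⟩
      h * 1200                                 ≤⟨ *-monoʳ-≤ h 1200≤Q ⟩
      h * Q                                    ≡⟨ *-comm h Q ⟩
      Q * h                                    ∎) ⟩
    (Q * h) ^ 4                               ∎
    where
    x : ℕ
    x = h * 240
    twice : ∀ h → h + h ≡ h * 2
    twice = solve-∀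
    coarse : blocks (h * 2) ≤ 3 * (x * x)
    coarse = subst (_≤ 3 * (x * x)) (blocks≡ (h * 2)) (*-monoʳ-≤ 3 (*-mono-≤ (≤-reflexive (*-assoc h 2 120)) (≤-trans (≤-reflexive (*-assoc h 2 67)) (*-monoʳ-≤ h (m≤m+n 134 106)))))
    regroup : ∀ a b x → a * (b * (x * x) * (b * (x * x))) ≡ a * (b * b) * (x * (x * (x * (x * 1))))
    regroup = solve-∀

open Threshold

record Scale (k h : ℕ) : Set where
  field
    g      : ℕ
    1≤g    : 1 ≤ g
    2^g≤k  : 2 ^ g ≤ k
    k<2^   : k < 2 ^ suc g
    ≤k     : threshold h * g ≤ k
    k<     : k < threshold (suc h) * g

abstract
  -- The reciprocal of the constant in the exponent; its size is dictated by `threshold≤`.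
  constant : ℕ
  constant = 1200

  1200≤constant : 1200 ≤ constant
  1200≤constant = ≤-refl

  instance
    constant≢0 : NonZero constant
    constant≢0 = _

scale : ∀ k → 2 ≤ k → ∃ λ h → Scale k h
scale k 2≤k = proj₁ greatest , record
  { g = g ; 1≤g = 1≤g ; 2^g≤k = 2^g≤k ; k<2^ = k<2^
  ; ≤k = proj₁ (proj₂ greatest) ; k< = proj₂ (proj₂ greatest) }
  where
  bits : ∃ λ g → 2 ^ g ≤ k × k < 2 ^ suc g
  bits = subst (λ k → ∃ λ g → 2 ^ g ≤ k × k < 2 ^ suc g)
    (suc-pred k {{>-nonZero (≤-trans (s≤s z≤n) 2≤k)}}) (binary-length (pred k))
  g : ℕ
  g = proj₁ bits
  2^g≤k : 2 ^ g ≤ k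
  2^g≤k = proj₁ (proj₂ bits)
  k<2^ : k < 2 ^ suc g
  k<2^ = proj₂ (proj₂ bits)
  1≤g : 1 ≤ g
  1≤g = ≮⇒≥ λ g<1 → <⇒≱ k<2^ (≤-trans (^-monoʳ-≤ 2 g<1) 2≤k)
  greatest : ∃ λ h → threshold h * g ≤ k × k < threshold (suc h) * g
  greatest = largest g k {{>-nonZero 1≤g}}

scales : ∀ k → ∃ λ h → 2 ≤ k → Scale k h
scales k with 2 ≤? k
... | yes 2≤k = proj₁ (scale k 2≤k) , λ _ → proj₂ (scale k 2≤k)
-- A default height for `k < 2`, so that the sets are defined for every `k`.
... | no  2≰k = 0 , λ 2≤k → contradiction 2≤k 2≰k

height : ℕ → ℕ
height k = proj₁ (scales k)

scale-of : ∀ k → 2 ≤ k → Scale k (height k)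
scale-of k = proj₂ (scales k)

abstract
  onset : ℕ → ℕ
  onset H = 2 ^ suc (3 * threshold H)

  onset≡ : ∀ H → onset H ≡ 2 ^ suc (3 * threshold H)
  onset≡ H = refl

2≤onset : ∀ H → 2 ≤ onset H
2≤onset H = subst (2 ≤_) (sym (onset≡ H)) (^-monoʳ-≤ 2 {1} {suc (3 * threshold H)} (s≤s z≤n))

-- Were the height below `H`, then `k < F * g` with `F = threshold H`; but `onset H` forces
-- `3 * F ≤ g`, and then `F * g ≤ 2 ^ g ≤ k`.
height-large : ∀ H k → onset H ≤ k → H ≤ height k
height-large H k K≤k = ≮⇒≥ λ h<H → <⇒≱ (k< sc) (begin
  threshold (suc (height k)) * g sc         ≤⟨ *-monoˡ-≤ (g sc) (threshold-mono h<H) ⟩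
  F * g sc                                  ≡⟨ cong (F *_) (m+[n∸m]≡n 3F≤g) ⟨
  F * (3 * F + (g sc ∸ 3 * F))              ≤⟨ 2^-beats-linear F (g sc ∸ 3 * F) ⟩
  2 ^ (3 * F + (g sc ∸ 3 * F))             ≡⟨ cong (2 ^_) (m+[n∸m]≡n 3F≤g) ⟩
  2 ^ g sc                                 ≤⟨ 2^g≤k sc ⟩
  k                                         ∎)
  where
  open ≤-Reasoning
  open Scale
  F : ℕ
  F = threshold H
  sc : Scale k (height k)
  sc = scale-of k (≤-trans (2≤onset H) K≤k)
  3F≤g : 3 * F ≤ g sc
  3F≤g = ≮⇒≥ λ g<3F → <⇒≱ (k<2^ sc) (≤-trans (^-monoʳ-≤ 2 (<⇒≤ (s≤s g<3F))) (≤-trans (≤-reflexive (sym (onset≡ H))) K≤k))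

-- The divisor `ρ + 1` is positive even at height zero, and it leaves at most `s + ρ` positions and
-- values outside the grid.
cellSize : ℕ → ℕ
cellSize k = k ℕ./ suc (blocks (height k))

U : ∀ k → PermutationSet k
U k = gridSet (blocks (height k)) (cellSize k) k

module Bounds (k : ℕ) (2≤k : 2 ≤ k) (1≤h : 1 ≤ height k) where
  open Scale (scale-of k 2≤k)
  open ≤-Reasoning

  h ρ s y : ℕ
  h = height k
  ρ = blocks h
  s = cellSize k
  -- As `k < 2 ^ suc g`, this gives `k * k ≤ 2 ^ y`, enough to dominate `ρ * ρ * h`.
  y = 2 * suc g

  3≤ρ : 3 ≤ ρ
  3≤ρ = 3≤blocks h 1≤h

  1≤ρ : 1 ≤ ρ
  1≤ρ = ≤-trans (s≤s z≤n) 3≤ρ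

  -- The factor 32 of `threshold` is used up here: 8 from `4 * 2`, doubled for `1 + g ≤ 2 g` and
  -- doubled again for `1 + ρ ≤ 2 ρ`.
  4ρy≤s : 4 * ρ * y ≤ s
  4ρy≤s = subst (_≤ s) (m*n/n≡m (4 * ρ * y) (suc ρ)) (/-monoˡ-≤ (suc ρ) (begin
    4 * ρ * (2 * (1 + g)) * (1 + ρ)   ≤⟨ *-mono-≤ (*-monoʳ-≤ (4 * ρ) (*-monoʳ-≤ 2 (+-monoˡ-≤ g 1≤g))) (+-monoˡ-≤ ρ 1≤ρ) ⟩
    4 * ρ * (2 * (g + g)) * (ρ + ρ)   ≡⟨ collect 4 ρ g ⟩
    32 * (ρ * ρ) * g                  ≡⟨ cong (_* g) (threshold≡ h) ⟩
    threshold h * g                   ≤⟨ ≤k ⟩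
    k                                 ∎))
    where
    collect : ∀ a r g → a * r * (2 * (g + g)) * (r + r) ≡ a * 8 * (r * r) * g
    collect = solve-∀

  ρ≤s : ρ ≤ s
  ρ≤s = ≤-trans (≤-trans (m≤n*m ρ 4) (m≤m*n (4 * ρ) y)) 4ρy≤s

  1≤s : 1 ≤ s
  1≤s = ≤-trans 1≤ρ ρ≤s

  ρs≤k : ρ * s ≤ k
  ρs≤k = ≤-trans (≤-reflexive (*-comm ρ s)) (≤-trans (*-monoʳ-≤ s (n≤1+n ρ)) (m/n*n≤m k (suc ρ)))

  k≤ : k ≤ ρ * s + s + ρ
  k≤ = begin
    k                                 ≡⟨ m≡m%n+[m/n]*n k (suc ρ) ⟩
    k ℕ.% suc ρ + s * suc ρ           ≤⟨ +-monoˡ-≤ (s * suc ρ) (≤-pred (m%n<n k (suc ρ))) ⟩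
    ρ + s * suc ρ                     ≡⟨ collect ρ s ⟩
    ρ * s + s + ρ                     ∎
    where
    collect : ∀ r s → r + s * suc r ≡ r * s + s + r
    collect = solve-∀

  ρρh≤ : ρ * ρ * h ≤ 2 ^ y
  ρρh≤ = begin
    ρ * ρ * h                    ≤⟨ *-mono-≤ ρρ≤k (≤-trans (h≤blocks h) (≤-trans (m≤m*n ρ ρ {{>-nonZero 1≤ρ}}) ρρ≤k)) ⟩
    k * k                        ≤⟨ *-mono-≤ (<⇒≤ k<2^) (<⇒≤ k<2^) ⟩
    2 ^ suc g * 2 ^ suc g      ≡⟨ ^-distribˡ-+-* 2 (suc g) (suc g) ⟨
    2 ^ (suc g + suc g)         ≡⟨ cong (λ z → 2 ^ (suc g + z)) (+-identityʳ (suc g)) ⟨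
    2 ^ y                       ∎
    where
    ρρ≤k : ρ * ρ ≤ k
    ρρ≤k = ≤-trans (square≤threshold h) (≤-trans (m≤m*n (threshold h) g {{>-nonZero 1≤g}}) ≤k)

  U-size : k ! * h ≤ size (U k) * h + 5 * k !
  U-size = gridSet-size ρ s k h y 3≤ρ ρ≤s (h≤blocks h) ρs≤k k≤ 4ρy≤s ρρh≤

  U-indecomposable : All SkewIndecomposable (elements (U k))
  U-indecomposable = All.map (λ {π} → Grid⇒SkewIndecomposable (≤-trans (s≤s (s≤s z≤n)) 3≤ρ) 1≤s ρs≤k π) (gridSet-Grid ρ s k)

-- Density of the sets, their growth rates and the conclusion

open import Data.Integer using (+_)
open import Data.Rational using (_/_; ↧ₙ_)

size≤! : ∀ k → size (U k) ≤ k !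
size≤! k = ≤-trans (length-filter (good? (blocks (height k)) (cellSize k) k) (permutations k)) (≤-reflexive (length-permutations k))

U-almost-everything : (λ k → fromℚ ((+ size (U k) / k !) {{k !≢0}})) ⟶ 1ℝ
U-almost-everything ε 0<ε = onset H , λ k K≤k →
    let H≤h = height-large H k K≤k
        2≤k = ≤-trans (2≤onset H) K≤k
    in ratio-near-1 (size (U k)) (k !) (height k) {{k !≢0}} 0<ε (size≤! k)
         (Bounds.U-size k 2≤k (≤-trans (s≤s z≤n) H≤h)) H≤h
  where
  H : ℕ
  H = suc (5 * ↧ₙ ε)

-- A missing proportion of `5/h` is less than one from height 6 on, which fixes `k₀ = onset 6`. The
-- Marcus-Tardos bound needs such a member.
U-nonempty : ∀ k → onset 6 ≤ k → ∃ λ π → π ∈ˡ elements (U k)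
U-nonempty k K≤k = member (elements (U k)) (≰⇒> λ size≤0 → <⇒≱ (*-monoˡ-< (k !) {{k !≢0}} (n<1+n 5)) (begin
  6 * k !                           ≡⟨ *-comm 6 (k !) ⟩
  k ! * 6                           ≤⟨ *-monoʳ-≤ (k !) 6≤h ⟩
  k ! * height k                    ≤⟨ Bounds.U-size k (≤-trans (2≤onset 6) K≤k) (≤-trans (s≤s z≤n) 6≤h) ⟩
  size (U k) * height k + 5 * k !   ≤⟨ +-monoˡ-≤ (5 * k !) (*-monoˡ-≤ (height k) size≤0) ⟩
  5 * k !                           ∎))
  where
  open ≤-Reasoning
  6≤h : 6 ≤ height k
  6≤h = height-large 6 k K≤k
  member : (xs : List (Permutation′ k)) → 0 < length xs → ∃ λ x → x ∈ˡ xs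
  member (x ∷ xs) _ = x , here refl

-- Supplies the positivity at lengths 0 and 1 that Fekete's lemma starts from.
small-avoids : ∀ {k} n → n < k → (V : PermutationSet k) → 1 ≤ S n V
small-avoids {k} n n<k V = avoiders≥ V (const Permutation.id) (λ _ → All.universal (λ π (x , mono , _) →
  <⇒≱ n<k (Fin.injective⇒≤ {f = x} (increasing⇒injective x (λ {i} {j} → mono i j)))) (elements V)) λ { zero zero _ → refl }

module _ (em : ExcludedMiddle 0ℓ) (k : ℕ) (K≤k : onset 6 ≤ k) where
  private
    2≤k : 2 ≤ k
    2≤k = ≤-trans (2≤onset 6) K≤k

    1≤h : 1 ≤ height k
    1≤h = ≤-trans (s≤s z≤n) (height-large 6 k K≤k)

    instance
      k≢0 : NonZero k
      k≢0 = >-nonZero (≤-trans (s≤s z≤n) 2≤k)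
      h≢0 : NonZero (height k)
      h≢0 = >-nonZero 1≤h

    member : ∃ λ π → π ∈ˡ elements (U k)
    member = U-nonempty k K≤k

    sc : Scale k (height k)
    sc = scale-of k 2≤k

  module Growth = Fekete em (λ n → S n (U k)) (small-avoids 0 (≤-trans (s≤s z≤n) 2≤k) (U k)) (small-avoids 1 2≤k (U k))
    (supermultiplicative (U k) (Bounds.U-indecomposable k 2≤k 1≤h)) (MarcusTardos.growthBound k)
    (MarcusTardos.S-bounded k (U k) (proj₁ member) (proj₂ member))

  -- The single length found by `exponential-lower-bound` is already a witness in the supremum that
  -- defines the limit.
  growth-bound : exp₂ (fromℚ (unit constant) *ᴿ root 4 (n/log₂n k 2≤k)) ≤ᴿ Growth.limit
  growth-bound q q∈ =
    let x = fromℚ (unit constant) *ᴿ root 4 (n/log₂n k 2≤k)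
        m , 2^≤S = exponential-lower-bound (height k) {blocks (height k)} {cellSize k} {k} (≤-reflexive (blocks≡ (height k)))
        s , lt , q<s = exp₂-< x (height k) (exponent-bound constant (height k) (Scale.g sc) k {{constant≢0}} {{h≢0}} {{>-nonZero (Scale.1≤g sc)}} 2≤k (Scale.2^g≤k sc)
          (≤-trans (Scale.k< sc) (*-monoˡ-≤ (Scale.g sc) (threshold≤ constant (height k) 1200≤constant)))) m (S (suc m) (U k)) 2^≤S q q∈
    in s , inj₂ (m , lt) , q<s

theorem2 : ExcludedMiddle 0ℓ →
    Σ ℝ λ c → 0ℝ <ᴿ c ×
    Σ ℕ λ k₀ → Σ (2 ≤ k₀) λ 2≤k₀ →
    Σ ((k : ℕ) → PermutationSet k) λ U →
    ((λ k → fromℚ ((+ size (U k) / k !) {{k !≢0}})) ⟶ 1ℝ) ×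
    ((k : ℕ) (k₀≤k : k₀ ≤ k) →
    Σ ℝ λ L →
    ((λ n → root (suc n) (fromℕ (S (suc n) (U k)))) ⟶ L) ×
    exp₂ (c *ᴿ root 4 (n/log₂n k (≤-trans 2≤k₀ k₀≤k))) ≤ᴿ L)
theorem2 em = fromℚ (unit constant) , 0<unit constant , onset 6 , 2≤onset 6 , U , U-almost-everything ,
  λ k K≤k → Growth.limit em k K≤k , Growth.converges em k K≤k , growth-bound em k K≤k
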